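{- For every unsatisfiable formula $\Gamma$ let $m(\Gamma)=\lceil\log(\mathrm{size}_{\mathsf{SBC}^- }(\Gamma))\rceil$ and $\mathcal{K}(\Gamma)=\mathcal{I}_{m(\Gamma)}(\Gamma)$. Then the formulas $\mathcal{K}(\mathrm{BPHP}_n)$ admit $\mathsf{GER}^-$ proofs of size $n^{O(1)}$, but every $\mathsf{SBC}^-$ proof of $\mathcal{K}(\mathrm{BPHP}_n)$ has size $2^{\Omega(n)}$.
   Context: A literal is a variable $v$ or its negation $\bar v$. A clause is a nontautological set of literals; $\bot$ is the empty clause; a formula is a finite set of clauses; $\mathrm{var}(\Gamma)$ is its set of variables. For a set $L$ of literals, $\bar L=\{\bar\ell:\ell\in L\}$. $D$ is a weakening of $C$ if $C\subseteq D$. If $C\cup\{x\}$, $D\cup\{\bar x\}$ are clauses with $x,\bar x\notin C\cup D$ and $C\cup D$ nontautological, $C\cup D$ is their resolvent. For a clause $C$ and formula $\Delta$, $C\vee\Delta=\{C\cup D: D\in\Delta,\ C\cup D \text{ nontautological}\}$. Resolution proof of $\Gamma$: sequence of formulas $(\Gamma_1,\dots,\Gamma_N)$, $\Gamma_1=\Gamma$, $\bot\in\Gamma_N$, each $\Gamma_{i+1}=\Gamma_i\cup\{C\}$ with $C$ a resolvent of two clauses of $\Gamma_i$ or a weakening of a clause of $\Gamma_i$; size $N$. $C$ is a set-blocked clause (SBC) for nonempty $L\subseteq C$ w.r.t. $\Gamma$ if for every $D\in\Gamma$ with $D\cap\bar L\ne\varnothing$, $D\cap L=\varnothing$, the set $(C\setminus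 L)\cup(D\setminus\bar L)$ is tautological. An $\mathsf{SBC}$ proof is like a resolution proof but additionally allows adding a clause that is an SBC w.r.t. the current $\Gamma_i$; an $\mathsf{SBC}^-$ proof of $\Gamma$ uses only variables from $\mathrm{var}(\Gamma)$. $\mathrm{size}_{P}(\Gamma)$ is the minimum size of a $P$-proof of $\Gamma$. Blocked clause: $C=\{p\}\cup C'$ ($p\notin C'$) is blocked for $p$ w.r.t. $\Gamma$ if for every $\{\bar p\}\cup D'\in\Gamma$ ($\bar p\notin D'$), $C'\cup D'$ is tautological; $C$ is blocked w.r.t. $\Gamma$ if blocked for some $p\in C$. $\Lambda$ is a blocked extension for $\Gamma$ if there is $\Gamma'\subseteq\Gamma$ and an ordering $(C_1,\dots,C_r)$ of all clauses of $\Lambda\cup(\Gamma\setminus\Gamma')$ with each $C_i$ blocked w.r.t. $\Gamma'\cup\{C_1,\dots,C_{i-1}\}$. A $\mathsf{GER}$ proof of $\Gamma$ is a pair $(\Lambda,\Pi)$, $\Lambda$ a blocked extension for $\Gamma$, $\Pi$ a resolution proof of $\Gamma\cup\Lambda$; size $|\Lambda|+|\Pi|$; $\mathsf{GER}^-$ requires all variables of $\Lambda$ and $\Pi$ to lie in $\mathrm{var}(\Gamma)$. Extended resolution: for a formula $\Delta$, literals $p,q$ and a variable $x$ not occurring in $\Delta,p,q$, $\{\bar x\vee p,\ \bar x\vee q,\ x\vee\bar p\vee\bar q\}$ is a set of extension clauses for $\Delta$. $\Lambda$ is an extension for $\Gamma$ if $\Lambda=\bigcup_{i=1}^t\lambda_i$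 with each $\lambda_i$ a set of extension clauses for $\Gamma\cup\lambda_1\cup\dots\cup\lambda_{i-1}$. An $\mathsf{ER}$ proof of $\Gamma$ is a pair $(\Lambda,\Pi)$ with $\Lambda$ an extension for $\Gamma$ and $\Pi$ a resolution proof of $\Gamma\cup\Lambda$; size $|\Lambda|+|\Pi|$. Construction: for unsatisfiable $\Gamma$, fix a minimum-size $\mathsf{ER}$ proof $(\Lambda,\Pi)$ of $\Gamma$, $\Lambda$ being the union of $t(\Gamma)=|\Lambda|/3$ sets $\lambda_i=\{\bar x_i\vee p_i,\ \bar x_i\vee q_i,\ x_i\vee\bar p_i\vee\bar q_i\}$ with extension variables $x_1,\dots,x_{t(\Gamma)}$. For $m\in\mathbb{N}^+$ let $y_1,\dots,y_m,z_1,\dots,z_m$ be $2m$ distinct variables not in $\mathrm{var}(\Gamma\cup\Lambda)$, and define $V_m(\Gamma)=\bigcup_{i=1}^{t(\Gamma)}\bigcup_{j=1}^m\{x_i\vee y_j\vee\bar z_j,\ \bar x_i\vee y_j\vee\bar z_j\}$, $W_m(\Gamma)=\bigcup_{j=1}^m\big[\{\bar y_j\vee z_j\}\cup(y_j\vee\Gamma)\cup(\bar z_j\vee\Gamma)\big]$, $\mathcal{I}_m(\Gamma)=\Gamma\cup V_m(\Gamma)\cup W_m(\Gamma)$. Bit pigeonhole principle: for $n=2^k$, $k\ge1$, variables $p^x_\ell$ ($x\in[n+1]$, $\ell\in[k]$); writing "$v\neq0$" for $v$ and "$v\neq1$" for $\bar v$, $\mathrm{BPHP}_n$ is the set of clauses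 $\bigvee_{\ell=1}^k (p^x_\ell\neq h_\ell)\vee\bigvee_{\ell=1}^k(p^y_\ell\neq h_\ell)$ over all $x\ne y$ in $[n+1]$ and $h\in\{0,1\}^k$. For other $n\ge2$, $\mathrm{BPHP}_n:=\mathrm{BPHP}_m$ with $m$ the largest power of two $\le n$. $\log$ is base 2. -}

module Defs where

open import Data.Nat using (ℕ; zero; suc; _+_; _*_; _^_; _≤_; _<_; _≟_)
open import Data.Nat.Logarithm using (⌊log₂_⌋; ⌈log₂_⌉)
open import Data.Bool using (Bool; true; false; if_then_else_)
open import Data.List using (List; []; _∷_; _++_; map; concatMap; upTo; zip; length)
open import Data.List.Membership.Propositional using (_∈_; _∉_)
open import Data.Fin using (Fin)
open import Data.Product using (Σ; ∃; _×_; _,_)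
open import Data.Sum using (_⊎_)
open import Data.Unit using (⊤)
open import Data.Empty using (⊥)
open import Relation.Nullary using (¬_; does)
open import Relation.Binary.PropositionalEquality using (_≡_; _≢_)

Var : Set
Var = ℕ

data Lit : Set where
  pos : Var → Lit
  neg : Var → Lit

var : Lit → Var
var (pos v) = v
var (neg v) = v

_ᶜ : Lit → Lit
pos v ᶜ = neg v
neg v ᶜ = pos v

-- A clause is represented by a list of literals, read as the SET of its
-- elements (order and repetitions are irrelevant).  Genuine clauses are
-- nontautological (see IsClause).
Clause : Set
Clause = List Lit

-- A formula is a list of clauses, read as the SET of its elements.
Formula : Set
Formula = List Clause

_⊆ᶜ_ : Clause → Clause → Set
C ⊆ᶜ D = ∀ {l} → l ∈ C → l ∈ D

_≋_ : Clause → Clause → Set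
C ≋ D = (C ⊆ᶜ D) × (D ⊆ᶜ C)

_∈F_ : Clause → Formula → Set
C ∈F Γ = ∃ λ D → D ∈ Γ × D ≋ C

_⊆F_ : Formula → Formula → Set
Γ ⊆F Δ = ∀ {C} → C ∈F Γ → C ∈F Δ

Tautological : Clause → Set
Tautological C = ∃ λ l → l ∈ C × (l ᶜ) ∈ C

IsClause : Clause → Set
IsClause C = ¬ Tautological C

TautPred : (Lit → Set) → Set
TautPred S = ∃ λ l → S l × S (l ᶜ)

OccursIn : Var → Formula → Set
OccursIn v Γ = ∃ λ C → C ∈ Γ × ∃ λ l → l ∈ C × var l ≡ v

VarsIn : Clause → Formula → Set
VarsIn C Γ = ∀ {l} → l ∈ C → OccursIn (var l) Γ

Resolvent : Formula → Clause → Set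
Resolvent Δ C =
  ∃ λ A → ∃ λ B → ∃ λ l → A ∈ Δ × B ∈ Δ × l ∈ A × (l ᶜ) ∈ B ×
  (∀ l' → (l' ∈ C → (l' ∈ A × l' ≢ l) ⊎ (l' ∈ B × l' ≢ (l ᶜ)))
        × ((l' ∈ A × l' ≢ l) ⊎ (l' ∈ B × l' ≢ (l ᶜ)) → l' ∈ C)) ×
  IsClause C

Weakening : Formula → Clause → Set
Weakening Δ C = ∃ λ A → A ∈ Δ × A ⊆ᶜ C × IsClause C

ResRule : Formula → Clause → Set
ResRule Δ C = Resolvent Δ C ⊎ Weakening Δ C

SetBlockedFor : Formula → Clause → List Lit → Set
SetBlockedFor Δ C L =
  (∀ D → D ∈ Δ →
     (∃ λ l → l ∈ L × (l ᶜ) ∈ D) →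
     (∀ l → l ∈ L → l ∉ D) →
     TautPred (λ l → (l ∈ C × l ∉ L) ⊎ (l ∈ D × (l ᶜ) ∉ L)))

SetBlocked : Formula → Clause → Set
SetBlocked Δ C = IsClause C × ∃ λ L → (∃ λ l → l ∈ L) × L ⊆ᶜ C × SetBlockedFor Δ C L

SBCRule : Formula → Clause → Set
SBCRule Δ C = ResRule Δ C ⊎ SetBlocked Δ C

Restrict : Formula → (Formula → Clause → Set) → Formula → Clause → Set
Restrict Γ₀ R Δ C = R Δ C × VarsIn C Γ₀

-- Proofs: a sequence (Γ₁ = Γ, …, Γ_N) with Γ_{i+1} = Γ_i ∪ {C}.
-- Derivation R Γ Δ N : a sequence of length N starting with Γ, ending in Δ.

data Derivation (R : Formula → Clause → Set) (Γ : Formula) : Formula → ℕ → Set where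
  start : Derivation R Γ Γ 1
  step  : ∀ {Δ N C} → Derivation R Γ Δ N → R Δ C → Derivation R Γ (C ∷ Δ) (suc N)

ProofOfSize : (Formula → Clause → Set) → Formula → ℕ → Set
ProofOfSize R Γ N = ∃ λ Δ → Derivation R Γ Δ N × [] ∈F Δ

ResProof : Formula → ℕ → Set
ResProof Γ N = ProofOfSize ResRule Γ N

SBC⁻Proof : Formula → ℕ → Set
SBC⁻Proof Γ N = ProofOfSize (Restrict Γ SBCRule) Γ N

IsSizeSBC⁻ : Formula → ℕ → Set
IsSizeSBC⁻ Γ s = SBC⁻Proof Γ s × (∀ s' → SBC⁻Proof Γ s' → s ≤ s')

BlockedFor : Formula → Clause → Lit → Set
BlockedFor Δ C p =
  p ∈ C ×
  (∀ D → D ∈ Δ → (p ᶜ) ∈ D →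
     TautPred (λ l → (l ∈ C × l ≢ p) ⊎ (l ∈ D × l ≢ (p ᶜ))))

Blocked : Formula → Clause → Set
Blocked Δ C = ∃ λ p → BlockedFor Δ C p

data BlockedSeq : Formula → List Clause → Set where
  []  : ∀ {Δ} → BlockedSeq Δ []
  _∷_ : ∀ {Δ C Cs} → Blocked Δ C → BlockedSeq (C ∷ Δ) Cs → BlockedSeq Δ (C ∷ Cs)

BlockedExtension : Formula → Formula → Set
BlockedExtension Γ Λ =
  (∀ {C} → C ∈ Λ → IsClause C) ×
  ∃ λ Γ' → Γ' ⊆F Γ × ∃ λ Cs →
    (∀ C → (C ∈F Cs → C ∈F Λ ⊎ (C ∈F Γ × ¬ C ∈F Γ'))
         × (C ∈F Λ ⊎ (C ∈F Γ × ¬ C ∈F Γ') → C ∈F Cs)) ×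
    BlockedSeq Γ' Cs

-- GER⁻ proof of Γ of size ≤ b  (|Λ| is bounded by the length of the list Λ)
HasGER⁻ProofOfSize≤ : Formula → ℕ → Set
HasGER⁻ProofOfSize≤ Γ b =
  ∃ λ Λ → BlockedExtension Γ Λ × (∀ {C} → C ∈ Λ → VarsIn C Γ) ×
  ∃ λ N → ProofOfSize (Restrict Γ ResRule) (Γ ++ Λ) N × length Λ + N ≤ b

ExtStep : Set
ExtStep = Var × Lit × Lit

extClauses : ExtStep → Formula
extClauses (x , p , q) = (neg x ∷ p ∷ []) ∷ (neg x ∷ q ∷ []) ∷ (pos x ∷ (p ᶜ) ∷ (q ᶜ) ∷ []) ∷ []

extFormula : List ExtStep → Formula
extFormula = concatMap extClauses

extVar : ExtStep → Var
extVar (x , _ , _) = x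

data ExtensionFor : Formula → List ExtStep → Set where
  []  : ∀ {Δ} → ExtensionFor Δ []
  ext : ∀ {Δ x p q es} →
        ¬ OccursIn x Δ → var p ≢ x → var q ≢ x →
        (∀ {C} → C ∈ extClauses (x , p , q) → IsClause C) →
        ExtensionFor (Δ ++ extClauses (x , p , q)) es →
        ExtensionFor Δ ((x , p , q) ∷ es)

-- ER proof (Λ = extFormula es, Π) of Γ of size s = |Λ| + |Π| = 3t + |Π|
ERProofOfSize : Formula → List ExtStep → ℕ → Set
ERProofOfSize Γ es s =
  ExtensionFor Γ es × ∃ λ N → ResProof (Γ ++ extFormula es) N × 3 * length es + N ≡ s

IsMinERExtension : Formula → List ExtStep → Set
IsMinERExtension Γ es =
  ∃ λ s → ERProofOfSize Γ es s × (∀ es' s' → ERProofOfSize Γ es' s' → s ≤ s')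

FreshYZ : Formula → List ExtStep → (m : ℕ) → (Fin m → Var) → (Fin m → Var) → Set
FreshYZ Γ es m y z =
  (∀ i j → y i ≡ y j → i ≡ j) × (∀ i j → z i ≡ z j → i ≡ j) ×
  (∀ i j → y i ≢ z j) ×
  (∀ j → ¬ OccursIn (y j) (Γ ++ extFormula es)) ×
  (∀ j → ¬ OccursIn (z j) (Γ ++ extFormula es))

allFinList : (m : ℕ) → List (Fin m)
allFinList m = Data.List.allFin m
  where import Data.List

V : List ExtStep → (m : ℕ) → (Fin m → Var) → (Fin m → Var) → Formula
V es m y z =
  concatMap (λ e → concatMap (λ j →
      (pos (extVar e) ∷ pos (y j) ∷ neg (z j) ∷ []) ∷
      (neg (extVar e) ∷ pos (y j) ∷ neg (z j) ∷ []) ∷ []) (allFinList m)) es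

-- l ∨ Γ ; (no clause is discarded because l is fresh for Γ)
_∨F_ : Lit → Formula → Formula
l ∨F Γ = map (l ∷_) Γ

W : Formula → (m : ℕ) → (Fin m → Var) → (Fin m → Var) → Formula
W Γ m y z =
  concatMap (λ j → ((neg (y j) ∷ pos (z j) ∷ []) ∷ []) ++ (pos (y j) ∨F Γ) ++ (neg (z j) ∨F Γ))
            (allFinList m)

I : Formula → List ExtStep → (m : ℕ) → (Fin m → Var) → (Fin m → Var) → Formula
I Γ es m y z = Γ ++ V es m y z ++ W Γ m y z

-- variable p^x_ℓ (x ∈ {0,…,2^k}, ℓ ∈ {0,…,k-1}) is encoded as x * k + ℓ
bvar : ℕ → ℕ → ℕ → Var
bvar k x ℓ = x * k + ℓ

_≠lit_ : Var → Bool → Lit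
v ≠lit false = pos v
v ≠lit true  = neg v

bitStrings : ℕ → List (List Bool)
bitStrings zero    = [] ∷ []
bitStrings (suc k) = concatMap (λ h → (false ∷ h) ∷ (true ∷ h) ∷ []) (bitStrings k)

holeLits : ℕ → ℕ → List Bool → Clause
holeLits k x h = map (λ { (ℓ , b) → bvar k x ℓ ≠lit b }) (zip (upTo k) h)

BPHP2^ : ℕ → Formula
BPHP2^ k =
  concatMap (λ x → concatMap (λ y →
      if does (x ≟ y) then [] else map (λ h → holeLits k x h ++ holeLits k y h) (bitStrings k))
    pigeons) pigeons
  where pigeons = upTo (suc (2 ^ k))

BPHP : ℕ → Formula
BPHP n = BPHP2^ ⌊log₂ n ⌋

{-# OPTIONS --safe #-}
-- Lower bound. A set-blocked clause of BPHP clashes with so many axioms that it mentions all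
-- but one of the pigeons. So do the set-blocked clauses of I, except for those that are true
-- when y j = z j for all j, and those that touch every pair (y j , z j); fewer than 2^m of the
-- latter are made true by a suitable common value of each pair. A greedily chosen partial
-- matching of at most n/4 pigeons satisfies every clause that mentions many pigeons, because each
-- chosen pigeon is offered a hole and its bitwise complement. The remaining clauses mention few
-- pigeons, and resolution and weakening preserve their truth under all assignments that are
-- injective on the pigeons they mention; so few steps do not derive the empty clause.
--
-- Upper bound. Cook's proof gives a small ER proof of BPHP, so the minimum proof is small. Its
-- extension clauses may be added to Γ ∪ W, after which the clauses of V are blocked on y j.
module Submission where

open import Defs
open import Data.Nat
open import Data.Nat.Properties
open import Data.Nat.DivMod
open import Data.Nat.Divisibility using (divides-refl)
open import Data.Nat.Logarithm
open import Data.Nat.Induction using (<-rec)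
open import Data.Nat.Tactic.RingSolver using (solve-∀)
open import Data.Bool using (Bool; true; false; not; _∧_; if_then_else_)
import Data.Bool.Properties as Bool
open import Data.Fin using (Fin; toℕ; fromℕ<)
import Data.Fin.Properties as Fin
open import Data.List hiding (and; or; all; any; find; lookup; sum; product)
open import Data.Nat.ListAction using (sum)
open import Data.List.Properties
open import Data.List.Membership.Propositional using (_∈_; _∉_; lose; find)
open import Data.List.Membership.Propositional.Properties
open import Data.List.Relation.Unary.All as All using (All; []; _∷_)
import Data.List.Relation.Unary.All.Properties as All
open import Data.List.Relation.Unary.Any using (Any; here; there; any?)
open import Data.List.Relation.Unary.AllPairs using (AllPairs; []; _∷_)
import Data.List.Relation.Unary.AllPairs.Properties as AllPairs
open import Data.List.Relation.Binary.Subset.Propositional using (_⊆_)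
open import Data.List.Relation.Binary.Subset.Propositional.Properties using (⊆-refl)
import Data.List.Membership.DecPropositional as DecMembership
open import Data.Product using (Σ; ∃; _×_; _,_; proj₁; proj₂)
open import Data.Sum using (_⊎_; inj₁; inj₂; [_,_]′)
open import Data.Empty using (⊥; ⊥-elim)
open import Data.Unit using (tt)
open import Function using (_∘_; id)
open import Relation.Nullary
open import Relation.Nullary.Decidable using (map′; _×-dec_; _⊎-dec_; dec-true; dec-false; decidable-stable)
open import Relation.Unary using (Decidable)
open import Relation.Binary.Definitions using (DecidableEquality)
open import Relation.Binary.PropositionalEquality

-- The value of `m` lets the lower bound assume at most 2^m steps: a longer proof of `I` exceeds
-- 2^m, which is at least the SBC⁻ size of BPHP, and BPHP alone is already hard for SBC⁻. Both
-- formulas are treated by one argument with a parameter `τ`, an assignment of the variables outside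
-- the pigeons. Adding a set-blocked clause does not preserve truth, so no soundness is claimed for
-- that rule. Each such clause is instead true under `τ` or so wide that the matching satisfies it.
-- In the upper bound, `V` contains every extension variable with both signs and so destroys its
-- freshness. A blocked extension may drop `V`, add the extension clauses and then restore `V`; an
-- SBC⁻ proof can only add clauses. The minimum ER proof is unknown and may use variables foreign to
-- `I`, hence a substitution is applied to it. Cook's proof is checked semantically: each clause of
-- a stage follows by exhaustive branching over 15 k variables, which is affordable because 2^k = n.

Assignment : Set
Assignment = Var → Bool

eval : Assignment → Lit → Bool
eval α (pos v) = α v
eval α (neg v) = not (α v)

Falsifies : Assignment → Clause → Set
Falsifies α C = ∀ {l} → l ∈ C → eval α l ≡ false

ᶜ-involutive : ∀ l → (l ᶜ) ᶜ ≡ l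
ᶜ-involutive (pos _) = refl
ᶜ-involutive (neg _) = refl

var-ᶜ : ∀ l → var (l ᶜ) ≡ var l
var-ᶜ (pos _) = refl
var-ᶜ (neg _) = refl

l≢lᶜ : ∀ l → l ≢ l ᶜ
l≢lᶜ (pos _) ()
l≢lᶜ (neg _) ()

var-≡ : ∀ l l' → var l ≡ var l' → l ≡ l' ⊎ l ≡ l' ᶜ
var-≡ (pos _) (pos _) refl = inj₁ refl
var-≡ (pos _) (neg _) refl = inj₂ refl
var-≡ (neg _) (pos _) refl = inj₂ refl
var-≡ (neg _) (neg _) refl = inj₁ refl

eval-ᶜ : ∀ α l → eval α (l ᶜ) ≡ not (eval α l)
eval-ᶜ α (pos v) = refl
eval-ᶜ α (neg v) = sym (Bool.not-involutive (α v))

true≢false : true ≢ false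
true≢false ()

_≟ᴸ_ : DecidableEquality Lit
pos u ≟ᴸ pos v = map′ (cong pos) (λ { refl → refl }) (u ≟ v)
pos u ≟ᴸ neg v = no λ ()
neg u ≟ᴸ pos v = no λ ()
neg u ≟ᴸ neg v = map′ (cong neg) (λ { refl → refl }) (u ≟ v)

open DecMembership _≟ᴸ_ using () renaming (_∈?_ to _∈ᴸ?_)
open DecMembership _≟_ using () renaming (_∈?_ to _∈ℕ?_)

tautological? : Decidable Tautological
tautological? C = map′ (λ p → let (l , l∈C , q) = find p in l , l∈C , q)
                       (λ (l , l∈C , q) → lose l∈C q)
                       (any? (λ l → (l ᶜ) ∈ᴸ? C) C)

falsifiable⇒clause : ∀ {α C} → Falsifies α C → IsClause C
falsifiable⇒clause {α} f (l , l∈C , lᶜ∈C) with eval α l | f l∈C | eval-ᶜ α l | f lᶜ∈C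
... | false | refl | e | e' = true≢false (trans (sym e) e')

falsifies? : ∀ α → Decidable (Falsifies α)
falsifies? α C = map′ (λ a → All.lookup a) (λ f → All.tabulate f)
                      (All.all? (λ l → eval α l Bool.≟ false) C)

-- Bit strings, hole literals and the pigeonhole axioms.

nth : List Bool → ℕ → Bool
nth []       _       = false
nth (b ∷ bs) zero    = b
nth (b ∷ bs) (suc i) = nth bs i

applyUpTo-nth : ∀ bs → applyUpTo (nth bs) (length bs) ≡ bs
applyUpTo-nth []       = refl
applyUpTo-nth (b ∷ bs) = cong (b ∷_) (applyUpTo-nth bs)

nth-applyUpTo : ∀ g k {i} → i < k → nth (applyUpTo g k) i ≡ g i
nth-applyUpTo g (suc k) {zero}  _       = refl
nth-applyUpTo g (suc k) {suc i} (s≤s p) = nth-applyUpTo (g ∘ suc) k p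

map-upTo-nth : ∀ g k h → length h ≡ k → (∀ {l} → l < k → g l ≡ nth h l) → map g (upTo k) ≡ h
map-upTo-nth g k h len e = begin
  map g (upTo k)                ≡⟨ map-cong-local (All.map e (All.all-upTo k)) ⟩
  map (nth h) (upTo k)          ≡⟨ map-upTo (nth h) k ⟩
  applyUpTo (nth h) k           ≡⟨ cong (applyUpTo (nth h)) len ⟨
  applyUpTo (nth h) (length h)  ≡⟨ applyUpTo-nth h ⟩
  h                             ∎
  where open ≡-Reasoning

-- X may exceed the number of pigeons: the ER proof stores its extension variables in further
-- blocks of k variables, as if they were the bits of further pigeons.
val : ℕ → Assignment → ℕ → List Bool
val k α X = map (λ l → α (bvar k X l)) (upTo k)

length-val : ∀ k α X → length (val k α X) ≡ k
length-val k α X = trans (length-map _ (upTo k)) (length-upTo k)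

nth-val : ∀ k α X {l} → l < k → nth (val k α X) l ≡ α (bvar k X l)
nth-val k α X {l} l<k = trans (cong (λ bs → nth bs l) (map-upTo _ k)) (nth-applyUpTo _ k l<k)

eval-≠lit : ∀ α v b → eval α (v ≠lit b) ≡ false → α v ≡ b
eval-≠lit α v false e = e
eval-≠lit α v true  e = trans (sym (Bool.not-involutive (α v))) (cong not e)

eval-≠lit-≡ : ∀ α v → eval α (v ≠lit α v) ≡ false
eval-≠lit-≡ α v with α v in e
... | false = e
... | true  = cong not e

var-≠lit : ∀ v b → var (v ≠lit b) ≡ v
var-≠lit v false = refl
var-≠lit v true  = refl

module _ (k X : ℕ) where
  private
    -- Generalises `holeLits` to any list of positions, because the tail of `upTo k` is not again of
    -- that form and blocks the induction.
    lits : List ℕ → List Bool → Clause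
    lits ls h = map (λ { (ℓ , b) → bvar k X ℓ ≠lit b }) (zip ls h)

  lits-falsified : ∀ α ls h → length h ≡ length ls → Falsifies α (lits ls h) →
                   map (λ l → α (bvar k X l)) ls ≡ h
  lits-falsified α []       []      _ f = refl
  lits-falsified α (l ∷ ls) (b ∷ h) e f =
    cong₂ _∷_ (eval-≠lit α _ b (f (here refl)))
              (lits-falsified α ls h (suc-injective e) (f ∘ there))

  falsifies-lits : ∀ α ls → Falsifies α (lits ls (map (λ l → α (bvar k X l)) ls))
  falsifies-lits α (l ∷ ls) (here refl) = eval-≠lit-≡ α (bvar k X l)
  falsifies-lits α (l ∷ ls) (there p)   = falsifies-lits α ls p

  lits-vars : ∀ ls h {l} → l ∈ lits ls h → ∃ λ i → i ∈ ls × var l ≡ bvar k X i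
  lits-vars (i ∷ ls) (b ∷ h) (here refl) = i , here refl , var-≠lit _ b
  lits-vars (i ∷ ls) (b ∷ h) (there p)   =
    let (j , j∈ , e) = lits-vars ls h p in j , there j∈ , e

  vars-lits : ∀ ls h → length h ≡ length ls → ∀ {i} → i ∈ ls →
              ∃ λ l → l ∈ lits ls h × var l ≡ bvar k X i
  vars-lits (i ∷ ls) (b ∷ h) e (here refl) = _ , here refl , var-≠lit _ b
  vars-lits (i ∷ ls) (b ∷ h) e (there p)   =
    let (l , l∈ , e') = vars-lits ls h (suc-injective e) p in l , there l∈ , e'

  -- The literal `v ≠lit b` is false exactly when v has the value b, so the clause fails only in
  -- hole h. The length hypothesis keeps `zip` from truncating.
  holeLits-falsified : ∀ α {h} → length h ≡ k → Falsifies α (holeLits k X h) → val k α X ≡ h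
  holeLits-falsified α {h} e = lits-falsified α (upTo k) h (trans e (sym (length-upTo k)))

  falsifies-holeLits : ∀ α {h} → val k α X ≡ h → Falsifies α (holeLits k X h)
  falsifies-holeLits α refl = falsifies-lits α (upTo k)

  holeLits-vars : ∀ {h l} → l ∈ holeLits k X h → ∃ λ i → i < k × var l ≡ bvar k X i
  holeLits-vars {h} p = let (i , i∈ , e) = lits-vars (upTo k) h p in i , ∈-upTo⁻ i∈ , e

  vars-holeLits : ∀ {h} → length h ≡ k → ∀ {i} → i < k →
                  ∃ λ l → l ∈ holeLits k X h × var l ≡ bvar k X i
  vars-holeLits {h} e i<k = vars-lits (upTo k) h (trans e (sym (length-upTo k))) (∈-upTo⁺ i<k)

bitStrings-length : ∀ k {h} → h ∈ bitStrings k → length h ≡ k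
bitStrings-length zero    (here refl) = refl
bitStrings-length (suc k) p with find (∈-concatMap⁻ _ {xs = bitStrings k} p)
... | h , h∈ , here refl         = cong suc (bitStrings-length k h∈)
... | h , h∈ , there (here refl) = cong suc (bitStrings-length k h∈)

∈-bitStrings : ∀ k {h} → length h ≡ k → h ∈ bitStrings k
∈-bitStrings zero    {[]}        e = here refl
∈-bitStrings (suc k) {false ∷ h} e =
  ∈-concatMap⁺ _ (lose (∈-bitStrings k (suc-injective e)) (here refl))
∈-bitStrings (suc k) {true ∷ h}  e =
  ∈-concatMap⁺ _ (lose (∈-bitStrings k (suc-injective e)) (there (here refl)))

length-bitStrings : ∀ k → length (bitStrings k) ≡ 2 ^ k
length-bitStrings zero    = refl
length-bitStrings (suc k) = trans (twice (bitStrings k)) (cong (2 *_) (length-bitStrings k))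
  where
  twice : ∀ (hs : List (List Bool)) →
          length (concatMap (λ h → (false ∷ h) ∷ (true ∷ h) ∷ []) hs) ≡ 2 * length hs
  twice []       = refl
  twice (h ∷ hs) = trans (cong (2 +_) (twice hs)) (sym (*-suc 2 (length hs)))

if-no⁺ : ∀ {P : Set} {xs : Formula} {z} (d : Dec P) → ¬ P → z ∈ xs →
         z ∈ (if does d then [] else xs)
if-no⁺ (yes p) ¬p _  = ⊥-elim (¬p p)
if-no⁺ (no _)  _  z∈ = z∈

if-no⁻ : ∀ {P : Set} {xs : Formula} {z} (d : Dec P) →
         z ∈ (if does d then [] else xs) → ¬ P × z ∈ xs
if-no⁻ (no ¬p) z∈ = ¬p , z∈

module _ (k : ℕ) where
  ∈-BPHP : ∀ {x y h} → x < suc (2 ^ k) → y < suc (2 ^ k) → x ≢ y → length h ≡ k →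
           (holeLits k x h ++ holeLits k y h) ∈ BPHP2^ k
  ∈-BPHP {x} {y} {h} x< y< x≢y e =
    ∈-concatMap⁺ _ (lose (∈-upTo⁺ x<) (∈-concatMap⁺ _ (lose (∈-upTo⁺ y<) inner)))
    where
    inner : (holeLits k x h ++ holeLits k y h) ∈
            (if does (x ≟ y) then [] else map (λ h → holeLits k x h ++ holeLits k y h) (bitStrings k))
    inner = if-no⁺ (x ≟ y) x≢y (∈-map⁺ _ (∈-bitStrings k e))

  data Axiom : Clause → Set where
    axiom : ∀ {x y h} → x < suc (2 ^ k) → y < suc (2 ^ k) → x ≢ y → length h ≡ k →
            Axiom (holeLits k x h ++ holeLits k y h)

  ∈-BPHP⁻ : ∀ {C} → C ∈ BPHP2^ k → Axiom C
  ∈-BPHP⁻ {C} C∈ with find (∈-concatMap⁻ _ {xs = upTo (suc (2 ^ k))} C∈)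
  ... | x , x∈ , p with find (∈-concatMap⁻ _ {xs = upTo (suc (2 ^ k))} p)
  ... | y , y∈ , q with if-no⁻ (x ≟ y) q
  ... | x≢y , q′ with ∈-map⁻ _ q′
  ... | h , h∈ , e = subst Axiom (sym e) (axiom (∈-upTo⁻ x∈) (∈-upTo⁻ y∈) x≢y (bitStrings-length k h∈))

-- A bit string outside a short list.

tailsOf : Bool → List (List Bool) → List (List Bool)
tailsOf c [] = []
tailsOf c ([] ∷ Bs) = tailsOf c Bs
tailsOf c ((b ∷ bs) ∷ Bs) = if does (b Bool.≟ c) then bs ∷ tailsOf c Bs else tailsOf c Bs

∈-tailsOf : ∀ c bs Bs → (c ∷ bs) ∈ Bs → bs ∈ tailsOf c Bs
∈-tailsOf true  bs (_ ∷ Bs) (here refl) = here refl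
∈-tailsOf false bs (_ ∷ Bs) (here refl) = here refl
∈-tailsOf c bs ([] ∷ Bs)      (there p) = ∈-tailsOf c bs Bs p
∈-tailsOf c bs ((b ∷ _) ∷ Bs) (there p) with does (b Bool.≟ c)
... | true  = there (∈-tailsOf c bs Bs p)
... | false = ∈-tailsOf c bs Bs p

-- Only an inequality: an empty string contributes to neither half.
length-tailsOf : ∀ Bs → length (tailsOf true Bs) + length (tailsOf false Bs) ≤ length Bs
length-tailsOf []                 = z≤n
length-tailsOf ([] ∷ Bs)          = m≤n⇒m≤1+n (length-tailsOf Bs)
length-tailsOf ((true ∷ _) ∷ Bs)  = s≤s (length-tailsOf Bs)
length-tailsOf ((false ∷ _) ∷ Bs) =
  ≤-trans (≤-reflexive (+-suc (length (tailsOf true Bs)) _)) (s≤s (length-tailsOf Bs))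

-- In each position, branch into the half that contains fewer of the strings.
avoid : ∀ k (Bs : List (List Bool)) → length Bs < 2 ^ k → ∃ λ b → length b ≡ k × b ∉ Bs
avoid zero    []      _ = [] , refl , λ ()
avoid zero    (_ ∷ _) (s≤s ())
avoid (suc k) Bs      p with length (tailsOf true Bs) <? 2 ^ k
... | yes q = let (b , e , b∉) = avoid k (tailsOf true Bs) q in
              true ∷ b , cong suc e , b∉ ∘ ∈-tailsOf true b Bs
... | no ¬q = let (b , e , b∉) = avoid k (tailsOf false Bs) small in
              false ∷ b , cong suc e , b∉ ∘ ∈-tailsOf false b Bs
  where
  small : length (tailsOf false Bs) < 2 ^ k
  small = +-cancelˡ-< (2 ^ k) _ _ (begin-strict
    2 ^ k + length (tailsOf false Bs)                     ≤⟨ +-monoˡ-≤ _ (≮⇒≥ ¬q) ⟩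
    length (tailsOf true Bs) + length (tailsOf false Bs)  ≤⟨ length-tailsOf Bs ⟩
    length Bs                                             <⟨ p ⟩
    2 ^ k + (2 ^ k + 0)                                   ≡⟨ cong (2 ^ k +_) (+-identityʳ _) ⟩
    2 ^ k + 2 ^ k                                         ∎)
    where open ≤-Reasoning

-- Counting, averaging and double counting.

bit : Bool → ℕ
bit b = if b then 1 else 0

+-interchange : ∀ a b c d → (a + b) + (c + d) ≡ (a + c) + (b + d)
+-interchange = solve-∀

if-case : ∀ {P A : Set} (Q : A → Set) (d : Dec P) {a b} → (P → Q a) → (¬ P → Q b) → Q (if does d then a else b)
if-case Q (yes p) f _ = f p
if-case Q (no ¬p) _ g = g ¬p

module _ {A : Set} where
  count : {P : A → Set} → Decidable P → List A → ℕ
  count P? []       = 0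
  count P? (x ∷ xs) = bit (does (P? x)) + count P? xs

  module _ {P : A → Set} (P? : Decidable P) where
    length-filter≡count : ∀ xs → length (filter P? xs) ≡ count P? xs
    length-filter≡count []       = refl
    length-filter≡count (x ∷ xs) with does (P? x)
    ... | true  = cong suc (length-filter≡count xs)
    ... | false = length-filter≡count xs

    count-complement : ∀ xs → count (λ x → ¬? (P? x)) xs + count P? xs ≡ length xs
    count-complement []       = refl
    count-complement (x ∷ xs) with does (P? x)
    ... | true  = trans (+-suc _ _) (cong suc (count-complement xs))
    ... | false = cong suc (count-complement xs)

    count-none : (∀ x → ¬ P x) → ∀ xs → count P? xs ≡ 0
    count-none ¬P []       = refl
    count-none ¬P (x ∷ xs) with P? x
    ... | yes p = ⊥-elim (¬P x p)
    ... | no  _ = count-none ¬P xs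

    count-all : ∀ {xs} → All P xs → count P? xs ≡ length xs
    count-all []              = refl
    count-all (_∷_ {x} px ps) with P? x
    ... | yes _  = cong suc (count-all ps)
    ... | no ¬px = ⊥-elim (¬px px)

    -- Once an element fails `P`, every later one satisfies it, so at most one element fails.
    count-pairwise : ∀ {xs} → AllPairs (λ x y → P x ⊎ P y) xs → length xs ≤ suc (count P? xs)
    count-pairwise []              = z≤n
    count-pairwise (_∷_ {x} px ps) with P? x
    ... | yes _  = s≤s (count-pairwise ps)
    ... | no ¬px = s≤s (≤-reflexive (sym (count-all
      (All.map (λ { (inj₁ p) → ⊥-elim (¬px p) ; (inj₂ q) → q }) px))))

  count-⊎ : ∀ {P Q R : A → Set} (P? : Decidable P) (Q? : Decidable Q) (R? : Decidable R) →
            (∀ x → P x → Q x ⊎ R x) → ∀ xs → count P? xs ≤ count Q? xs + count R? xs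
  count-⊎ P? Q? R? P⇒ []       = z≤n
  count-⊎ P? Q? R? P⇒ (x ∷ xs) = begin
    bit (does (P? x)) + count P? xs
      ≤⟨ +-mono-≤ here≤ (count-⊎ P? Q? R? P⇒ xs) ⟩
    (bit (does (Q? x)) + bit (does (R? x))) + (count Q? xs + count R? xs)
      ≡⟨ +-interchange (bit (does (Q? x))) _ _ _ ⟩
    (bit (does (Q? x)) + count Q? xs) + (bit (does (R? x)) + count R? xs) ∎
    where
    open ≤-Reasoning
    here≤ : bit (does (P? x)) ≤ bit (does (Q? x)) + bit (does (R? x))
    here≤ with P? x | Q? x | R? x
    ... | no  _ | _     | _     = z≤n
    ... | yes _ | yes _ | _     = s≤s z≤n
    ... | yes _ | no _  | yes _ = s≤s z≤n
    ... | yes p | no ¬q | no ¬r = ⊥-elim ([ ¬q , ¬r ]′ (P⇒ x p))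

  count-mono : ∀ {P Q : A → Set} (P? : Decidable P) (Q? : Decidable Q) →
               (∀ x → P x → Q x) → ∀ xs → count P? xs ≤ count Q? xs
  count-mono P? Q? P⇒Q []       = z≤n
  count-mono P? Q? P⇒Q (x ∷ xs) = +-mono-≤ here≤ (count-mono P? Q? P⇒Q xs)
    where
    here≤ : bit (does (P? x)) ≤ bit (does (Q? x))
    here≤ with P? x | Q? x
    ... | no  _ | _     = z≤n
    ... | yes _ | yes _ = s≤s z≤n
    ... | yes p | no ¬q = ⊥-elim (¬q (P⇒Q x p))

  unique-⊆-length : ∀ {xs ys : List A} → AllPairs _≢_ xs → xs ⊆ ys → length xs ≤ length ys
  unique-⊆-length {[]}     _          _     = z≤n
  unique-⊆-length {x ∷ xs} (x∉ ∷ xs!) xs⊆ys with ∈-∃++ (xs⊆ys (here refl))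
  ... | as , bs , refl = begin
    suc (length xs)           ≤⟨ s≤s (unique-⊆-length xs! sub) ⟩
    suc (length (as ++ bs))   ≡⟨ cong suc (length-++ as) ⟩
    suc (length as + length bs) ≡⟨ +-suc (length as) (length bs) ⟨
    length as + suc (length bs) ≡⟨ length-++ as ⟨
    length (as ++ x ∷ bs) ∎
    where
    open ≤-Reasoning
    sub : xs ⊆ as ++ bs
    sub z∈ with ∈-++⁻ as (xs⊆ys (there z∈))
    ... | inj₁ p           = ∈-++⁺ˡ p
    ... | inj₂ (here refl) = ⊥-elim (All.lookup x∉ z∈ refl)
    ... | inj₂ (there q)   = ∈-++⁺ʳ as q

  sum-map-+ : ∀ (f g : A → ℕ) xs → sum (map (λ x → f x + g x) xs) ≡ sum (map f xs) + sum (map g xs)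
  sum-map-+ f g []       = refl
  sum-map-+ f g (x ∷ xs) = trans (cong (f x + g x +_) (sum-map-+ f g xs)) (+-interchange (f x) (g x) _ _)

  sum-map-≥ : ∀ (f : A → ℕ) c {xs} → All (λ x → c ≤ f x) xs → length xs * c ≤ sum (map f xs)
  sum-map-≥ f c []       = z≤n
  sum-map-≥ f c (p ∷ ps) = +-mono-≤ p (sum-map-≥ f c ps)

  -- The witness maximises `f`; the product form of the average avoids division.
  above-average : ∀ (f : A → ℕ) x xs → ∃ λ y → y ∈ (x ∷ xs) × sum (map f (x ∷ xs)) ≤ length (x ∷ xs) * f y
  above-average f x []        = x , here refl , ≤-refl
  above-average f x (x′ ∷ xs) with above-average f x′ xs
  ... | y , y∈ , le with ≤-total (f x) (f y)
  ... | inj₁ x≤y = y , there y∈ , +-mono-≤ x≤y le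
  ... | inj₂ y≤x = x , here refl , +-monoʳ-≤ (f x) (≤-trans le (*-monoʳ-≤ (length (x′ ∷ xs)) y≤x))

double-counting : ∀ {A B : Set} {R : A → B → Set} (R? : ∀ a b → Dec (R a b)) as bs →
  sum (map (λ b → count (λ a → R? a b) as) bs) ≡ sum (map (λ a → count (R? a) bs) as)
double-counting R? [] bs = zeros bs
  where
  zeros : ∀ {B : Set} (bs : List B) → sum (map (λ _ → 0) bs) ≡ 0
  zeros []       = refl
  zeros (_ ∷ bs) = zeros bs
double-counting R? (a ∷ as) bs = begin
  sum (map (λ b → bit (does (R? a b)) + count (λ a → R? a b) as) bs)
    ≡⟨ sum-map-+ _ _ bs ⟩
  sum (map (λ b → bit (does (R? a b))) bs) + sum (map (λ b → count (λ a → R? a b) as) bs)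
    ≡⟨ cong₂ _+_ (bits bs) (double-counting R? as bs) ⟩
  count (R? a) bs + sum (map (λ a → count (R? a) bs) as) ∎
  where
  open ≡-Reasoning
  bits : ∀ bs → sum (map (λ b → bit (does (R? a b))) bs) ≡ count (R? a) bs
  bits []       = refl
  bits (b ∷ bs) = cong (bit (does (R? a b)) +_) (bits bs)

upTo-unique : ∀ m → AllPairs _≢_ (upTo m)
upTo-unique m = AllPairs.applyUpTo⁺₁ id m (λ i<j _ → <⇒≢ i<j)

module _ {R : Formula → Clause → Set} {Γ : Formula} where
  added : ∀ {Δ N} → Derivation R Γ Δ N → Formula
  added start              = []
  added (step {C = C} d _) = C ∷ added d

  length-added : ∀ {Δ N} (d : Derivation R Γ Δ N) → suc (length (added d)) ≡ N
  length-added start      = refl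
  length-added (step d _) = cong suc (length-added d)

  derivation-⊇ : ∀ {Δ N} → Derivation R Γ Δ N → Γ ⊆ Δ
  derivation-⊇ start      = id
  derivation-⊇ (step d _) = there ∘ derivation-⊇ d

≋[]⇒≡ : ∀ {D} → D ≋ [] → D ≡ []
≋[]⇒≡ {[]}    _         = refl
≋[]⇒≡ {l ∷ D} (D⊆ , _) with () ← D⊆ (here refl)

module _ (k : ℕ) .{{_ : NonZero k}} where
  bvar-/ : ∀ x {l} → l < k → bvar k x l / k ≡ x
  bvar-/ x {l} l<k = begin
    (x * k + l) / k     ≡⟨ +-distrib-/-∣ˡ {x * k} l (divides-refl x) ⟩
    x * k / k + l / k   ≡⟨ cong₂ _+_ (m*n/n≡m x k) (m<n⇒m/n≡0 l<k) ⟩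
    x + 0               ≡⟨ +-identityʳ x ⟩
    x                   ∎
    where open ≡-Reasoning

  bvar-% : ∀ x {l} → l < k → bvar k x l % k ≡ l
  bvar-% x {l} l<k = trans (cong (_% k) (+-comm (x * k) l))
                           (trans ([m+kn]%n≡m%n l x k) (m<n⇒m%n≡m l<k))

bvar-< : ∀ k {x l S} → x < S → l < k → bvar k x l < S * k
bvar-< k {x} {l} {S} x<S l<k = begin-strict
  x * k + l  <⟨ +-monoʳ-< (x * k) l<k ⟩
  x * k + k  ≡⟨ +-comm (x * k) k ⟩
  suc x * k  ≤⟨ *-monoˡ-≤ k x<S ⟩
  S * k      ∎
  where open ≤-Reasoning

^-distribʳ-* : ∀ q a b → (a * b) ^ q ≡ a ^ q * b ^ q
^-distribʳ-* zero    a b = refl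
^-distribʳ-* (suc q) a b = trans (cong (a * b *_) (^-distribʳ-* q a b)) (interchange a b (a ^ q) (b ^ q))
  where
  interchange : ∀ a b c d → a * b * (c * d) ≡ a * c * (b * d)
  interchange = solve-∀

-- Placements of pigeons, partial matchings and the clauses they satisfy.

module Pigeons (k : ℕ) .{{_ : NonZero k}} where
  n S : ℕ
  n = 2 ^ k
  S = suc n

  -- The quotient by k recovers the pigeon from a variable. Beyond the pigeon variables it is at
  -- least `S`, which is why `width` and `Broad` look only below `S`.
  Mentions : Clause → ℕ → Set
  Mentions C x = Any (λ l → var l / k ≡ x) C

  mentions? : ∀ C → Decidable (Mentions C)
  mentions? C x = any? (λ l → var l / k ≟ x) C

  -- At most one pigeon is missing, in the form in which this comes out of an axiom about u and v.
  Broad : Clause → Set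
  Broad C = ∀ {u v} → u < S → v < S → u ≢ v → Mentions C u ⊎ Mentions C v

  IsPigeonVar : Var → Set
  IsPigeonVar v = v < S * k

  isPigeonVar : ∀ {v} → v / k < S → IsPigeonVar v
  isPigeonVar {v} p = begin-strict
    v                    ≡⟨ m≡m%n+[m/n]*n v k ⟩
    v % k + (v / k) * k  <⟨ +-monoˡ-< ((v / k) * k) (m%n<n v k) ⟩
    suc (v / k) * k      ≤⟨ *-monoˡ-≤ k p ⟩
    S * k                ∎
    where open ≤-Reasoning

  pigeonVar-/ : ∀ {v} → IsPigeonVar v → v / k < S
  pigeonVar-/ = m<n*o⇒m/o<n

  assign : (ℕ → List Bool) → Assignment → Assignment
  assign f τ v = if does (v <? S * k) then nth (f (v / k)) (v % k) else τ v

  assign-pigeonVar : ∀ f τ {v} → IsPigeonVar v → assign f τ v ≡ nth (f (v / k)) (v % k)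
  assign-pigeonVar f τ {v} p rewrite dec-true (v <? S * k) p = refl

  assign-other : ∀ f τ {v} → ¬ IsPigeonVar v → assign f τ v ≡ τ v
  assign-other f τ {v} p rewrite dec-false (v <? S * k) p = refl

  Total : (ℕ → List Bool) → Set
  Total f = ∀ x → length (f x) ≡ k

  val-assign : ∀ f τ → Total f → ∀ {x} → x < S → val k (assign f τ) x ≡ f x
  val-assign f τ tot {x} x<S = map-upTo-nth _ k (f x) (tot x) bitwise
    where
    bitwise : ∀ {l} → l < k → assign f τ (bvar k x l) ≡ nth (f x) l
    bitwise {l} l<k = trans (assign-pigeonVar f τ (bvar-< k x<S l<k))
                            (cong₂ (λ y i → nth (f y) i) (bvar-/ k x l<k) (bvar-% k x l<k))

  Assigned : Set
  Assigned = List (ℕ × List Bool)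

  Extends : (ℕ → List Bool) → Assigned → Set
  Extends f ρ = ∀ {x h} → (x , h) ∈ ρ → f x ≡ h

  -- No injectivity is demanded: the pigeons in `ρ` together with `τ` make C true wherever the other
  -- pigeons sit.
  Killed : Assignment → Assigned → Clause → Set
  Killed τ ρ C = ∀ f → Total f → Extends f ρ → ¬ Falsifies (assign f τ) C

  Matching : Assigned → Set
  Matching ρ = AllPairs (λ p q → proj₁ p ≢ proj₁ q × proj₂ p ≢ proj₂ q) ρ ×
               All (λ p → proj₁ p < S × length (proj₂ p) ≡ k) ρ

  KilledBy : ℕ → List Bool → Clause → Set
  KilledBy x h C = Any (λ l → var l / k ≡ x × eval (λ v → nth h (v % k)) l ≡ true) C

  killedBy? : ∀ x h → Decidable (KilledBy x h)
  killedBy? x h = any? (λ l → (var l / k ≟ x) ×-dec (eval (λ v → nth h (v % k)) l Bool.≟ true))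

  eval-local : ∀ {α β} l → α (var l) ≡ β (var l) → eval α l ≡ eval β l
  eval-local (pos v) e = e
  eval-local (neg v) e = cong not e

  killedBy-killed : ∀ {τ ρ x h C} → (x , h) ∈ ρ → x < S → KilledBy x h C → Killed τ ρ C
  killedBy-killed {τ} {h = h} x∈ x<S K f tot ext-f fals with find K
  ... | l , l∈ , refl , e = true≢false (trans (sym (trans lit e)) (fals l∈))
    where
    lit : eval (assign f τ) l ≡ eval (λ v → nth h (v % k)) l
    lit = eval-local l (trans (assign-pigeonVar f τ (isPigeonVar x<S)) (cong (λ h → nth h (var l % k)) (ext-f x∈)))

  nth-not : ∀ h {i} → i < length h → nth (map not h) i ≡ not (nth h i)
  nth-not (b ∷ h) {zero}  _       = refl
  nth-not (b ∷ h) {suc i} (s≤s p) = nth-not h p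

  -- A literal about x reads one bit of the hole of x, and h and its complement differ in every bit.
  mentions-killedBy : ∀ {x h} → length h ≡ k → ∀ C → Mentions C x → KilledBy x h C ⊎ KilledBy x (map not h) C
  mentions-killedBy {x} {h} len C M with find M
  ... | l , l∈ , e = [ (λ t → inj₁ (lose l∈ (e , t))) , (λ t → inj₂ (lose l∈ (e , t))) ]′ (either l)
    where
    neg-nth : ∀ v → nth (map not h) (v % k) ≡ not (nth h (v % k))
    neg-nth v = nth-not h (subst (v % k <_) (sym len) (m%n<n v k))
    either : ∀ l → eval (λ v → nth h (v % k)) l ≡ true ⊎ eval (λ v → nth (map not h) (v % k)) l ≡ true
    either (pos v) with nth h (v % k) | neg-nth v
    ... | true  | _ = inj₁ refl
    ... | false | p = inj₂ p
    either (neg v) with nth h (v % k) | neg-nth v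
    ... | true  | p = inj₂ (cong not p)
    ... | false | _ = inj₁ refl

  width : Clause → ℕ
  width C = count (mentions? C) (upTo S)

  -- Greedy construction of the matching.

  module Greedy (τ : Assignment) (R a : ℕ) (a>0 : 0 < a) (S≤4a : S ≤ 4 * a) (2R≤n : 2 * R ≤ n) where
    -- `R` bounds the size of the matching. Even when that many pigeons are matched, a wide clause
    -- mentions `a` others, and `a` is at least a quarter of all pigeons by `S≤4a`.
    Wide : Clause → Set
    Wide C = R + a ≤ width C


    larger-half : ∀ w c d → w ≤ 4 * (c + d) → d ≤ c → w ≤ 8 * c
    larger-half w c d w≤ d≤c = begin
      w            ≤⟨ w≤ ⟩
      4 * (c + d)  ≤⟨ *-monoʳ-≤ 4 (+-monoʳ-≤ c d≤c) ⟩
      4 * (c + c)  ≡⟨ double c ⟩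
      8 * c        ∎
      where
      open ≤-Reasoning
      double : ∀ c → 4 * (c + c) ≡ 8 * c
      double = solve-∀

    module Step (ρ : Assigned) (|ρ|<R : length ρ < R) (M : Matching ρ) where
      dom : List ℕ
      dom = map proj₁ ρ

      Hits : Clause → ℕ → Set
      Hits C x = Mentions C x × x ∉ dom

      hits? : ∀ C → Decidable (Hits C)
      hits? C x = mentions? C x ×-dec ¬? (x ∈ℕ? dom)

      wide-hits : ∀ {C} → Wide C → a ≤ count (hits? C) (upTo S)
      wide-hits {C} wide = +-cancelˡ-≤ R a _ (begin
        R + a                                                         ≤⟨ wide ⟩
        width C                                                       ≤⟨ count-⊎ (mentions? C) (hits? C) (_∈ℕ? dom) split (upTo S) ⟩
        count (hits? C) (upTo S) + count (_∈ℕ? dom) (upTo S)           ≡⟨ +-comm (count (hits? C) (upTo S)) _ ⟩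
        count (_∈ℕ? dom) (upTo S) + count (hits? C) (upTo S)           ≤⟨ +-monoˡ-≤ _ dom≤R ⟩
        R + count (hits? C) (upTo S)                                  ∎)
        where
        open ≤-Reasoning
        split : ∀ x → Mentions C x → Hits C x ⊎ x ∈ dom
        split x m with x ∈ℕ? dom
        ... | yes p = inj₂ p
        ... | no ¬p = inj₁ (m , ¬p)
        dom≤R : count (_∈ℕ? dom) (upTo S) ≤ R
        dom≤R = begin
          count (_∈ℕ? dom) (upTo S)           ≡⟨ length-filter≡count (_∈ℕ? dom) (upTo S) ⟨
          length (filter (_∈ℕ? dom) (upTo S)) ≤⟨ unique-⊆-length (AllPairs.filter⁺ (_∈ℕ? dom) (upTo-unique S))
                                                   (λ p → proj₂ (∈-filter⁻ (_∈ℕ? dom) {xs = upTo S} p)) ⟩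
          length dom                         ≡⟨ length-map proj₁ ρ ⟩
          length ρ                           ≤⟨ <⇒≤ |ρ|<R ⟩
          R                                  ∎

      -- Averaging over the pigeons: each wide clause mentions at least `a` unmatched ones, and
      -- there are at most 4 a pigeons in all.
      popular : ∀ {Ws} → All Wide Ws → 0 < length Ws →
                ∃ λ x → x < S × x ∉ dom × length Ws ≤ 4 * count (λ C → mentions? C x) Ws
      popular {Ws} wide nonempty with above-average (λ x → count (λ C → hits? C x) Ws) 0 (applyUpTo suc n)
      ... | x , x∈ , avg = x , ∈-upTo⁻ x∈ , x∉dom , ≤-trans bound (*-monoʳ-≤ 4 hits≤mentions)
        where
        open ≤-Reasoning
        hits : ℕ
        hits = count (λ C → hits? C x) Ws
        bound : length Ws ≤ 4 * hits
        bound = *-cancelʳ-≤ (length Ws) (4 * hits) a {{>-nonZero a>0}} (begin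
          length Ws * a                                         ≤⟨ sum-map-≥ _ a (All.map wide-hits wide) ⟩
          sum (map (λ C → count (hits? C) (upTo S)) Ws)         ≡⟨ double-counting hits? Ws (upTo S) ⟨
          sum (map (λ x → count (λ C → hits? C x) Ws) (upTo S)) ≤⟨ avg ⟩
          length (upTo S) * hits                                ≡⟨ cong (_* hits) (length-upTo S) ⟩
          S * hits                                              ≤⟨ *-monoˡ-≤ hits S≤4a ⟩
          4 * a * hits                                          ≡⟨ rearrange a hits ⟩
          4 * hits * a                                          ∎)
          where
          rearrange : ∀ a h → 4 * a * h ≡ 4 * h * a
          rearrange = solve-∀
        -- A matched pigeon gets no hits, whereas `bound` makes the number of hits of x positive.
        x∉dom : x ∉ dom
        x∉dom x∈dom = <⇒≱ nonempty (≤-trans bound (≤-reflexive (cong (4 *_)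
          (count-none (λ C → hits? C x) (λ _ h → proj₂ h x∈dom) Ws))))
        hits≤mentions : hits ≤ count (λ C → mentions? C x) Ws
        hits≤mentions = count-mono (λ C → hits? C x) (λ C → mentions? C x) (λ _ → proj₁) Ws

      few-holes : length (map proj₂ ρ ++ map (map not ∘ proj₂) ρ) < n
      few-holes = begin-strict
        length (map proj₂ ρ ++ map (map not ∘ proj₂) ρ)          ≡⟨ length-++ (map proj₂ ρ) ⟩
        length (map proj₂ ρ) + length (map (map not ∘ proj₂) ρ)  ≡⟨ cong₂ _+_ (length-map proj₂ ρ) (length-map (map not ∘ proj₂) ρ) ⟩
        length ρ + length ρ                                      <⟨ +-mono-< |ρ|<R |ρ|<R ⟩
        R + R                                                    ≡⟨ cong (R +_) (+-identityʳ R) ⟨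
        2 * R                                                    ≤⟨ 2R≤n ⟩
        n                                                        ∎
        where open ≤-Reasoning

      not-not : ∀ h → map not (map not h) ≡ h
      not-not []      = refl
      not-not (b ∷ h) = cong₂ _∷_ (Bool.not-involutive b) (not-not h)

      fresh-pair : ∃ λ h → length h ≡ k × All (λ p → h ≢ proj₂ p × map not h ≢ proj₂ p) ρ
      fresh-pair = separate (avoid k (map proj₂ ρ ++ map (map not ∘ proj₂) ρ) few-holes)
        where
        separate : (∃ λ h → length h ≡ k × h ∉ map proj₂ ρ ++ map (map not ∘ proj₂) ρ) →
                   ∃ λ h → length h ≡ k × All (λ p → h ≢ proj₂ p × map not h ≢ proj₂ p) ρ
        separate (h , len , h∉) = h , len , All.tabulate λ {p} p∈ →
          (λ { refl → h∉ (∈-++⁺ˡ (∈-map⁺ proj₂ p∈)) }) ,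
          (λ e → h∉ (∈-++⁺ʳ (map proj₂ ρ) (subst (_∈ map (map not ∘ proj₂) ρ)
                   (trans (cong (map not) (sym e)) (not-not h)) (∈-map⁺ (map not ∘ proj₂) p∈))))

      Step : List Clause → Set
      Step Ws = ∃ λ x → ∃ λ h → x < S × Matching ((x , h) ∷ ρ) × length Ws ≤ 8 * count (killedBy? x h) Ws

      -- Of two complementary holes, one satisfies at least half of the clauses that mention
      -- a popular pigeon.
      best-step : ∀ {Ws} → All Wide Ws → 0 < length Ws → Step Ws
      best-step {Ws} wide nonempty = complementary (popular wide nonempty) fresh-pair
        where
        kills : ℕ → List Bool → ℕ
        kills x h = count (killedBy? x h) Ws
        complementary : (∃ λ x → x < S × x ∉ dom × length Ws ≤ 4 * count (λ C → mentions? C x) Ws) →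
                 (∃ λ h → length h ≡ k × All (λ p → h ≢ proj₂ p × map not h ≢ proj₂ p) ρ) → Step Ws
        complementary (x , x<S , x∉ , many) (h , len , h∉) = choose (≤-total (kills x (map not h)) (kills x h))
          where
          both : length Ws ≤ 4 * (kills x h + kills x (map not h))
          both = ≤-trans many (*-monoʳ-≤ 4 (count-⊎ (λ C → mentions? C x) (killedBy? x h) (killedBy? x (map not h))
                   (mentions-killedBy {h = h} len) Ws))
          matching : ∀ g → length g ≡ k → All (λ p → g ≢ proj₂ p) ρ → Matching ((x , g) ∷ ρ)
          matching g len g∉ =
            All.tabulate (λ p∈ → (λ x≡ → x∉ (subst (_∈ dom) (sym x≡) (∈-map⁺ proj₁ p∈))) , All.lookup g∉ p∈) ∷ proj₁ M ,
            (x<S , len) ∷ proj₂ M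
          choose : kills x (map not h) ≤ kills x h ⊎ kills x h ≤ kills x (map not h) → Step Ws
          choose (inj₁ le) = x , h , x<S , matching h len (All.map proj₁ h∉) ,
            larger-half (length Ws) (kills x h) (kills x (map not h)) both le
          choose (inj₂ le) = x , map not h , x<S , matching (map not h) (trans (length-map not h) len) (All.map proj₂ h∉) ,
            larger-half (length Ws) (kills x (map not h)) (kills x h)
              (subst (λ c → length Ws ≤ 4 * c) (+-comm (kills x h) (kills x (map not h))) both) le

    -- Satisfying an eighth of the clauses leaves at most 7/8 of them, and the invariant is w
    -- (7/8)^r < 1 without fractions. The eighth is half of the quarter from `popular`.
    shrink : ∀ r w c w′ → w′ + c ≡ w → w ≤ 8 * c → w * 7 ^ suc r < 8 ^ suc r → w′ * 7 ^ r < 8 ^ r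
    shrink r w c w′ refl w≤8c lt = *-cancelˡ-< 8 _ _ (begin-strict
      8 * (w′ * 7 ^ r)    ≡⟨ *-assoc 8 w′ (7 ^ r) ⟨
      8 * w′ * 7 ^ r      ≤⟨ *-monoˡ-≤ (7 ^ r) 8w′≤7w ⟩
      7 * w * 7 ^ r       ≡⟨ rearrange w (7 ^ r) ⟩
      w * 7 ^ suc r       <⟨ lt ⟩
      8 * 8 ^ r           ∎)
      where
      open ≤-Reasoning
      rearrange : ∀ w p → 7 * w * p ≡ w * (7 * p)
      rearrange = solve-∀
      expand : ∀ w′ c → 8 * w′ + 8 * c ≡ 7 * (w′ + c) + (w′ + c)
      expand = solve-∀
      8w′≤7w : 8 * w′ ≤ 7 * w
      8w′≤7w = +-cancelʳ-≤ (8 * c) _ _ (begin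
        8 * w′ + 8 * c ≡⟨ expand w′ c ⟩
        7 * w + w      ≤⟨ +-monoʳ-≤ (7 * w) w≤8c ⟩
        7 * w + 8 * c  ∎)

    -- At r = 0 the invariant reads w < 1, so no clause is left when the steps are used up.
    greedy : ∀ r ρ Ws → Matching ρ → length ρ + r ≤ R → All Wide Ws → length Ws * 7 ^ r < 8 ^ r →
             ∃ λ ρ′ → Matching ρ′ × length ρ′ ≤ length ρ + r × ρ ⊆ ρ′ × (∀ {C} → C ∈ Ws → Killed τ ρ′ C)
    greedy r       ρ []         M le wide lt = ρ , M , m≤m+n _ r , ⊆-refl , λ ()
    greedy zero    ρ (_ ∷ _)    M le wide (s≤s ())
    greedy (suc r) ρ Ws@(_ ∷ _) M le wide lt = go (Step.best-step ρ ρ<R M wide (s≤s z≤n))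
      where
      ρ<R : length ρ < R
      ρ<R = ≤-trans (m≤m+n (suc (length ρ)) r) (subst (_≤ R) (+-suc (length ρ) r) le)
      go : (∃ λ x → ∃ λ h → x < S × Matching ((x , h) ∷ ρ) × length Ws ≤ 8 * count (killedBy? x h) Ws) →
           ∃ λ ρ′ → Matching ρ′ × length ρ′ ≤ length ρ + suc r × ρ ⊆ ρ′ × (∀ {C} → C ∈ Ws → Killed τ ρ′ C)
      go (x , h , x<S , M′ , many) with
        greedy r ((x , h) ∷ ρ) (filter (λ C → ¬? (killedBy? x h C)) Ws) M′
          (subst (_≤ R) (+-suc (length ρ) r) le)
          (All.filter⁺ (λ C → ¬? (killedBy? x h C)) wide)
          (shrink r (length Ws) (count (killedBy? x h) Ws) (length (filter (λ C → ¬? (killedBy? x h C)) Ws)) (trans (cong (_+ count (killedBy? x h) Ws) (length-filter≡count (λ C → ¬? (killedBy? x h C)) Ws))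
                           (count-complement (killedBy? x h) Ws)) many lt)
      ... | ρ′ , M″ , len , ρ⊆ , kill = ρ′ , M″ , subst (length ρ′ ≤_) (sym (+-suc (length ρ) r)) len , ρ⊆ ∘ there , all-killed
        where
        all-killed : ∀ {C} → C ∈ Ws → Killed τ ρ′ C
        all-killed {C} C∈ with killedBy? x h C
        ... | yes K = killedBy-killed (ρ⊆ (here refl)) x<S K
        ... | no ¬K = kill (∈-filter⁺ (λ C → ¬? (killedBy? x h C)) C∈ ¬K)

-- Soundness of resolution relative to a matching.

module Soundness (k : ℕ) .{{_ : NonZero k}} (τ : Assignment) where
  open Pigeons k

  module _ (ρ : Assigned) where
    Involved : Clause → ℕ → Set
    Involved C x = x < S × (x ∈ map proj₁ ρ ⊎ Mentions C x)

    InjectiveOn : (ℕ → List Bool) → (ℕ → Set) → Set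
    InjectiveOn f P = ∀ {x y} → P x → P y → f x ≡ f y → x ≡ y

    -- C holds under all assignments that extend ρ and violate no pigeonhole axiom about the
    -- pigeons that C or ρ talks about.
    Sound : Clause → Set
    Sound C = ∀ f → Total f → Extends f ρ → InjectiveOn f (Involved C) → ¬ Falsifies (assign f τ) C

    killed⇒sound : ∀ {C} → Killed τ ρ C → Sound C
    killed⇒sound kill f tot ext-f _ = kill f tot ext-f

    -- The larger clause involves more pigeons, so its soundness quantifies over fewer placements.
    weakening-sound : ∀ {A C} → A ⊆ C → Sound A → Sound C
    weakening-sound A⊆C snd f tot ext-f inj fals =
      snd f tot ext-f (λ x y → inj (widen x) (widen y)) (fals ∘ A⊆C)
      where
      widen : ∀ {x} → Involved _ x → Involved _ x
      widen (x<S , inj₁ p) = x<S , inj₁ p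
      widen (x<S , inj₂ m) = let (l , l∈ , e) = find m in x<S , inj₂ (lose (A⊆C l∈) e)

    mentions-literal : ∀ {C l x i} → l ∈ C → var l ≡ bvar k x i → i < k → Mentions C x
    mentions-literal l∈ e i<k = lose l∈ (trans (cong (_/ k) e) (bvar-/ k _ i<k))

    -- Falsifying the axiom puts x and y into the same hole, against injectivity on the pigeons that
    -- C mentions.
    axiom-sound : ∀ {C x y h} → x < S → y < S → x ≢ y → length h ≡ k →
                  holeLits k x h ++ holeLits k y h ⊆ C → Sound C
    axiom-sound {C} {x} {y} {h} x<S y<S x≢y len sub f tot ext-f inj fals =
      x≢y (inj (involved x<S ∈-++⁺ˡ) (involved y<S (∈-++⁺ʳ (holeLits k x h)))
               (trans (located x<S ∈-++⁺ˡ) (sym (located y<S (∈-++⁺ʳ (holeLits k x h))))))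
      where
      involved : ∀ {z} → z < S → holeLits k z h ⊆ holeLits k x h ++ holeLits k y h → Involved C z
      -- Position 0 exists because k is nonzero, so the hole literals do mention their pigeon.
      involved {z} z<S z⊆ = let (l , l∈ , e) = vars-holeLits k z len {0} (>-nonZero⁻¹ k) in
        z<S , inj₂ (mentions-literal (sub (z⊆ l∈)) e (>-nonZero⁻¹ k))
      located : ∀ {z} → z < S → holeLits k z h ⊆ holeLits k x h ++ holeLits k y h → f z ≡ h
      located {z} z<S z⊆ = trans (sym (val-assign f τ tot z<S))
        (holeLits-falsified k z (assign f τ) len (λ l∈ → fals (sub (z⊆ l∈))))

    module _ (M : Matching ρ) where
      involvedList : Clause → List ℕ
      involvedList C = map proj₁ ρ ++ filter (mentions? C) (upTo S)

      involved⇒∈ : ∀ {C x} → Involved C x → x ∈ involvedList C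
      involved⇒∈ {C} (x<S , inj₁ p) = ∈-++⁺ˡ p
      involved⇒∈ {C} (x<S , inj₂ m) = ∈-++⁺ʳ (map proj₁ ρ) (∈-filter⁺ (mentions? C) (∈-upTo⁺ x<S) m)

      ∈⇒involved : ∀ {C x} → x ∈ involvedList C → Involved C x
      ∈⇒involved {C} x∈ with ∈-++⁻ (map proj₁ ρ) x∈
      ... | inj₁ p = let ((x , h) , q , e) = ∈-map⁻ proj₁ p in
                     subst (_< S) (sym e) (proj₁ (All.lookup (proj₂ M) q)) , inj₁ p
      ... | inj₂ q = let (x∈ , m) = ∈-filter⁻ (mentions? C) {xs = upTo S} q in ∈-upTo⁻ x∈ , inj₂ m

      -- If the resolved variable belongs to a pigeon x that is not involved in C, then x can be
      -- moved to a hole that avoids the involved pigeons, without changing the value of C.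
      resolvent-sound : ∀ {A B C} l → length ρ + width C < n →
        (∀ {l′} → l′ ∈ A → l′ ≢ l → l′ ∈ C) → (∀ {l′} → l′ ∈ B → l′ ≢ l ᶜ → l′ ∈ C) →
        Sound A → Sound B → Sound C
      resolvent-sound {A} {B} {C} l small A⊆ B⊆ sndA sndB f tot ext-f inj fals = relocate (x ∈ℕ? involvedList C)
        where
        x : ℕ
        x = var l / k

        -- Beyond the pigeons involved in C, the premises involve at most the pigeon of the resolved
        -- variable.
        Near : ℕ → Set
        Near y = Involved C y ⊎ y ≡ x

        near : ∀ {D l₀} → var l₀ ≡ var l → (∀ {l′} → l′ ∈ D → l′ ≢ l₀ → l′ ∈ C) →
               ∀ {y} → Involved D y → Near y
        near e D⊆ (y<S , inj₁ p) = inj₁ (y<S , inj₁ p)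
        near {l₀ = l₀} e D⊆ (y<S , inj₂ m) with find m
        ... | l′ , l′∈ , e′ with l′ ≟ᴸ l₀
        ... | yes refl = inj₂ (trans (sym e′) (cong (_/ k) e))
        ... | no  ≢    = inj₁ (y<S , inj₂ (lose (D⊆ l′∈ ≢) e′))

        refute : ∀ f → Total f → Extends f ρ → InjectiveOn f Near → ¬ Falsifies (assign f τ) C
        refute f tot ext-f inj fals with eval (assign f τ) l in e
        ... | false = sndA f tot ext-f (λ p q → inj (near refl A⊆ p) (near refl A⊆ q)) falsA
          where
          falsA : Falsifies (assign f τ) A
          falsA {l′} l′∈ with l′ ≟ᴸ l
          ... | yes refl = e
          ... | no  ≢    = fals (A⊆ l′∈ ≢)
        ... | true = sndB f tot ext-f (λ p q → inj (near (var-ᶜ l) B⊆ p) (near (var-ᶜ l) B⊆ q)) falsB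
          where
          falsB : Falsifies (assign f τ) B
          falsB {l′} l′∈ with l′ ≟ᴸ (l ᶜ)
          ... | yes refl = trans (eval-ᶜ (assign f τ) l) (cong not e)
          ... | no  ≢    = fals (B⊆ l′∈ ≢)

        relocate : Dec (x ∈ involvedList C) → ⊥
        relocate (yes x∈) = refute f tot ext-f (λ p q → inj (known p) (known q)) fals
          where
          known : ∀ {y} → Near y → Involved C y
          known (inj₁ p)    = p
          known (inj₂ refl) = ∈⇒involved x∈
        -- This case includes resolved variables that belong to no pigeon: then x is at least `S`,
        -- and changing f at x does not affect the assignment.
        relocate (no x∉) = move (avoid k (map f (involvedList C)) few)
          where
          few : length (map f (involvedList C)) < n
          few = begin-strict
            length (map f (involvedList C))
              ≡⟨ length-map f (involvedList C) ⟩
            length (involvedList C)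
              ≡⟨ length-++ (map proj₁ ρ) ⟩
            length (map proj₁ ρ) + length (filter (mentions? C) (upTo S))
              ≡⟨ cong₂ _+_ (length-map proj₁ ρ) (length-filter≡count (mentions? C) (upTo S)) ⟩
            length ρ + width C
              <⟨ small ⟩
            n ∎
            where open ≤-Reasoning
          move : (∃ λ h → length h ≡ k × h ∉ map f (involvedList C)) → ⊥
          move (h , len , h∉) = refute g tot-g ext-g inj-g fals-g
            where
            g : ℕ → List Bool
            g y = if does (y ≟ x) then h else f y
            g-x : g x ≡ h
            g-x rewrite dec-true (x ≟ x) refl = refl
            g-other : ∀ {y} → y ≢ x → g y ≡ f y
            g-other {y} y≢x rewrite dec-false (y ≟ x) y≢x = refl
            tot-g : Total g
            tot-g y = if-case (λ h → length h ≡ k) (y ≟ x) (λ _ → len) (λ _ → tot y)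
            involved≢x : ∀ {y} → Involved C y → y ≢ x
            involved≢x p refl = x∉ (involved⇒∈ p)
            ext-g : Extends g ρ
            ext-g {y} y∈ = trans (g-other λ { refl → x∉ (∈-++⁺ˡ (∈-map⁺ proj₁ y∈)) }) (ext-f y∈)
            inj-g : InjectiveOn g Near
            inj-g (inj₁ p) (inj₁ q) e =
              inj p q (trans (sym (g-other (involved≢x p))) (trans e (g-other (involved≢x q))))
            inj-g (inj₂ refl) (inj₂ refl) e = refl
            inj-g (inj₁ p) (inj₂ refl) e = ⊥-elim (h∉ (subst (_∈ map f (involvedList C))
              (trans (sym (g-other (involved≢x p))) (trans e g-x)) (∈-map⁺ f (involved⇒∈ p))))
            inj-g (inj₂ refl) (inj₁ q) e = ⊥-elim (h∉ (subst (_∈ map f (involvedList C))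
              (trans (sym (g-other (involved≢x q))) (trans (sym e) g-x)) (∈-map⁺ f (involved⇒∈ q))))
            fals-g : Falsifies (assign g τ) C
            fals-g {l′} l′∈ = trans (eval-local l′ same) (fals l′∈)
              where
              same : assign g τ (var l′) ≡ assign f τ (var l′)
              same with var l′ <? S * k
              ... | no ¬p = trans (assign-other g τ ¬p) (sym (assign-other f τ ¬p))
              ... | yes p = trans (assign-pigeonVar g τ p) (trans (cong (λ h → nth h (var l′ % k))
                              (g-other (involved≢x {var l′ / k} (pigeonVar-/ p , inj₂ (lose l′∈ refl)))))
                              (sym (assign-pigeonVar f τ p)))

      -- The empty clause mentions no pigeon, so only the pigeons in `ρ` must be kept apart; all
      -- others may share the default hole.
      extension : ∃ λ f → Total f × Extends f ρ × InjectiveOn f (Involved [])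
      extension = place ρ , total ρ (proj₂ M) , extends ρ (proj₁ M) , injective
        where
        place : Assigned → ℕ → List Bool
        place []            _ = replicate k false
        place ((x , h) ∷ ρ) y = if does (y ≟ x) then h else place ρ y
        total : ∀ ρ → All (λ p → proj₁ p < S × length (proj₂ p) ≡ k) ρ → Total (place ρ)
        total []            _              y = length-replicate k
        total ((x , h) ∷ ρ) ((_ , e) ∷ ps) y = if-case (λ h → length h ≡ k) (y ≟ x) (λ _ → e) (λ _ → total ρ ps y)
        extends : ∀ ρ → AllPairs (λ p q → proj₁ p ≢ proj₁ q × proj₂ p ≢ proj₂ q) ρ → Extends (place ρ) ρ
        extends ((x , h) ∷ ρ) (_ ∷ _)  (here refl) rewrite dec-true (x ≟ x) refl = refl
        extends ((x , h) ∷ ρ) (p ∷ ps) {y} (there y∈)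
          rewrite dec-false (y ≟ x) (λ y≡x → proj₁ (All.lookup p y∈) (sym y≡x)) = extends ρ ps y∈
        same-hole : ∀ {ρ} → AllPairs (λ p q → proj₁ p ≢ proj₁ q × proj₂ p ≢ proj₂ q) ρ →
                    ∀ {x y h} → (x , h) ∈ ρ → (y , h) ∈ ρ → x ≡ y
        same-hole (p ∷ ps) (here refl) (here refl) = refl
        same-hole (p ∷ ps) (here refl) (there y∈)  = ⊥-elim (proj₂ (All.lookup p y∈) refl)
        same-hole (p ∷ ps) (there x∈)  (here refl) = ⊥-elim (proj₂ (All.lookup p x∈) refl)
        same-hole (p ∷ ps) (there x∈)  (there y∈)  = same-hole ps x∈ y∈
        injective : InjectiveOn (place ρ) (Involved [])
        injective (_ , inj₁ x∈) (_ , inj₁ y∈) e with ∈-map⁻ proj₁ x∈ | ∈-map⁻ proj₁ y∈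
        ... | (x , h) , p , refl | (y , h′) , q , refl = same-hole (proj₁ M) p (subst (λ h → (y , h) ∈ ρ) h′≡h q)
          where
          h′≡h : h′ ≡ h
          h′≡h = trans (sym (extends ρ (proj₁ M) q)) (trans (sym e) (extends ρ (proj₁ M) p))

  -- The true literal lies outside the pigeon variables, so no placement can undo it.
  TrueUnder : Clause → Set
  TrueUnder C = ∃ λ l → l ∈ C × ¬ IsPigeonVar (var l) × eval τ l ≡ true

  trueUnder⇒killed : ∀ {ρ C} → TrueUnder C → Killed τ ρ C
  trueUnder⇒killed (l , l∈ , np , t) f _ _ fals =
    true≢false (trans (sym t) (trans (eval-local l (sym (assign-other f τ np))) (fals l∈)))

  broad-width : ∀ {C} → Broad C → n ≤ width C
  broad-width {C} broad = s≤s⁻¹ (subst (_≤ suc (width C)) (length-upTo S)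
    (count-pairwise (mentions? C) (AllPairs.applyUpTo⁺₁ id S (λ i<j j<S → broad (<-trans i<j j<S) j<S (<⇒≢ i<j)))))

  -- The second case also covers the copies in `W`, which are axioms with one more literal.
  Initial : Clause → Set
  Initial C = TrueUnder C ⊎ (∃ λ D → D ∈ BPHP2^ k × D ⊆ C)

  -- `new` holds the clauses of the complete derivation and stays fixed in the induction, so that
  -- `rules` may rely on a `τ` chosen for that derivation. Of the current formula only `F ⊆ Δ` is
  -- passed on, since blockedness is exploited against clauses of `F` alone.
  module _ {R : Formula → Clause → Set} {F : Formula} (initial : ∀ {C} → C ∈ F → Initial C)
           (new : List Clause)
           (rules : ∀ {Δ C} → F ⊆ Δ → C ∈ new → R Δ C → ResRule Δ C ⊎ TrueUnder C ⊎ Broad C) where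

    initial-sound : ∀ {ρ C} → C ∈ F → Sound ρ C
    initial-sound {ρ} {C} C∈ = [ killed⇒sound ρ {C} ∘ trueUnder⇒killed , contains-axiom ]′ (initial C∈)
      where
      from : ∀ {D} → Axiom k D → D ⊆ C → Sound ρ C
      from (axiom x<S y<S x≢y len) = axiom-sound ρ {C} x<S y<S x≢y len
      contains-axiom : (∃ λ D → D ∈ BPHP2^ k × D ⊆ C) → Sound ρ C
      contains-axiom (D , D∈ , D⊆C) = from (∈-BPHP⁻ k D∈) D⊆C

    -- Clauses of width at least w are killed by `ρ`, and broad clauses are among them because w ≤
    -- n. For a narrower resolvent, length ρ + w ≤ n provides the free hole that `resolvent-sound`
    -- needs.
    derivation-sound : ∀ {ρ w} → Matching ρ → length ρ + w ≤ n → w ≤ n →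
      ∀ {Δ N} (d : Derivation R F Δ N) → added d ⊆ new →
      (∀ {C} → C ∈ added d → w ≤ width C → Killed τ ρ C) →
      ∀ {C} → C ∈ Δ → Sound ρ C
    derivation-sound M fits w≤n start      _   _    C∈ = initial-sound C∈
    derivation-sound M fits w≤n (step d _) sub kill (there C∈) =
      derivation-sound M fits w≤n d (sub ∘ there) (kill ∘ there) C∈
    derivation-sound {ρ} {w} M fits w≤n (step {Δ} {C = C} d r) sub kill (here refl) = narrow (w ≤? width C)
      where
      earlier : ∀ {A} → A ∈ Δ → Sound ρ A
      earlier = derivation-sound M fits w≤n d (sub ∘ there) (kill ∘ there)
      narrow : Dec (w ≤ width C) → Sound ρ C
      narrow (yes wide) = killed⇒sound ρ {C} (kill (here refl) wide)
      narrow (no ¬wide) with rules (derivation-⊇ d) (sub (here refl)) r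
      ... | inj₁ (inj₁ (A , B , l , A∈ , B∈ , _ , _ , iff , _)) =
        resolvent-sound ρ M {A} {B} {C} l (<-≤-trans (+-monoʳ-< (length ρ) (≰⇒> ¬wide)) fits)
          (λ l′∈ ≢ → proj₂ (iff _) (inj₁ (l′∈ , ≢))) (λ l′∈ ≢ → proj₂ (iff _) (inj₂ (l′∈ , ≢)))
          (earlier A∈) (earlier B∈)
      ... | inj₁ (inj₂ (A , A∈ , A⊆C , _)) = weakening-sound ρ {A} {C} A⊆C (earlier A∈)
      ... | inj₂ (inj₁ t) = killed⇒sound ρ {C} (trueUnder⇒killed t)
      ... | inj₂ (inj₂ b) = ⊥-elim (¬wide (≤-trans w≤n (broad-width b)))

  -- Six steps halve the number of clauses, as 2 * 7^6 = 235298 is below 8^6 = 262144.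
  power-bound : ∀ q L → L < 2 ^ q → L * 7 ^ (6 * q) < 8 ^ (6 * q)
  power-bound q L L<2^q = begin-strict
    L * 7 ^ (6 * q)        <⟨ *-monoˡ-< (7 ^ (6 * q)) {{m^n≢0 7 (6 * q)}} L<2^q ⟩
    2 ^ q * 7 ^ (6 * q)    ≡⟨ cong (2 ^ q *_) (^-*-assoc 7 6 q) ⟨
    2 ^ q * (7 ^ 6) ^ q    ≡⟨ ^-distribʳ-* q 2 (7 ^ 6) ⟨
    (2 * 7 ^ 6) ^ q        ≤⟨ ^-monoˡ-≤ q (≤ᵇ⇒≤ 235298 262144 tt) ⟩
    (8 ^ 6) ^ q            ≡⟨ ^-*-assoc 8 6 q ⟩
    8 ^ (6 * q)            ∎
    where open ≤-Reasoning

  module _ (8≤n : 8 ≤ n) where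
    private
      -- `a` just exceeds n/4, as `S≤4a` requires. `R` is a multiple of 6 for the sake of
      -- `power-bound`; as 24 = 6 * 4, it is at most n/4, which leaves room for `fits`.
      a R : ℕ
      a = suc (n / 4)
      R = 6 * (n / 24)

      4[n/4]≤n : n / 4 * 4 ≤ n
      4[n/4]≤n = m/n*n≤m n 4

      R≤n/4 : R ≤ n / 4
      R≤n/4 = subst (_≤ n / 4) (m*n/n≡m R 4) (/-monoˡ-≤ 4 (≤-trans (≤-reflexive (rearrange (n / 24))) (m/n*n≤m n 24)))
        where
        rearrange : ∀ q → 6 * q * 4 ≡ q * 24
        rearrange = solve-∀

      S≤4a : S ≤ 4 * a
      S≤4a = begin
        suc n                    ≡⟨ cong suc (m≡m%n+[m/n]*n n 4) ⟩
        suc (n % 4) + n / 4 * 4  ≤⟨ +-monoˡ-≤ (n / 4 * 4) (m%n<n n 4) ⟩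
        4 + n / 4 * 4            ≡⟨ *-comm a 4 ⟩
        4 * a                    ∎
        where open ≤-Reasoning

      2≤n/4 : 2 ≤ n / 4
      2≤n/4 = /-monoˡ-≤ 4 8≤n

      fits : R + (R + a) ≤ n
      fits = begin
        R + (R + a)                         ≤⟨ +-mono-≤ R≤n/4 (+-monoˡ-≤ a R≤n/4) ⟩
        n / 4 + (n / 4 + suc (n / 4))       ≤⟨ +-monoʳ-≤ (n / 4) (+-monoʳ-≤ (n / 4) (+-monoˡ-≤ (n / 4) (≤-trans (n≤1+n 1) 2≤n/4))) ⟩
        n / 4 + (n / 4 + (n / 4 + n / 4))   ≡⟨ rearrange (n / 4) ⟩
        n / 4 * 4                           ≤⟨ 4[n/4]≤n ⟩
        n                                   ∎
        where
        open ≤-Reasoning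
        rearrange : ∀ q → q + (q + (q + q)) ≡ q * 4
        rearrange = solve-∀

      2R≤n : 2 * R ≤ n
      2R≤n = begin
        R + (R + 0)  ≤⟨ +-monoʳ-≤ R (+-monoʳ-≤ R z≤n) ⟩
        R + (R + a)  ≤⟨ fits ⟩
        n            ∎
        where open ≤-Reasoning

    open Greedy τ R a (s≤s z≤n) S≤4a 2R≤n

    -- Fewer than 2^(n/24) clauses are few enough for `greedy` to kill all wide ones. Soundness of
    -- the empty clause is then absurd, since every assignment falsifies it.
    lower-bound : ∀ {R F} → (∀ {C} → C ∈ F → Initial C) →
      ∀ {Δ N} (d : Derivation R F Δ N) →
      (∀ {Δ C} → F ⊆ Δ → C ∈ added d → R Δ C → ResRule Δ C ⊎ TrueUnder C ⊎ Broad C) →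
      [] ∈F Δ → 2 ^ (n / 24) ≤ N
    lower-bound initial {N = N} d rules (D , D∈ , D≋[]) with 2 ^ (n / 24) ≤? N
    ... | yes p = p
    ... | no ¬p = ⊥-elim (refuted (greedy R [] Ws ([] , []) ≤-refl (All.all-filter wide? (added d)) few))
      where
      wide? : Decidable Wide
      wide? C = R + a ≤? width C
      Ws : List Clause
      Ws = filter wide? (added d)
      few : length Ws * 7 ^ R < 8 ^ R
      few = power-bound (n / 24) (length Ws) (begin-strict
        length Ws         ≤⟨ length-filter wide? (added d) ⟩
        length (added d)  <⟨ ≤-reflexive (length-added d) ⟩
        N                 <⟨ ≰⇒> ¬p ⟩
        2 ^ (n / 24)      ∎)
        where open ≤-Reasoning
      refuted : (∃ λ ρ → Matching ρ × length ρ ≤ R × [] ⊆ ρ × (∀ {C} → C ∈ Ws → Killed τ ρ C)) → ⊥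
      refuted (ρ , M , |ρ|≤R , _ , kill) with extension ρ M
      ... | f , tot , ext-f , inj =
        derivation-sound initial (added d) rules M (≤-trans (+-monoˡ-≤ (R + a) |ρ|≤R) fits) (≤-trans (m≤n+m (R + a) R) fits)
          d ⊆-refl (λ C∈ wide → kill (∈-filter⁺ wide? C∈ wide))
          (subst (_∈ _) (≋[]⇒≡ D≋[]) D∈) f tot ext-f inj λ ()

≠lit-false : ∀ α l → eval α l ≡ false → l ≡ (var l ≠lit α (var l))
≠lit-false α (pos v) e rewrite e = refl
≠lit-false α (neg v) e with α v
... | true = refl

-- Clauses and variables of `I`.

module IClauses (Γ : Formula) (es : List ExtStep) {m : ℕ} (y z : Fin m → Var) where
  ∈-V⁺ : ∀ {e} → e ∈ es → ∀ j →
         (pos (extVar e) ∷ pos (y j) ∷ neg (z j) ∷ []) ∈ V es m y z ×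
         (neg (extVar e) ∷ pos (y j) ∷ neg (z j) ∷ []) ∈ V es m y z
  ∈-V⁺ e∈ j = ∈-concatMap⁺ _ (lose e∈ (∈-concatMap⁺ _ (lose (∈-allFin j) (here refl)))) ,
              ∈-concatMap⁺ _ (lose e∈ (∈-concatMap⁺ _ (lose (∈-allFin j) (there (here refl)))))

  ∈-V⁻ : ∀ {C} → C ∈ V es m y z → ∃ λ e → ∃ λ j → e ∈ es ×
         ∃ λ l → var l ≡ extVar e × C ≡ l ∷ pos (y j) ∷ neg (z j) ∷ []
  ∈-V⁻ C∈ with find (∈-concatMap⁻ _ {xs = es} C∈)
  ... | e , e∈ , p with find (∈-concatMap⁻ _ {xs = allFinList m} p)
  ... | j , _ , here refl         = e , j , e∈ , pos (extVar e) , refl , refl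
  ... | j , _ , there (here refl) = e , j , e∈ , neg (extVar e) , refl , refl

  ∈-W-yz : ∀ j → (neg (y j) ∷ pos (z j) ∷ []) ∈ W Γ m y z
  ∈-W-yz j = ∈-concatMap⁺ _ (lose (∈-allFin j) (here refl))

  ∈-W-y : ∀ j {C} → C ∈ Γ → (pos (y j) ∷ C) ∈ W Γ m y z
  ∈-W-y j C∈ = ∈-concatMap⁺ _ (lose (∈-allFin j) (there (∈-++⁺ˡ (∈-map⁺ _ C∈))))

  ∈-W-z : ∀ j {C} → C ∈ Γ → (neg (z j) ∷ C) ∈ W Γ m y z
  ∈-W-z j C∈ = ∈-concatMap⁺ _ (lose (∈-allFin j) (there (∈-++⁺ʳ (map (pos (y j) ∷_) Γ) (∈-map⁺ _ C∈))))

  ∈-W⁻ : ∀ {C} → C ∈ W Γ m y z → ∃ λ j →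
         C ≡ neg (y j) ∷ pos (z j) ∷ [] ⊎
         (∃ λ D → D ∈ Γ × C ≡ pos (y j) ∷ D) ⊎ (∃ λ D → D ∈ Γ × C ≡ neg (z j) ∷ D)
  ∈-W⁻ C∈ with find (∈-concatMap⁻ _ {xs = allFinList m} C∈)
  ... | j , _ , here refl = j , inj₁ refl
  ... | j , _ , there p with ∈-++⁻ (map (pos (y j) ∷_) Γ) p
  ... | inj₁ q = let (D , D∈ , e) = ∈-map⁻ _ q in j , inj₂ (inj₁ (D , D∈ , e))
  ... | inj₂ q = let (D , D∈ , e) = ∈-map⁻ _ q in j , inj₂ (inj₂ (D , D∈ , e))

  ∈-I⁻ : ∀ {C} → C ∈ I Γ es m y z → C ∈ Γ ⊎ C ∈ V es m y z ⊎ C ∈ W Γ m y z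
  ∈-I⁻ C∈ with ∈-++⁻ Γ C∈
  ... | inj₁ p = inj₁ p
  ... | inj₂ q = inj₂ (∈-++⁻ (V es m y z) q)

  V⊆I : V es m y z ⊆ I Γ es m y z
  V⊆I = ∈-++⁺ʳ Γ ∘ ∈-++⁺ˡ

  W⊆I : W Γ m y z ⊆ I Γ es m y z
  W⊆I = ∈-++⁺ʳ Γ ∘ ∈-++⁺ʳ (V es m y z)

  occursIn-W⁻ : ∀ {v} → OccursIn v (W Γ m y z) → OccursIn v Γ ⊎ (∃ λ j → v ≡ y j ⊎ v ≡ z j)
  occursIn-W⁻ (C , C∈ , l , l∈ , refl) with ∈-W⁻ C∈ | l∈
  ... | j , inj₁ refl | here refl         = inj₂ (j , inj₁ refl)
  ... | j , inj₁ refl | there (here refl) = inj₂ (j , inj₂ refl)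
  ... | j , inj₂ (inj₁ (D , D∈ , refl)) | here refl  = inj₂ (j , inj₁ refl)
  ... | j , inj₂ (inj₁ (D , D∈ , refl)) | there l∈D = inj₁ (D , D∈ , l , l∈D , refl)
  ... | j , inj₂ (inj₂ (D , D∈ , refl)) | here refl  = inj₂ (j , inj₂ refl)
  ... | j , inj₂ (inj₂ (D , D∈ , refl)) | there l∈D = inj₁ (D , D∈ , l , l∈D , refl)

  occursIn-I⁻ : ∀ {v} → OccursIn v (I Γ es m y z) →
                OccursIn v Γ ⊎ (∃ λ e → e ∈ es × v ≡ extVar e) ⊎ (∃ λ j → v ≡ y j ⊎ v ≡ z j)
  occursIn-I⁻ (C , C∈ , l , l∈ , refl) with ∈-I⁻ C∈
  ... | inj₁ p = inj₁ (C , p , l , l∈ , refl)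
  ... | inj₂ (inj₁ p) with ∈-V⁻ p | l∈
  ... | e , j , e∈ , l₀ , l₀≡ , refl | here refl                 = inj₂ (inj₁ (e , e∈ , l₀≡))
  ... | e , j , e∈ , l₀ , l₀≡ , refl | there (here refl)         = inj₂ (inj₂ (j , inj₁ refl))
  ... | e , j , e∈ , l₀ , l₀≡ , refl | there (there (here refl)) = inj₂ (inj₂ (j , inj₂ refl))
  occursIn-I⁻ (C , C∈ , l , l∈ , refl) | inj₂ (inj₂ p) = [ inj₁ , inj₂ ∘ inj₂ ]′ (occursIn-W⁻ (C , p , l , l∈ , refl))

-- Set-blocked clauses that must be broad.

module SetBlockedClauses (k : ℕ) .{{_ : NonZero k}} where
  open Pigeons k

  Γ : Formula
  Γ = BPHP2^ k

  axiomClause : ℕ → ℕ → List Bool → Clause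
  axiomClause x y h = holeLits k x h ++ holeLits k y h

  -- Placing all pigeons into h falsifies the axiom, and a falsifiable clause is not tautological.
  axiom-isClause : ∀ {x y h} → x < S → y < S → length h ≡ k → IsClause (axiomClause x y h)
  axiom-isClause {x} {y} {h} x<S y<S len = falsifiable⇒clause {α} falsified
    where
    α : Assignment
    α = assign (λ _ → h) (λ _ → false)
    falsified : Falsifies α (axiomClause x y h)
    falsified l∈ with ∈-++⁻ (holeLits k x h) l∈
    ... | inj₁ p = falsifies-holeLits k x α (val-assign (λ _ → h) (λ _ → false) (λ _ → len) x<S) p
    ... | inj₂ p = falsifies-holeLits k y α (val-assign (λ _ → h) (λ _ → false) (λ _ → len) y<S) p

  holeLits-mentions : ∀ {x h l} → l ∈ holeLits k x h → var l / k ≡ x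
  holeLits-mentions {x} l∈ = let (i , i<k , e) = holeLits-vars k x l∈ in trans (cong (_/ k) e) (bvar-/ k x i<k)

  mentions-ᶜ : ∀ {C x} l → (l ᶜ) ∈ C → var l / k ≡ x → Mentions C x
  mentions-ᶜ l l∈ e = lose l∈ (trans (cong (_/ k) (var-ᶜ l)) e)

  occursIn⇒pigeonVar : ∀ {v} → OccursIn v Γ → IsPigeonVar v
  occursIn⇒pigeonVar (C , C∈ , l , l∈ , refl) = from (∈-BPHP⁻ k C∈) l∈
    where
    from : ∀ {C} → Axiom k C → l ∈ C → IsPigeonVar (var l)
    from (axiom {x} {y} {h} x<S y<S _ _) l∈ with ∈-++⁻ (holeLits k x h) l∈
    ... | inj₁ p = isPigeonVar (subst (_< S) (sym (holeLits-mentions p)) x<S)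
    ... | inj₂ p = isPigeonVar (subst (_< S) (sym (holeLits-mentions p)) y<S)

  other : ∀ x → ∃ λ y → y < S × x ≢ y
  other zero    = 1 , s≤s (m^n>0 2 k) , λ ()
  other (suc x) = 0 , s≤s z≤n , λ ()

  pigeonVar⇒occursIn : ∀ {v} → IsPigeonVar v → OccursIn v Γ
  pigeonVar⇒occursIn {v} p with other (v / k) | vars-holeLits k (v / k) {replicate k false} (length-replicate k) (m%n<n v k)
  ... | y , y<S , x≢y | l , l∈ , e =
    _ , ∈-BPHP k {h = replicate k false} (pigeonVar-/ p) y<S x≢y (length-replicate k) , l , ∈-++⁺ˡ l∈ ,
    trans e (trans (+-comm _ (v % k)) (sym (m≡m%n+[m/n]*n v k)))

  module _ {Δ : Formula} {C L : List Lit} (C-clause : IsClause C) (L⊆C : L ⊆ C) (blocked : SetBlockedFor Δ C L) where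

    -- Some position of pigeon x satisfies all literals of L and falsifies all literals of C ∖ L
    -- about x; if C does not mention y, then y can be put into the same hole, which makes the
    -- axiom about x, y and this hole a counterexample to blockedness.
    pigeon-literal⇒broad : Γ ⊆ Δ → ∀ {l} → l ∈ L → IsPigeonVar (var l) → Broad C
    pigeon-literal⇒broad Γ⊆Δ {l} l∈L pv {u} {v} u<S v<S u≢v with u ≟ var l / k | v ≟ var l / k
    ... | yes u≡x | _       = inj₁ (lose (L⊆C l∈L) (sym u≡x))
    ... | no _    | yes v≡x = inj₂ (lose (L⊆C l∈L) (sym v≡x))
    ... | no u≢x  | no _    = inj₁ (decidable-stable (mentions? C u) (unmentioned u<S u≢x))
      where
      x : ℕ
      x = var l / k

      -- `v ≠lit b` is the literal that the value b falsifies: it must not lie in L. Its complement,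
      -- made true by b, may lie in C only if it lies in L.
      choice : ∀ v → ∃ λ b → (v ≠lit b) ∉ L × (((v ≠lit b) ᶜ) ∈ C → ((v ≠lit b) ᶜ) ∈ L)
      choice v with pos v ∈ᴸ? L | neg v ∈ᴸ? L | pos v ∈ᴸ? C
      ... | yes p | _     | _     = true , (λ n → C-clause (pos v , L⊆C p , L⊆C n)) , λ _ → p
      ... | no ¬p | yes n | _     = false , ¬p , λ _ → n
      ... | no ¬p | no ¬n | yes p = false , ¬p , λ n → ⊥-elim (C-clause (pos v , p , n))
      ... | no ¬p | no ¬n | no ¬c = true , ¬n , λ c → ⊥-elim (¬c c)

      α : Assignment
      α v = proj₁ (choice v)

      h : List Bool
      h = val k α x

      x<S : x < S
      x<S = pigeonVar-/ pv

      chosen : ∀ {e} → e ∈ holeLits k x h → e ∉ L × ((e ᶜ) ∈ C → (e ᶜ) ∈ L)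
      chosen {e} e∈ = subst (λ e → e ∉ L × ((e ᶜ) ∈ C → (e ᶜ) ∈ L))
        (sym (≠lit-false α e (falsifies-holeLits k x α refl e∈))) (proj₂ (choice (var e)))

      unmentioned : ∀ {u} → u < S → u ≢ x → ¬ ¬ Mentions C u
      unmentioned {u} u<S u≢x ¬m with blocked E (Γ⊆Δ (∈-BPHP k x<S u<S (u≢x ∘ sym) (length-val k α x))) (l , l∈L , lᶜ∈E) E∩L
        where
        E : Clause
        E = axiomClause x u h
        lᶜ∈E : (l ᶜ) ∈ E
        lᶜ∈E with vars-holeLits k x (length-val k α x) (m%n<n (var l) k)
        ... | e , e∈ , var-e with var-≡ l e (trans (trans (m≡m%n+[m/n]*n (var l) k) (+-comm (var l % k) _)) (sym var-e))
        ... | inj₁ refl = ⊥-elim (proj₁ (chosen e∈) l∈L)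
        ... | inj₂ refl = ∈-++⁺ˡ (subst (_∈ holeLits k x h) (sym (ᶜ-involutive e)) e∈)
        E∩L : ∀ l → l ∈ L → l ∉ E
        E∩L l l∈L l∈E with ∈-++⁻ (holeLits k x h) l∈E
        ... | inj₁ p = proj₁ (chosen p) l∈L
        ... | inj₂ p = ¬m (lose (L⊆C l∈L) (holeLits-mentions p))
      -- A clashing pair cannot lie within C or within the axiom. A mixed pair on x contradicts the
      -- choice of h, and one on u would make C mention u.
      ... | l , inj₁ (p , _) , inj₁ (q , _) = C-clause (l , p , q)
      ... | l , inj₂ (p , _) , inj₂ (q , _) = axiom-isClause {x} {u} x<S u<S (length-val k α x) (l , p , q)
      ... | l , inj₁ (p , p∉) , inj₂ (q , _) with ∈-++⁻ (holeLits k x h) q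
      ... | inj₁ r = p∉ (subst (_∈ L) (ᶜ-involutive l) (proj₂ (chosen r) (subst (_∈ C) (sym (ᶜ-involutive l)) p)))
      ... | inj₂ r = ¬m (mentions-ᶜ (l ᶜ) (subst (_∈ C) (sym (ᶜ-involutive l)) p) (holeLits-mentions r))
      unmentioned {u} u<S u≢x ¬m | l , inj₂ (p , _) , inj₁ (q , q∉) with ∈-++⁻ (holeLits k x h) p
      ... | inj₁ r = q∉ (proj₂ (chosen r) q)
      ... | inj₂ r = ¬m (mentions-ᶜ l q (holeLits-mentions r))

    -- Here blockedness forces C to clash with every axiom, so no two pigeons are unmentioned.
    copy⇒broad : ∀ {l₀} → (l₀ ᶜ) ∈ L → (∀ {E} → E ∈ Γ → (l₀ ∷ E) ∈ Δ) → Broad C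
    copy⇒broad {l₀} l₀ᶜ∈L copy {u} {v} u<S v<S u≢v with mentions? C u | mentions? C v
    ... | yes m | _     = inj₁ m
    ... | no _  | yes m = inj₂ m
    ... | no ¬u | no ¬v = ⊥-elim (clash (blocked D (copy (∈-BPHP k u<S v<S u≢v len)) (_ , l₀ᶜ∈L , here (ᶜ-involutive l₀)) D∩L))
      where
      h : List Bool
      h = replicate k false
      len : length h ≡ k
      len = length-replicate k
      E D : Clause
      E = axiomClause u v h
      D = l₀ ∷ E
      foreign : ∀ {l} → l ∈ E → l ∉ C × (l ᶜ) ∉ C
      foreign {l} l∈ with ∈-++⁻ (holeLits k u h) l∈
      ... | inj₁ p = (λ l∈C → ¬u (lose l∈C (holeLits-mentions p))) , λ l∈C → ¬u (mentions-ᶜ l l∈C (holeLits-mentions p))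
      ... | inj₂ p = (λ l∈C → ¬v (lose l∈C (holeLits-mentions p))) , λ l∈C → ¬v (mentions-ᶜ l l∈C (holeLits-mentions p))
      D∩L : ∀ l → l ∈ L → l ∉ D
      D∩L l l∈L (here refl) = C-clause (l , L⊆C l∈L , L⊆C l₀ᶜ∈L)
      D∩L l l∈L (there p)   = proj₁ (foreign p) (L⊆C l∈L)
      rest : ∀ {l} → l ∈ D → (l ᶜ) ∉ L → l ∈ E
      rest (here refl) ∉L = ⊥-elim (∉L l₀ᶜ∈L)
      rest (there p)   _  = p
      clash : TautPred (λ l → (l ∈ C × l ∉ L) ⊎ (l ∈ D × (l ᶜ) ∉ L)) → ⊥
      clash (l , inj₁ (p , _) , inj₁ (q , _)) = C-clause (l , p , q)
      clash (l , inj₁ (p , _) , inj₂ (q , r)) = proj₂ (foreign (rest q r)) (subst (_∈ C) (sym (ᶜ-involutive l)) p)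
      clash (l , inj₂ (p , r) , inj₁ (q , _)) = proj₂ (foreign (rest p r)) q
      clash (l , inj₂ (p , r) , inj₂ (q , s)) = axiom-isClause {u} {v} u<S v<S len (l , rest p r , rest q s)

applyUpTo-tabulate : ∀ m (g : ℕ → Bool) (f : Fin m → Bool) → (∀ j → g (toℕ j) ≡ f j) → applyUpTo g m ≡ tabulate f
applyUpTo-tabulate zero    g f e = refl
applyUpTo-tabulate (suc m) g f e = cong₂ _∷_ (e Fin.zero) (applyUpTo-tabulate m (g ∘ suc) (f ∘ Fin.suc) (e ∘ Fin.suc))

-- Lower bounds for BPHP and for `I`.

module SBC⁻LowerBound (k : ℕ) .{{_ : NonZero k}} (8≤n : 8 ≤ 2 ^ k) where
  open Pigeons k
  open SetBlockedClauses k

  -- Only pigeon variables occur here, so every set-blocked clause is broad. This bound also makes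
  -- 2^m large in the theorem.
  bphp-lower-bound : ∀ {N} → SBC⁻Proof Γ N → 2 ^ (n / 24) ≤ N
  bphp-lower-bound (Δ , d , []∈) = lower-bound 8≤n (λ {C} C∈ → inj₂ (C , C∈ , id)) d rules []∈
    where
    open Soundness k (λ _ → false) using (lower-bound; TrueUnder)
    rules : ∀ {Δ C} → Γ ⊆ Δ → C ∈ added d → Restrict Γ SBCRule Δ C → ResRule Δ C ⊎ TrueUnder C ⊎ Broad C
    rules Γ⊆Δ _ (inj₁ r , _) = inj₁ r
    rules Γ⊆Δ _ (inj₂ (C-clause , L , (l , l∈) , L⊆C , blocked) , vars) =
      inj₂ (inj₂ (pigeon-literal⇒broad C-clause L⊆C blocked Γ⊆Δ l∈ (occursIn⇒pigeonVar (vars (L⊆C l∈)))))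

  module _ {es : List ExtStep} {m : ℕ} {y z : Fin m → Var} (fresh : FreshYZ Γ es m y z) where
    private
      y-inj : ∀ i j → y i ≡ y j → i ≡ j
      y-inj = proj₁ fresh
      z-inj : ∀ i j → z i ≡ z j → i ≡ j
      z-inj = proj₁ (proj₂ fresh)
      y≢z : ∀ i j → y i ≢ z j
      y≢z = proj₁ (proj₂ (proj₂ fresh))

    open IClauses Γ es y z

    IΓ : Formula
    IΓ = I Γ es m y z

    not-pigeonVar : ∀ {v} → ¬ OccursIn v (Γ ++ extFormula es) → ¬ IsPigeonVar v
    not-pigeonVar ∉ p = let (C , C∈ , rest) = pigeonVar⇒occursIn p in ∉ (C , ∈-++⁺ˡ C∈ , rest)

    y-not-pigeonVar : ∀ j → ¬ IsPigeonVar (y j)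
    y-not-pigeonVar j = not-pigeonVar (proj₁ (proj₂ (proj₂ (proj₂ fresh))) j)

    z-not-pigeonVar : ∀ j → ¬ IsPigeonVar (z j)
    z-not-pigeonVar j = not-pigeonVar (proj₂ (proj₂ (proj₂ (proj₂ fresh))) j)

    YZ : Fin m → Var → Set
    YZ j v = v ≡ y j ⊎ v ≡ z j

    Touches : Clause → Fin m → Set
    Touches C j = Any (λ l → YZ j (var l)) C

    yz? : ∀ j v → Dec (YZ j v)
    yz? j v = (v ≟ y j) ⊎-dec (v ≟ z j)

    module Side (b : Fin m → Bool) where
      τ : Assignment
      τ v with Fin.any? (λ j → yz? j v)
      ... | yes (j , _) = b j
      ... | no _        = false

      τ-yz : ∀ {v} j → YZ j v → τ v ≡ b j
      τ-yz {v} j p with Fin.any? (λ j → yz? j v)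
      ... | no ∄        = ⊥-elim (∄ (j , p))
      ... | yes (i , q) = cong b (same p q)
        where
        same : YZ j v → YZ i v → i ≡ j
        same (inj₁ p) (inj₁ q) = y-inj i j (trans (sym q) p)
        same (inj₂ p) (inj₂ q) = z-inj i j (trans (sym q) p)
        same (inj₁ p) (inj₂ q) = ⊥-elim (y≢z j i (trans (sym p) q))
        same (inj₂ p) (inj₁ q) = ⊥-elim (y≢z i j (trans (sym q) p))

      open Soundness k τ using (TrueUnder; Initial; lower-bound) public

      yz-not-pigeonVar : ∀ {v} j → YZ j v → ¬ IsPigeonVar v
      yz-not-pigeonVar j (inj₁ refl) = y-not-pigeonVar j
      yz-not-pigeonVar j (inj₂ refl) = z-not-pigeonVar j

      true-literal : ∀ {C l} j → l ∈ C → YZ j (var l) → eval (λ _ → b j) l ≡ true → TrueUnder C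
      true-literal {l = l} j l∈ p t = l , l∈ , yz-not-pigeonVar j p , trans (eval-local l (τ-yz j p)) t

      y∨¬z-true : ∀ {C} j → pos (y j) ∈ C → neg (z j) ∈ C → TrueUnder C
      y∨¬z-true j y∈ z∈ with b j in e
      ... | true  = true-literal j y∈ (inj₁ refl) e
      ... | false = true-literal j z∈ (inj₂ refl) (cong not e)

      ¬y∨z-true : ∀ {C} j → neg (y j) ∈ C → pos (z j) ∈ C → TrueUnder C
      ¬y∨z-true j y∈ z∈ with b j in e
      ... | true  = true-literal j z∈ (inj₂ refl) e
      ... | false = true-literal j y∈ (inj₁ refl) (cong not e)

      -- With y j = z j all clauses of `V` and all clauses ¬y j ∨ z j are true; the rest of `W`
      -- consists of weakened axioms.
      initial : ∀ {C} → C ∈ IΓ → Initial C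
      initial {C} C∈ with ∈-I⁻ C∈
      ... | inj₁ p = inj₂ (C , p , id)
      ... | inj₂ (inj₁ p) with ∈-V⁻ p
      ... | e , j , e∈ , l , _ , refl = inj₁ (y∨¬z-true j (there (here refl)) (there (there (here refl))))
      initial {C} C∈ | inj₂ (inj₂ p) with ∈-W⁻ p
      ... | j , inj₁ refl                     = inj₁ (¬y∨z-true j (here refl) (there (here refl)))
      ... | j , inj₂ (inj₁ (D , D∈ , refl))   = inj₂ (D , D∈ , there)
      ... | j , inj₂ (inj₂ (D , D∈ , refl))   = inj₂ (D , D∈ , there)

    -- The value of y j and z j that falsifies the literals of a clause on y j and z j, if one
    -- value does.
    bad : Clause → Fin m → Bool
    bad C j = not (does (any? (λ l → (l ≟ᴸ pos (y j)) ⊎-dec (l ≟ᴸ pos (z j))) C))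

    -- If C has a positive literal on the pair, the bad value is false and b j = true satisfies that
    -- literal. Otherwise its literals on the pair are negative, and b j is false.
    touch-true : ∀ b {C} j → Touches C j → b j ≢ bad C j → Side.TrueUnder b C
    touch-true b {C} j touch ≢ with any? (λ l → (l ≟ᴸ pos (y j)) ⊎-dec (l ≟ᴸ pos (z j))) C
    ... | yes p with find p
    ... | l , l∈ , inj₁ refl = Side.true-literal b j l∈ (inj₁ refl) (Bool.¬-not ≢)
    ... | l , l∈ , inj₂ refl = Side.true-literal b j l∈ (inj₂ refl) (Bool.¬-not ≢)
    touch-true b {C} j touch ≢ | no ¬p with find touch
    ... | pos v , l∈ , inj₁ refl = ⊥-elim (¬p (lose l∈ (inj₁ refl)))
    ... | pos v , l∈ , inj₂ refl = ⊥-elim (¬p (lose l∈ (inj₂ refl)))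
    ... | neg v , l∈ , yz        = Side.true-literal b j l∈ yz (cong not (Bool.¬-not ≢))

    module _ {Δ : Formula} {C L : List Lit} (I⊆Δ : IΓ ⊆ Δ)
             (C-clause : IsClause C) (L⊆C : L ⊆ C) (blocked : SetBlockedFor Δ C L) where

      -- For every j, `V` contains x ∨ y j ∨ ¬z j and ¬x ∨ y j ∨ ¬z j. The one with the complement
      -- of l can clash with the rest of C only on y j or z j.
      extVar⇒touches : ∀ {l e} → l ∈ L → e ∈ es → var l ≡ extVar e → ∀ j → Touches C j
      extVar⇒touches {l} {e} l∈ e∈ var-l j = decidable-stable (any? (λ l → yz? j (var l)) C)
        λ untouched → clash untouched (blocked D (I⊆Δ (V⊆I (D∈V l var-l))) (l , l∈ , here refl) (D∩L untouched))
        where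
        D : Clause
        D = (l ᶜ) ∷ pos (y j) ∷ neg (z j) ∷ []
        D∈V : ∀ l → var l ≡ extVar e → ((l ᶜ) ∷ pos (y j) ∷ neg (z j) ∷ []) ∈ V es m y z
        D∈V (pos _) refl = proj₂ (∈-V⁺ e∈ j)
        D∈V (neg _) refl = proj₁ (∈-V⁺ e∈ j)
        D∩L : ¬ Touches C j → ∀ l → l ∈ L → l ∉ D
        D∩L untouched _ l′∈ (here refl)                 = C-clause (l , L⊆C l∈ , L⊆C l′∈)
        D∩L untouched _ l′∈ (there (here refl))         = untouched (lose (L⊆C l′∈) (inj₁ refl))
        D∩L untouched _ l′∈ (there (there (here refl))) = untouched (lose (L⊆C l′∈) (inj₂ refl))
        remaining : ∀ {l′} → l′ ∈ D → (l′ ᶜ) ∉ L → l′ ≡ pos (y j) ⊎ l′ ≡ neg (z j)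
        remaining (here refl)                 ∉ = ⊥-elim (∉ (subst (_∈ L) (sym (ᶜ-involutive l)) l∈))
        remaining (there (here refl))         ∉ = inj₁ refl
        remaining (there (there (here refl))) ∉ = inj₂ refl
        touches : ∀ {l′ l″} → l′ ≡ pos (y j) ⊎ l′ ≡ neg (z j) → l″ ∈ C → var l″ ≡ var l′ → Touches C j
        touches (inj₁ refl) l″∈ e = lose l″∈ (inj₁ e)
        touches (inj₂ refl) l″∈ e = lose l″∈ (inj₂ e)
        apart : ∀ l′ → l′ ≡ pos (y j) ⊎ l′ ≡ neg (z j) → (l′ ᶜ) ≡ pos (y j) ⊎ (l′ ᶜ) ≡ neg (z j) → ⊥
        apart _ (inj₁ refl) (inj₁ ())
        apart _ (inj₁ refl) (inj₂ e) = y≢z j j (cong var e)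
        apart _ (inj₂ refl) (inj₁ e) = y≢z j j (sym (cong var e))
        apart _ (inj₂ refl) (inj₂ ())
        clash : ¬ Touches C j → TautPred (λ l → (l ∈ C × l ∉ L) ⊎ (l ∈ D × (l ᶜ) ∉ L)) → ⊥
        clash _ (l′ , inj₁ (p , _) , inj₁ (q , _)) = C-clause (l′ , p , q)
        clash u (l′ , inj₁ (p , _) , inj₂ (q , r)) = u (touches (remaining q r) p (sym (var-ᶜ l′)))
        clash u (l′ , inj₂ (p , r) , inj₁ (q , _)) = u (touches (remaining p r) q (var-ᶜ l′))
        clash u (l′ , inj₂ (p , r) , inj₂ (q , s)) = apart l′ (remaining p r) (remaining q s)

      module _ (b : Fin m → Bool) where
        open Side b using (TrueUnder; y∨¬z-true)

        -- The literal ¬y j faces the whole copy y j ∨ Γ inside `W`; for the literal z j the copy is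
        -- ¬z j ∨ Γ.
        y-copy : ∀ j → neg (y j) ∈ L → Broad C
        y-copy j ∈L = copy⇒broad C-clause L⊆C blocked {pos (y j)} ∈L (λ E∈ → I⊆Δ (W⊆I (∈-W-y j E∈)))

        z-copy : ∀ j → pos (z j) ∈ L → Broad C
        z-copy j ∈L = copy⇒broad C-clause L⊆C blocked {neg (z j)} ∈L (λ E∈ → I⊆Δ (W⊆I (∈-W-z j E∈)))

        yz-clause : ∀ j → (∃ λ l → l ∈ L × (l ᶜ) ∈ (neg (y j) ∷ pos (z j) ∷ [])) →
          neg (y j) ∉ L → pos (z j) ∉ L →
          TautPred (λ l → (l ∈ C × l ∉ L) ⊎ (l ∈ (neg (y j) ∷ pos (z j) ∷ []) × (l ᶜ) ∉ L))
        yz-clause j hit ¬y z∉ = blocked _ (I⊆Δ (W⊆I (∈-W-yz j))) hit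
          λ { _ p (here refl) → ¬y p ; _ p (there (here refl)) → z∉ p }

        -- Only one literal of ¬y ∨ z is left after removing the complements of L, so its
        -- complement must lie in C.
        y⇒ : ∀ j → pos (y j) ∈ L → TrueUnder C ⊎ Broad C
        y⇒ j y∈ with pos (z j) ∈ᴸ? L
        ... | yes z∈ = inj₂ (z-copy j z∈)
        ... | no  z∉ = inj₁ (y∨¬z-true j (L⊆C y∈) (¬z∈C (yz-clause j (_ , y∈ , here refl)
                              (λ n → C-clause (_ , L⊆C y∈ , L⊆C n)) z∉)))
          where
          ¬z∈C : TautPred (λ l → (l ∈ C × l ∉ L) ⊎ (l ∈ (neg (y j) ∷ pos (z j) ∷ []) × (l ᶜ) ∉ L)) → neg (z j) ∈ C
          ¬z∈C (l , inj₁ (p , _) , inj₁ (q , _))                  = ⊥-elim (C-clause (l , p , q))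
          ¬z∈C (_ , inj₂ (here refl , y∉) , _)                    = ⊥-elim (y∉ y∈)
          ¬z∈C (_ , inj₂ (there (here refl) , _) , inj₁ (q , _))  = q
          ¬z∈C (_ , inj₂ (there (here refl) , _) , inj₂ (here e , _)) = ⊥-elim (y≢z j j (sym (cong var e)))
          ¬z∈C (_ , inj₂ (there (here refl) , _) , inj₂ (there (here ()) , _))
          ¬z∈C (pos v , inj₁ (p , _) , inj₂ (here refl , y∉))     = ⊥-elim (y∉ y∈)
          ¬z∈C (neg v , inj₁ (p , _) , inj₂ (there (here refl) , _)) = p
          ¬z∈C (pos v , inj₁ (p , _) , inj₂ (there (here ()) , _))

        ¬z⇒ : ∀ j → neg (z j) ∈ L → TrueUnder C ⊎ Broad C
        ¬z⇒ j z∈ with neg (y j) ∈ᴸ? L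
        ... | yes y∈ = inj₂ (y-copy j y∈)
        ... | no  y∉ = inj₁ (y∨¬z-true j (y∈C (yz-clause j (_ , z∈ , there (here refl)) y∉
                              (λ p → C-clause (_ , L⊆C p , L⊆C z∈)))) (L⊆C z∈))
          where
          y∈C : TautPred (λ l → (l ∈ C × l ∉ L) ⊎ (l ∈ (neg (y j) ∷ pos (z j) ∷ []) × (l ᶜ) ∉ L)) → pos (y j) ∈ C
          y∈C (l , inj₁ (p , _) , inj₁ (q , _))                  = ⊥-elim (C-clause (l , p , q))
          y∈C (_ , inj₂ (there (here refl) , z∉) , _)            = ⊥-elim (z∉ z∈)
          y∈C (_ , inj₂ (here refl , _) , inj₁ (q , _))          = q
          y∈C (_ , inj₂ (here refl , _) , inj₂ (here () , _))
          y∈C (_ , inj₂ (here refl , _) , inj₂ (there (here e) , _)) = ⊥-elim (y≢z j j (cong var e))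
          y∈C (neg v , inj₁ (p , _) , inj₂ (there (here refl) , z∉)) = ⊥-elim (z∉ z∈)
          y∈C (pos v , inj₁ (p , _) , inj₂ (here refl , _))      = p
          y∈C (neg v , inj₁ (p , _) , inj₂ (here () , _))
          y∈C (pos v , inj₁ (p , _) , inj₂ (there (here ()) , _))

        -- A single literal of L decides the case: its variable belongs to a pigeon, to the
        -- extension or to a pair.
        set-blocked : ∀ {l} → l ∈ L → OccursIn (var l) IΓ →
                      (∀ j → Touches C j) ⊎ TrueUnder C ⊎ Broad C
        set-blocked {l} l∈ occ with occursIn-I⁻ occ
        ... | inj₁ p = inj₂ (inj₂ (pigeon-literal⇒broad C-clause L⊆C blocked (I⊆Δ ∘ ∈-++⁺ˡ) l∈ (occursIn⇒pigeonVar p)))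
        ... | inj₂ (inj₁ (e , e∈ , var-l)) = inj₁ (extVar⇒touches l∈ e∈ var-l)
        set-blocked {pos _} l∈ occ | inj₂ (inj₂ (j , inj₁ refl)) = inj₂ (y⇒ j l∈)
        set-blocked {neg _} l∈ occ | inj₂ (inj₂ (j , inj₁ refl)) = inj₂ (inj₂ (y-copy j l∈))
        set-blocked {pos _} l∈ occ | inj₂ (inj₂ (j , inj₂ refl)) = inj₂ (inj₂ (z-copy j l∈))
        set-blocked {neg _} l∈ occ | inj₂ (inj₂ (j , inj₂ refl)) = inj₂ (¬z⇒ j l∈)

    module _ {N : ℕ} (small : N ≤ 2 ^ m) where
      -- Fewer than 2^m clauses cannot exclude all values of the pairs (y j , z j).
      I-lower-bound : SBC⁻Proof IΓ N → 2 ^ (n / 24) ≤ N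
      I-lower-bound (Δ , d , []∈) = choose (avoid m (map (tabulate ∘ bad) (added d)) few)
        where
        few : length (map (tabulate ∘ bad) (added d)) < 2 ^ m
        few = begin-strict
          length (map (tabulate ∘ bad) (added d))  ≡⟨ length-map (tabulate ∘ bad) (added d) ⟩
          length (added d)                         <⟨ ≤-reflexive (length-added d) ⟩
          N                                        ≤⟨ small ⟩
          2 ^ m                                    ∎
          where open ≤-Reasoning
        choose : (∃ λ bs → length bs ≡ m × bs ∉ map (tabulate ∘ bad) (added d)) → 2 ^ (n / 24) ≤ N
        choose (bs , len , bs∉) = Side.lower-bound b 8≤n (Side.initial b) d rules []∈
          where
          b : Fin m → Bool
          b j = nth bs (toℕ j)
          avoids : ∀ {C} → C ∈ added d → ∃ λ j → b j ≢ bad C j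
          avoids {C} C∈ with Fin.any? (λ j → ¬? (b j Bool.≟ bad C j))
          ... | yes p = p
          ... | no ∄ = ⊥-elim (bs∉ (subst (_∈ map (tabulate ∘ bad) (added d)) (sym bs≡) (∈-map⁺ (tabulate ∘ bad) C∈)))
            where
            bs≡ : bs ≡ tabulate (bad C)
            bs≡ = trans (sym (applyUpTo-nth bs)) (trans (cong (applyUpTo (nth bs)) len)
              (applyUpTo-tabulate m (nth bs) (bad C)
                λ j → decidable-stable (b j Bool.≟ bad C j) λ ≢ → ∄ (j , ≢)))
          rules : ∀ {Δ C} → IΓ ⊆ Δ → C ∈ added d → Restrict IΓ SBCRule Δ C → ResRule Δ C ⊎ Side.TrueUnder b C ⊎ Broad C
          rules I⊆Δ C∈ (inj₁ r , _) = inj₁ r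
          rules I⊆Δ C∈ (inj₂ (C-clause , L , (l , l∈) , L⊆C , blocked) , vars)
            with set-blocked I⊆Δ C-clause L⊆C blocked b l∈ (vars (L⊆C l∈))
          ... | inj₂ r     = inj₂ r
          ... | inj₁ touch = let (j , ≢) = avoids C∈ in inj₂ (inj₁ (touch-true b j (touch j) ≢))

-- Phrased as a function on derivations, so that continuations compose without concatenating
-- derivations.
record Reach (Δ : Formula) (M : ℕ) (P : Formula → Set) : Set where
  constructor reach
  field
    {Δ′}     : Formula
    {steps}  : ℕ
    grows    : Δ ⊆ Δ′
    holds    : P Δ′
    bounded  : steps ≤ M
    continue : ∀ {Γ N} → Derivation ResRule Γ Δ N → Derivation ResRule Γ Δ′ (steps + N)

Monotone : (Formula → Set) → Set
Monotone P = ∀ {Δ Δ′} → Δ ⊆ Δ′ → P Δ → P Δ′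

done : ∀ {Δ M P} → P Δ → Reach Δ M P
done p = reach id p z≤n id

one-step : ∀ {Δ C} → ResRule Δ C → Reach Δ 1 (C ∈_)
one-step r = reach there (here refl) ≤-refl (λ d → step d r)

infixl 1 _>>=[_]_

_>>=[_]_ : ∀ {Δ M M′ P Q} → Reach Δ M P → Monotone P → (∀ {Δ′} → Δ ⊆ Δ′ → P Δ′ → Reach Δ′ M′ Q) →
           Reach Δ (M + M′) (λ Δ → P Δ × Q Δ)
reach {Δ₁} {s} Δ⊆ p s≤ c >>=[ mono ] f with f Δ⊆ p
... | reach {Δ₂} {s′} Δ₁⊆ q s′≤ c′ =
  reach (Δ₁⊆ ∘ Δ⊆) (mono Δ₁⊆ p , q) (+-mono-≤ s≤ s′≤)
    (λ {Γ} {N} d → subst (Derivation ResRule Γ Δ₂) (rearrange s s′ N) (c′ (c d)))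
  where
  rearrange : ∀ a b c → b + (a + c) ≡ a + b + c
  rearrange = solve-∀

weaken : ∀ {Δ M M′ P Q} → M ≤ M′ → (∀ {Δ′} → P Δ′ → Q Δ′) → Reach Δ M P → Reach Δ M′ Q
weaken M≤ P⇒Q (reach Δ⊆ p s≤ c) = reach Δ⊆ (P⇒Q p) (≤-trans s≤ M≤) c

for : ∀ {M} {P : ℕ → Formula → Set} → (∀ i → Monotone (P i)) → ∀ m {Δ} →
      (∀ {Δ′} i → i < m → Δ ⊆ Δ′ → Reach Δ′ M (P i)) → Reach Δ (m * M) (λ Δ → ∀ i → i < m → P i Δ)
for mono zero    f = done (λ _ ())
for {M} {P} mono (suc m) f = weaken (≤-reflexive (+-comm (m * M) M)) extend
  (for mono m (λ i i<m → f i (m<n⇒m<1+n i<m))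
    >>=[ (λ Δ⊆ p i i<m → mono i Δ⊆ (p i i<m)) ] λ Δ⊆ _ → f m ≤-refl Δ⊆)
  where
  extend : ∀ {Δ} → (∀ i → i < m → P i Δ) × P m Δ → ∀ i → i < suc m → P i Δ
  extend {Δ} (p , q) i i<1+m with m≤n⇒m<n∨m≡n (s≤s⁻¹ i<1+m)
  ... | inj₁ i<m  = p i i<m
  ... | inj₂ refl = q

when : ∀ {Δ M P} {Q : Set} → Dec Q → (Q → Reach Δ M P) → Reach Δ M (λ Δ → Q → P Δ)
when (yes q) f = weaken ≤-refl (λ p _ → p) (f q)
when (no ¬q) f = done (λ q → ⊥-elim (¬q q))

∈-monotone : ∀ {C} → Monotone (C ∈_)
∈-monotone Δ⊆ = Δ⊆

-- From semantic entailment to tree-like resolution.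

_CoveredBy_ : Clause → List Var → Set
D CoveredBy vs = ∀ {l} → l ∈ D → var l ∈ vs

-- Entailment of C by `Δ` with a restricted vocabulary: after branching over vs, all literals of the
-- falsified clause are determined.
Refuted : Formula → List Var → Clause → Set
Refuted Δ vs C = ∀ α → Falsifies α C → ∃ λ D → D ∈ Δ × Falsifies α D × (∀ {l} → l ∈ D → var l ∈ vs ⊎ var l ∈ map var C)

falsifying : Clause → Assignment
falsifying C v = does (neg v ∈ᴸ? C)

falsifying-falsifies : ∀ {C} → IsClause C → Falsifies (falsifying C) C
falsifying-falsifies {C} cl {pos v} l∈ = dec-false (neg v ∈ᴸ? C) (λ n → cl (pos v , l∈ , n))
falsifying-falsifies {C} cl {neg v} l∈ = cong not (dec-true (neg v ∈ᴸ? C) l∈)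

falsified⇒⊆ : ∀ {α C D} → Falsifies α C → Falsifies α D → (∀ {l} → l ∈ D → var l ∈ map var C) → D ⊆ C
falsified⇒⊆ {α} {C} falsC falsD vars {l} l∈ with ∈-map⁻ var (vars l∈)
... | l′ , l′∈ , e with var-≡ l l′ e
... | inj₁ refl = l′∈
... | inj₂ refl = ⊥-elim (true≢false (trans (sym (trans (eval-ᶜ α l′) (cong not (falsC l′∈)))) (falsD l∈)))

-- Tree-like resolution, branching over vs. At a leaf, C contains every variable of the falsified
-- clause of Δ and is therefore a weakening of it.
tree-resolution : ∀ vs {C Δ} → IsClause C → Refuted Δ vs C → Reach Δ (3 ^ length vs) (C ∈_)
tree-resolution [] {C} cl ref with ref (falsifying C) (falsifying-falsifies cl)
... | D , D∈ , falsD , vars = one-step (inj₂ (D , D∈ ,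
  falsified⇒⊆ (falsifying-falsifies cl) falsD (λ l∈ → [ (λ ()) , id ]′ (vars l∈)) , cl))
tree-resolution (v ∷ vs) {C} {Δ} cl ref with v ∈ℕ? map var C
... | yes v∈ = weaken (m≤m+n (3 ^ length vs) _) id (tree-resolution vs cl λ α fals →
  let (D , D∈ , falsD , vars) = ref α fals in D , D∈ , falsD , λ l∈ → shift (vars l∈))
  where
  shift : ∀ {u} → u ∈ v ∷ vs ⊎ u ∈ map var C → u ∈ vs ⊎ u ∈ map var C
  shift (inj₁ (here refl)) = inj₂ v∈
  shift (inj₁ (there p))   = inj₁ p
  shift (inj₂ q)           = inj₂ q
... | no v∉ = weaken bound (proj₂ ∘ proj₂)
  (branch (pos v) refl id >>=[ ∈-monotone ] λ Δ⊆ p∈ →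
   branch (neg v) refl Δ⊆ >>=[ ∈-monotone ] λ Δ⊆′ n∈ →
   one-step (inj₁ (_ , _ , pos v , Δ⊆′ p∈ , n∈ , here refl , here refl , (λ l′ → ⊆-res l′ , res-⊆ l′) , cl)))
  where
  -- Two branches of cost T and one resolution step make 2 T + 1, at most 3 T because T is positive;
  -- hence the base 3.
  bound : 3 ^ length vs + (3 ^ length vs + 1) ≤ 3 ^ length (v ∷ vs)
  bound = +-monoʳ-≤ (3 ^ length vs) (+-monoʳ-≤ (3 ^ length vs) (≤-trans (m^n>0 3 (length vs)) (≤-reflexive (sym (+-identityʳ _)))))
  branch : ∀ l → var l ≡ v → ∀ {Δ′} → Δ ⊆ Δ′ → Reach Δ′ (3 ^ length vs) ((l ∷ C) ∈_)
  branch l var-l Δ⊆ = tree-resolution vs l∷C-clause λ α fals →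
    let (D , D∈ , falsD , vars) = ref α (fals ∘ there) in D , Δ⊆ D∈ , falsD , λ l∈ → shift (vars l∈)
    where
    v∉C : ∀ {l′} → l′ ∈ C → var l′ ≢ v
    v∉C l′∈ refl = v∉ (∈-map⁺ var l′∈)
    l∷C-clause : IsClause (l ∷ C)
    l∷C-clause (_ , here refl , here e)  = l≢lᶜ l (sym e)
    l∷C-clause (_ , here refl , there q) = v∉C q (trans (var-ᶜ l) var-l)
    l∷C-clause (l′ , there p , here e)   = v∉C p (trans (sym (var-ᶜ l′)) (trans (cong var e) var-l))
    l∷C-clause (l′ , there p , there q)  = cl (l′ , p , q)
    shift : ∀ {u} → u ∈ v ∷ vs ⊎ u ∈ map var C → u ∈ vs ⊎ u ∈ map var (l ∷ C)
    shift (inj₁ (here refl)) = inj₂ (here (sym var-l))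
    shift (inj₁ (there p))   = inj₁ p
    shift (inj₂ q)           = inj₂ (there q)
  ⊆-res : ∀ l′ → l′ ∈ C → (l′ ∈ pos v ∷ C × l′ ≢ pos v) ⊎ (l′ ∈ neg v ∷ C × l′ ≢ neg v)
  ⊆-res l′ l′∈ = inj₁ (there l′∈ , λ { refl → v∉ (∈-map⁺ var l′∈) })
  res-⊆ : ∀ l′ → (l′ ∈ pos v ∷ C × l′ ≢ pos v) ⊎ (l′ ∈ neg v ∷ C × l′ ≢ neg v) → l′ ∈ C
  res-⊆ l′ (inj₁ (here e , ≢))  = ⊥-elim (≢ e)
  res-⊆ l′ (inj₁ (there p , _)) = p
  res-⊆ l′ (inj₂ (here e , ≢))  = ⊥-elim (≢ e)
  res-⊆ l′ (inj₂ (there p , _)) = p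

-- Enumeration of the holes; circuits as extensions.

at : List (List Bool) → ℕ → List Bool
at []       _       = []
at (h ∷ hs) zero    = h
at (h ∷ hs) (suc i) = at hs i

at-∈ : ∀ hs {i} → i < length hs → at hs i ∈ hs
at-∈ (h ∷ hs) {zero}  _       = here refl
at-∈ (h ∷ hs) {suc i} (s≤s p) = there (at-∈ hs p)

∈-at : ∀ {h hs} → h ∈ hs → ∃ λ i → i < length hs × at hs i ≡ h
∈-at (here refl) = 0 , s≤s z≤n , refl
∈-at (there p)   = let (i , i< , e) = ∈-at p in suc i , s≤s i< , e

length-concatMap : ∀ {A B : Set} (f : A → List B) c → (∀ x → length (f x) ≡ c) →
                   ∀ xs → length (concatMap f xs) ≡ length xs * c
length-concatMap f c e []       = refl
length-concatMap f c e (x ∷ xs) =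
  trans (length-++ (f x)) (cong₂ _+_ (e x) (length-concatMap f c e xs))

-- Outputs increase and inputs lie below their output, so freshness of an extension variable becomes
-- a comparison of numbers. The condition `p ≢ q ᶜ` keeps the third extension clause
-- nontautological.
data Block : ℕ → ℕ → List ExtStep → Set where
  []   : ∀ {lo hi} → lo ≤ hi → Block lo hi []
  gate : ∀ {lo hi x p q es} → lo ≤ x → var p < x → var q < x → p ≢ q ᶜ →
         Block (suc x) hi es → Block lo hi ((x , p , q) ∷ es)

block-≤ : ∀ {lo lo′ hi es} → lo′ ≤ lo → Block lo hi es → Block lo′ hi es
block-≤ le ([] lo≤hi)          = [] (≤-trans le lo≤hi)
block-≤ le (gate lo≤ p q p≢ bs) = gate (≤-trans le lo≤) p q p≢ bs

block-++ : ∀ {lo mid hi es fs} → Block lo mid es → Block mid hi fs → Block lo hi (es ++ fs)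
block-++ ([] le)              fs = block-≤ le fs
block-++ (gate lo≤ p q p≢ es) fs = gate lo≤ p q p≢ (block-++ es fs)

block-concatMap : ∀ (b : ℕ → ℕ) (f : ℕ → List ExtStep) m →
  (∀ i → i < m → Block (b i) (b (suc i)) (f i)) → Block (b 0) (b m) (concatMap f (upTo m))
block-concatMap b f m = go b id m
  where
  go : ∀ (b g : ℕ → ℕ) m → (∀ i → i < m → Block (b i) (b (suc i)) (f (g i))) →
       Block (b 0) (b m) (concatMap f (applyUpTo g m))
  go b g zero    blk = [] ≤-refl
  go b g (suc m) blk = block-++ (blk 0 (s≤s z≤n)) (go (b ∘ suc) (g ∘ suc) m (λ i i<m → blk (suc i) (s≤s i<m)))

pair-isClause : ∀ {a b} → a ≢ b ᶜ → IsClause (a ∷ b ∷ [])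
pair-isClause ≢ (l , here refl , here e)                 = l≢lᶜ l (sym e)
pair-isClause ≢ (l , here refl , there (here refl))      = ≢ (sym (ᶜ-involutive l))
pair-isClause ≢ (l , there (here refl) , here e)         = ≢ (sym e)
pair-isClause ≢ (l , there (here refl) , there (here e)) = l≢lᶜ l (sym e)

triple-isClause : ∀ {a b c} → a ≢ b ᶜ → a ≢ c ᶜ → b ≢ c ᶜ → IsClause (a ∷ b ∷ c ∷ [])
triple-isClause ab ac bc (l , here p , here q)                 = pair-isClause ab (l , here p , here q)
triple-isClause ab ac bc (l , here p , there (here q))         = pair-isClause ab (l , here p , there (here q))
triple-isClause ab ac bc (l , here p , there (there (here q))) = pair-isClause ac (l , here p , there (here q))
triple-isClause ab ac bc (l , there (here p) , here q)         = pair-isClause ab (l , there (here p) , here q)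
triple-isClause ab ac bc (l , there (there (here p)) , here q) = pair-isClause ac (l , there (here p) , here q)
triple-isClause ab ac bc (l , there p , there q)               = pair-isClause bc (l , p , q)

module _ {x : Var} {p q : Lit} (p≢x : var p ≢ x) (q≢x : var q ≢ x) where
  ext₁-isClause : IsClause (neg x ∷ p ∷ [])
  ext₁-isClause = pair-isClause λ e → p≢x (trans (sym (var-ᶜ p)) (sym (cong var e)))

  ext₂-isClause : IsClause (neg x ∷ q ∷ [])
  ext₂-isClause = pair-isClause λ e → q≢x (trans (sym (var-ᶜ q)) (sym (cong var e)))

  ext₃-isClause : p ≢ q ᶜ → IsClause (pos x ∷ (p ᶜ) ∷ (q ᶜ) ∷ [])
  ext₃-isClause p≢ = triple-isClause
    (λ e → p≢x (trans (sym (cong var (ᶜ-involutive p))) (sym (cong var e))))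
    (λ e → q≢x (trans (sym (cong var (ᶜ-involutive q))) (sym (cong var e))))
    (λ e → p≢ (trans (sym (ᶜ-involutive p)) (cong _ᶜ (trans e (ᶜ-involutive q)))))

extClauses-vars : ∀ {x p q C l} → C ∈ extClauses (x , p , q) → l ∈ C →
                  var l ≡ x ⊎ var l ≡ var p ⊎ var l ≡ var q
extClauses-vars (here refl) (here refl)         = inj₁ refl
extClauses-vars (here refl) (there (here refl)) = inj₂ (inj₁ refl)
extClauses-vars (there (here refl)) (here refl)         = inj₁ refl
extClauses-vars (there (here refl)) (there (here refl)) = inj₂ (inj₂ refl)
extClauses-vars (there (there (here refl))) (here refl) = inj₁ refl
extClauses-vars {p = p} (there (there (here refl))) (there (here refl)) = inj₂ (inj₁ (var-ᶜ p))
extClauses-vars {q = q} (there (there (here refl))) (there (there (here refl))) = inj₂ (inj₂ (var-ᶜ q))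

block-extension : ∀ {Δ lo hi es} → Block lo hi es → (∀ {v} → OccursIn v Δ → v < lo) → ExtensionFor Δ es
block-extension ([] _) _ = []
block-extension {Δ} (gate {x = x} {p} {q} lo≤x p< q< p≢ blk) below =
  ext (λ occ → <⇒≱ (below occ) lo≤x) (<⇒≢ p<) (<⇒≢ q<)
    (λ { (here refl)                 → ext₁-isClause {p = p} {q} (<⇒≢ p<) (<⇒≢ q<)
       ; (there (here refl))         → ext₂-isClause {p = p} {q} (<⇒≢ p<) (<⇒≢ q<)
       ; (there (there (here refl))) → ext₃-isClause {p = p} {q} (<⇒≢ p<) (<⇒≢ q<) p≢ })
    (block-extension blk below′)
  where
  below′ : ∀ {v} → OccursIn v (Δ ++ extClauses (x , p , q)) → v < suc x
  below′ (C , C∈ , l , l∈ , refl) with ∈-++⁻ Δ C∈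
  ... | inj₁ r = ≤-trans (below (C , r , l , l∈ , refl)) (m≤n⇒m≤1+n lo≤x)
  ... | inj₂ r with extClauses-vars {x} {p} {q} r l∈
  ... | inj₁ e        = s≤s (≤-reflexive e)
  ... | inj₂ (inj₁ e) = s≤s (≤-trans (≤-reflexive e) (<⇒≤ p<))
  ... | inj₂ (inj₂ e) = s≤s (≤-trans (≤-reflexive e) (<⇒≤ q<))

search : ∀ α F → (∃ λ D → D ∈ F × Falsifies α D) ⊎ (∀ {D} → D ∈ F → ¬ Falsifies α D)
search α F with any? (falsifies? α) F
... | yes p = inj₁ (find p)
... | no ¬p = inj₂ (λ D∈ f → ¬p (lose D∈ f))

gate-value : ∀ α x p q → (∀ {D} → D ∈ extClauses (x , p , q) → ¬ Falsifies α D) → α x ≡ eval α p ∧ eval α q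
gate-value α x p q sat with α x in ex | eval α p in ep | eval α q in eq
... | true  | true  | true  = refl
... | true  | false | _     = ⊥-elim (sat (here refl) λ { (here refl) → cong not ex ; (there (here refl)) → ep })
... | true  | true  | false = ⊥-elim (sat (there (here refl)) λ { (here refl) → cong not ex ; (there (here refl)) → eq })
... | false | false | _     = refl
... | false | true  | false = refl
... | false | true  | true  = ⊥-elim (sat (there (there (here refl)))
  λ { (here refl) → ex ; (there (here refl)) → trans (eval-ᶜ α p) (cong not ep)
    ; (there (there (here refl))) → trans (eval-ᶜ α q) (cong not eq) })

-- Cook's extended resolution proof, on the binary encoding. Stage i has a function from the
-- pigeons 0, …, n ∸ i to the holes that avoids the first i holes. The next stage moves every
-- pigeon in hole i to the hole of pigeon n ∸ i, which is then dropped. The bits of stage i form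
-- level 4 i of the variables; levels 4 i + 1, …, 4 i + 3 hold the auxiliary gates.
module Cook (k : ℕ) .{{_ : NonZero k}} where
  open Pigeons k using (n; S)
  open SetBlockedClauses k using (Γ; occursIn⇒pigeonVar)

  node : ℕ → ℕ → ℕ
  node j x = j * S + x

  v : ℕ → ℕ → ℕ → Var
  v j x l = bvar k (node j x) l

  hole : ℕ → List Bool
  hole = at (bitStrings k)

  hole-length : ∀ {i} → i < n → length (hole i) ≡ k
  hole-length i<n = bitStrings-length k (at-∈ (bitStrings k) (<-≤-trans i<n (≤-reflexive (sym (length-bitStrings k)))))

  -- `v ≠lit b` excludes the value b, so its complement asserts it.
  agrees : ℕ → ℕ → ℕ → Lit
  agrees i x l = (v (i * 4) x l ≠lit nth (hole i) l) ᶜ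

  top : ℕ
  top = k ∸ 1

  top<k : top < k
  top<k = ∸-monoʳ-< (s≤s z≤n) (>-nonZero⁻¹ k)

  -- Level 1: pigeon x agrees with hole i on the bits 0, …, l.
  gate₁ : ℕ → ℕ → ℕ → ExtStep
  gate₁ i x zero    = v (1 + i * 4) x zero , agrees i x zero , agrees i x zero
  gate₁ i x (suc l) = v (1 + i * 4) x (suc l) , pos (v (1 + i * 4) x l) , agrees i x (suc l)

  -- Levels 2 to 4: the new bit is ¬ (e ∧ ¬ g) ∧ ¬ (¬ e ∧ ¬ f), that is, if e then g else f.
  gate₂ gate₃ gate₄ : ℕ → ℕ → ℕ → ExtStep
  gate₂ i x l = v (2 + i * 4) x l , pos (v (1 + i * 4) x top) , neg (v (i * 4) (n ∸ i) l)
  gate₃ i x l = v (3 + i * 4) x l , neg (v (1 + i * 4) x top) , neg (v (i * 4) x l)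
  gate₄ i x l = v (4 + i * 4) x l , neg (v (2 + i * 4) x l) , neg (v (3 + i * 4) x l)

  line : (ℕ → ℕ → ExtStep) → ℕ → List ExtStep
  line g x = concatMap (λ l → g x l ∷ []) (upTo k)

  row : (ℕ → ℕ → ExtStep) → List ExtStep
  row g = concatMap (line g) (upTo S)

  stage : ℕ → List ExtStep
  stage i = row (gate₁ i) ++ row (gate₂ i) ++ row (gate₃ i) ++ row (gate₄ i)

  circuit : List ExtStep
  circuit = concatMap stage (upTo n)

  bvar-mono : ∀ {X X′ l l′} → X < X′ → l < k → bvar k X l < bvar k X′ l′
  bvar-mono {X} {X′} {l} {l′} X<X′ l<k = <-≤-trans (bvar-< k X<X′ l<k) (m≤m+n (X′ * k) l′)

  node-mono : ∀ {j j′ x x′} → j < j′ → x < S → node j x < node j′ x′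
  node-mono {j} {j′} {x} {x′} j<j′ x<S = begin-strict
    j * S + x   <⟨ +-monoʳ-< (j * S) x<S ⟩
    j * S + S   ≡⟨ +-comm (j * S) S ⟩
    suc j * S   ≤⟨ *-monoˡ-≤ S j<j′ ⟩
    j′ * S      ≤⟨ m≤m+n (j′ * S) x′ ⟩
    j′ * S + x′ ∎
    where open ≤-Reasoning

  level-< : ∀ {j j′ x x′ l l′} → j < j′ → x < S → l < k → v j x l < v j′ x′ l′
  level-< {j} {j′} j<j′ x<S l<k = bvar-mono (node-mono {j} {j′} j<j′ x<S) l<k

  var-agrees : ∀ i x l → var (agrees i x l) ≡ v (i * 4) x l
  var-agrees i x l = trans (var-ᶜ (v (i * 4) x l ≠lit nth (hole i) l)) (var-≠lit _ (nth (hole i) l))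

  n∸i<S : ∀ i → n ∸ i < S
  n∸i<S i = s≤s (m∸n≤m n i)

  GateAt : Var → ExtStep → Set
  GateAt w (x , p , q) = x ≡ w × var p < w × var q < w × p ≢ q ᶜ

  row-block : ∀ j g → (∀ x l → x < S → l < k → GateAt (v j x l) (g x l)) → Block (v j 0 0) (v (suc j) 0 0) (row g)
  row-block j g ok = subst (λ w → Block (v j 0 0) w (row g)) (next-level j S k)
    (block-concatMap (λ x → v j x 0) _ S λ x x<S →
      subst (λ w → Block (v j x 0) w (line g x)) (next-node j S x k)
        (block-concatMap (λ l → v j x l) _ k λ l l<k → single (g x l) (ok x l x<S l<k)))
    where
    next-level : ∀ j S k → (j * S + S) * k + 0 ≡ (suc j * S + 0) * k + 0
    next-level = solve-∀
    next-node : ∀ j S x k → (j * S + x) * k + k ≡ (j * S + suc x) * k + 0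
    next-node = solve-∀
    single : ∀ {x l} e → GateAt (v j x l) e → Block (v j x l) (v j x (suc l)) (e ∷ [])
    single {x} {l} (_ , p , q) (refl , p< , q< , p≢) =
      gate ≤-refl p< q< p≢ ([] (≤-reflexive (sym (+-suc (node j x * k) l))))

  stage-block : ∀ i → Block (v (1 + i * 4) 0 0) (v (1 + suc i * 4) 0 0) (stage i)
  stage-block i =
    block-++ (row-block (1 + i * 4) (gate₁ i) ok₁) (block-++ (row-block (2 + i * 4) (gate₂ i) ok₂)
      (block-++ (row-block (3 + i * 4) (gate₃ i) ok₃) (row-block (4 + i * 4) (gate₄ i) ok₄)))
    where
    up : ∀ {j} d → j < suc d + j
    up {j} d = s≤s (m≤n+m j d)
    agrees-< : ∀ {x l l′} → x < S → l < k → var (agrees i x l) < v (1 + i * 4) x l′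
    agrees-< {x} {l} x<S l<k = subst (_< _) (sym (var-agrees i x l)) (level-< {i * 4} {1 + i * 4} (up 0) x<S l<k)
    ok₁ : ∀ x l → x < S → l < k → GateAt (v (1 + i * 4) x l) (gate₁ i x l)
    ok₁ x zero    x<S l<k = refl , agrees-< x<S l<k , agrees-< x<S l<k , l≢lᶜ (agrees i x zero)
    ok₁ x (suc l) x<S l<k = refl , +-monoʳ-< (node (1 + i * 4) x * k) (n<1+n l) , agrees-< x<S l<k ,
      λ e → <⇒≢ (level-< {i * 4} {1 + i * 4} (up 0) x<S l<k)
              (sym (trans (cong var e) (trans (var-ᶜ (agrees i x (suc l))) (var-agrees i x (suc l)))))
    ok₂ : ∀ x l → x < S → l < k → GateAt (v (2 + i * 4) x l) (gate₂ i x l)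
    ok₂ x l x<S l<k = refl , level-< {1 + i * 4} {2 + i * 4} (up 0) x<S top<k ,
      level-< {i * 4} {2 + i * 4} (up 1) (n∸i<S i) l<k ,
      λ e → <⇒≢ (level-< {i * 4} {1 + i * 4} (up 0) (n∸i<S i) l<k) (sym (cong var e))
    ok₃ : ∀ x l → x < S → l < k → GateAt (v (3 + i * 4) x l) (gate₃ i x l)
    ok₃ x l x<S l<k = refl , level-< {1 + i * 4} {3 + i * 4} (up 1) x<S top<k ,
      level-< {i * 4} {3 + i * 4} (up 2) x<S l<k , λ ()
    ok₄ : ∀ x l → x < S → l < k → GateAt (v (4 + i * 4) x l) (gate₄ i x l)
    ok₄ x l x<S l<k = refl , level-< {2 + i * 4} {4 + i * 4} (up 1) x<S l<k ,
      level-< {3 + i * 4} {4 + i * 4} (up 0) x<S l<k , λ ()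

  -- The pigeon variables of Γ fill level 0, which ends exactly where the first gates begin.
  circuit-extension : ExtensionFor Γ circuit
  circuit-extension = block-extension
    (block-concatMap (λ i → v (1 + i * 4) 0 0) stage n (λ i _ → stage-block i))
    (λ {w} occ → <-≤-trans (occursIn⇒pigeonVar occ) (≤-reflexive (first S k)))
    where
    first : ∀ S k → S * k ≡ (1 * S + 0) * k + 0
    first = solve-∀

  length-circuit : length circuit ≡ n * (4 * (S * k))
  length-circuit = trans (length-concatMap stage _ length-stage (upTo n)) (cong (_* (4 * (S * k))) (length-upTo n))
    where
    length-row : ∀ g → length (row g) ≡ S * k
    length-row g = trans (length-concatMap (line g) k length-line (upTo S)) (cong (_* k) (length-upTo S))
      where
      length-line : ∀ x → length (line g x) ≡ k
      length-line x = trans (length-concatMap (λ l → g x l ∷ []) 1 (λ _ → refl) (upTo k))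
                            (trans (*-identityʳ _) (length-upTo k))
    length-++≡ : ∀ {A : Set} (xs ys : List A) {a b} → length xs ≡ a → length ys ≡ b → length (xs ++ ys) ≡ a + b
    length-++≡ xs ys refl refl = length-++ xs
    length-stage : ∀ i → length (stage i) ≡ 4 * (S * k)
    length-stage i =
      length-++≡ (row (gate₁ i)) _ (length-row _) (length-++≡ (row (gate₂ i)) _ (length-row _)
        (length-++≡ (row (gate₃ i)) _ (length-row _) (trans (length-row _) (sym (+-identityʳ (S * k))))))

  ∈-row : ∀ g {x l} → x < S → l < k → g x l ∈ row g
  ∈-row g x<S l<k = ∈-concatMap⁺ _ (lose (∈-upTo⁺ x<S) (∈-concatMap⁺ _ (lose (∈-upTo⁺ l<k) (here refl))))

  stage⊆ : ∀ {i} → i < n → stage i ⊆ circuit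
  stage⊆ i<n e∈ = ∈-concatMap⁺ stage (lose (∈-upTo⁺ i<n) e∈)

  bitGates : ℕ → ℕ → ℕ → List ExtStep
  bitGates i x l = gate₁ i x l ∷ gate₂ i x l ∷ gate₃ i x l ∷ gate₄ i x l ∷ []

  moveGates : ℕ → ℕ → List ExtStep
  moveGates i x = concatMap (bitGates i x) (upTo k)

  moveGates⊆ : ∀ {i x} → i < n → x < S → moveGates i x ⊆ circuit
  moveGates⊆ {i} {x} i<n x<S e∈ with find (∈-concatMap⁻ _ {xs = upTo k} e∈)
  ... | l , l∈ , here refl = stage⊆ i<n (∈-++⁺ˡ (∈-row (gate₁ i) x<S (∈-upTo⁻ l∈)))
  ... | l , l∈ , there (here refl) =
    stage⊆ i<n (∈-++⁺ʳ (row (gate₁ i)) (∈-++⁺ˡ (∈-row (gate₂ i) x<S (∈-upTo⁻ l∈))))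
  ... | l , l∈ , there (there (here refl)) =
    stage⊆ i<n (∈-++⁺ʳ (row (gate₁ i)) (∈-++⁺ʳ (row (gate₂ i)) (∈-++⁺ˡ (∈-row (gate₃ i) x<S (∈-upTo⁻ l∈)))))
  ... | l , l∈ , there (there (there (here refl))) =
    stage⊆ i<n (∈-++⁺ʳ (row (gate₁ i)) (∈-++⁺ʳ (row (gate₂ i)) (∈-++⁺ʳ (row (gate₃ i)) (∈-row (gate₄ i) x<S (∈-upTo⁻ l∈)))))

  extFormula⁺ : ∀ {es fs} → es ⊆ fs → extFormula es ⊆ extFormula fs
  extFormula⁺ {es} {fs} es⊆ C∈ = let (e , e∈ , C∈e) = find (∈-concatMap⁻ extClauses {xs = es} C∈) in
    ∈-concatMap⁺ extClauses (lose (es⊆ e∈) C∈e)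

  module Semantics (α : Assignment) {i x : ℕ} (i<n : i < n)
                   (sat : ∀ {D} → D ∈ extFormula (moveGates i x) → ¬ Falsifies α D) where
    value : ∀ {l X p q} → l < k → (X , p , q) ∈ bitGates i x l → α X ≡ eval α p ∧ eval α q
    value {l} {X} {p} {q} l<k e∈ = gate-value α X p q λ D∈ →
      sat (∈-concatMap⁺ extClauses (lose (∈-concatMap⁺ (bitGates i x) (lose (∈-upTo⁺ l<k) e∈)) D∈))

    Agrees : ℕ → Set
    Agrees l = α (v (i * 4) x l) ≡ nth (hole i) l

    agrees⇒true : ∀ l → Agrees l → eval α (agrees i x l) ≡ true
    agrees⇒true l e = trans (eval-ᶜ α (v (i * 4) x l ≠lit nth (hole i) l))
      (cong not (subst (λ b → eval α (v (i * 4) x l ≠lit b) ≡ false) e (eval-≠lit-≡ α (v (i * 4) x l))))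

    true⇒agrees : ∀ l → eval α (agrees i x l) ≡ true → Agrees l
    true⇒agrees l e = eval-≠lit α (v (i * 4) x l) (nth (hole i) l)
      (trans (sym (Bool.not-involutive _)) (trans (cong not (sym (eval-ᶜ α (v (i * 4) x l ≠lit nth (hole i) l)))) (cong not e)))

    prefix⇒true : ∀ l → l < k → (∀ {l′} → l′ ≤ l → Agrees l′) → α (v (1 + i * 4) x l) ≡ true
    prefix⇒true zero    l<k ag = trans (value l<k (here refl)) (cong₂ _∧_ (agrees⇒true zero (ag ≤-refl)) (agrees⇒true zero (ag ≤-refl)))
    prefix⇒true (suc l) l<k ag = trans (value l<k (here refl))
      (cong₂ _∧_ (prefix⇒true l (<-trans (n<1+n l) l<k) (ag ∘ m≤n⇒m≤1+n)) (agrees⇒true (suc l) (ag ≤-refl)))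

    ∧-true : ∀ {a b} → a ∧ b ≡ true → a ≡ true × b ≡ true
    ∧-true {true} e = refl , e

    true⇒prefix : ∀ l → l < k → α (v (1 + i * 4) x l) ≡ true → ∀ {l′} → l′ ≤ l → Agrees l′
    true⇒prefix zero    l<k e z≤n = true⇒agrees zero (proj₁ (∧-true (trans (sym (value l<k (here refl))) e)))
    true⇒prefix (suc l) l<k e {l′} l′≤ with ∧-true (trans (sym (value l<k (here refl))) e) | m≤n⇒m<n∨m≡n l′≤
    ... | e₁ , e₂ | inj₁ l′<  = true⇒prefix l (<-trans (n<1+n l) l<k) e₁ (s≤s⁻¹ l′<)
    ... | e₁ , e₂ | inj₂ refl = true⇒agrees (suc l) e₂

    taken : Bool
    taken = α (v (1 + i * 4) x top)

    new-bit : ∀ {l} → l < k → α (v (4 + i * 4) x l) ≡ (if taken then α (v (i * 4) (n ∸ i) l) else α (v (i * 4) x l))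
    new-bit {l} l<k = begin
      α (v (4 + i * 4) x l)
        ≡⟨ value l<k (there (there (there (here refl)))) ⟩
      not (α (v (2 + i * 4) x l)) ∧ not (α (v (3 + i * 4) x l))
        ≡⟨ cong₂ (λ a b → not a ∧ not b) (value l<k (there (here refl))) (value l<k (there (there (here refl)))) ⟩
      not (taken ∧ not (α (v (i * 4) (n ∸ i) l))) ∧ not (not taken ∧ not (α (v (i * 4) x l)))
        ≡⟨ mux taken _ _ ⟩
      (if taken then α (v (i * 4) (n ∸ i) l) else α (v (i * 4) x l)) ∎
      where
      open ≡-Reasoning
      mux : ∀ e g f → not (e ∧ not g) ∧ not (not e ∧ not f) ≡ (if e then g else f)
      mux true  true  _     = refl
      mux true  false _     = refl
      mux false _     true  = refl
      mux false _     false = refl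

    nth-val-node : ∀ j x {l} → l < k → nth (val k α (node j x)) l ≡ α (v j x l)
    nth-val-node j x = nth-val k α (node j x)

    -- The dichotomy that sums up the gates of one pigeon for the derivations: agreement with hole i
    -- on the bits up to `top` is equality with hole i.
    moved : (val k α (node (4 + i * 4) x) ≡ val k α (node (i * 4) (n ∸ i)) × val k α (node (i * 4) x) ≡ hole i) ⊎
            (val k α (node (4 + i * 4) x) ≡ val k α (node (i * 4) x) × val k α (node (i * 4) x) ≢ hole i)
    moved = choose taken refl
      where
      new-bit′ : ∀ b → taken ≡ b → ∀ {l} → l < k →
                 α (v (4 + i * 4) x l) ≡ (if b then α (v (i * 4) (n ∸ i) l) else α (v (i * 4) x l))
      new-bit′ b refl = new-bit
      same : ∀ u → (∀ {l} → l < k → α (v (4 + i * 4) x l) ≡ α (v (i * 4) u l)) →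
             val k α (node (4 + i * 4) x) ≡ val k α (node (i * 4) u)
      same u eq = map-upTo-nth _ k _ (length-val k α (node (i * 4) u))
                    (λ l<k → trans (eq l<k) (sym (nth-val-node (i * 4) u l<k)))
      choose : ∀ b → taken ≡ b →
        (val k α (node (4 + i * 4) x) ≡ val k α (node (i * 4) (n ∸ i)) × val k α (node (i * 4) x) ≡ hole i) ⊎
        (val k α (node (4 + i * 4) x) ≡ val k α (node (i * 4) x) × val k α (node (i * 4) x) ≢ hole i)
      choose true  e = inj₁ (same (n ∸ i) (new-bit′ true e) ,
        map-upTo-nth _ k (hole i) (hole-length i<n) (λ l<k → true⇒prefix top top<k e (∸-monoˡ-≤ 1 l<k)))
      choose false e = inj₂ (same x (new-bit′ false e) , λ h → true≢false (trans (sym (prefix⇒true top top<k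
        (λ {l} l≤ → trans (sym (nth-val-node (i * 4) x (≤-<-trans l≤ top<k))) (cong (λ h → nth h l) h)))) e))

-- Resolution derivations from stage to stage.

module CookProof (k : ℕ) .{{_ : NonZero k}} where
  open Pigeons k using (n; S)
  open SetBlockedClauses k using (Γ)
  open Cook k

  bits : ℕ → List Var
  bits X = map (bvar k X) (upTo k)

  collision : ℕ → ℕ → List Bool → Clause
  collision X Y h = holeLits k X h ++ holeLits k Y h

  -- The side conditions form one premise placed among the bounds, because nested uses of `for` and
  -- `when` produce exactly this shape.
  Distinct : ℕ → Formula → Set
  Distinct i Δ = ∀ x → x < S → ∀ y → y < S → x ≤ n ∸ i × y ≤ n ∸ i × x ≢ y → ∀ j → j < n →
                 collision (node (i * 4) x) (node (i * 4) y) (hole j) ∈ Δ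

  Avoids : ℕ → Formula → Set
  Avoids i Δ = ∀ x → x < S → ∀ j → j < n → x ≤ n ∸ i × j < i → holeLits k (node (i * 4) x) (hole j) ∈ Δ

  distinct-monotone : ∀ i → Monotone (Distinct i)
  distinct-monotone i Δ⊆ d x x< y y< c j j< = Δ⊆ (d x x< y y< c j j<)

  avoids-monotone : ∀ i → Monotone (Avoids i)
  avoids-monotone i Δ⊆ a x x< j j< c = Δ⊆ (a x x< j j< c)

  const-val : ∀ h X → length h ≡ k → val k (λ v → nth h (v % k)) X ≡ h
  const-val h X len = map-upTo-nth _ k h len (λ l<k → cong (nth h) (bvar-% k X l<k))

  falsifies-collision : ∀ α X Y {h} → val k α X ≡ h → val k α Y ≡ h → Falsifies α (collision X Y h)
  falsifies-collision α X Y {h} eX eY l∈ with ∈-++⁻ (holeLits k X h) l∈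
  ... | inj₁ p = falsifies-holeLits k X α eX p
  ... | inj₂ p = falsifies-holeLits k Y α eY p

  collision-isClause : ∀ X Y h → length h ≡ k → IsClause (collision X Y h)
  collision-isClause X Y h len = falsifiable⇒clause {λ v → nth h (v % k)}
    (falsifies-collision _ X Y (const-val h X len) (const-val h Y len))

  holeLits-isClause : ∀ X h → length h ≡ k → IsClause (holeLits k X h)
  holeLits-isClause X h len = falsifiable⇒clause {λ v → nth h (v % k)} (falsifies-holeLits k X _ (const-val h X len))

  holeLits-covered : ∀ X Xs {h} → X ∈ Xs → holeLits k X h CoveredBy concatMap bits Xs
  holeLits-covered X Xs X∈ l∈ with holeLits-vars k X l∈
  ... | l , l<k , e = subst (_∈ _) (sym e) (∈-concatMap⁺ bits (lose X∈ (∈-map⁺ (bvar k X) (∈-upTo⁺ l<k))))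

  collision-covered : ∀ X Y Xs {h} → X ∈ Xs → Y ∈ Xs → collision X Y h CoveredBy concatMap bits Xs
  collision-covered X Y Xs {h} X∈ Y∈ l∈ with ∈-++⁻ (holeLits k X h) l∈
  ... | inj₁ p = holeLits-covered X Xs X∈ p
  ... | inj₂ p = holeLits-covered Y Xs Y∈ p

  module Stage {i : ℕ} (i<n : i < n) {Δ : Formula} (circuit⊆ : extFormula circuit ⊆ Δ)
               (distinct : Distinct i Δ) (avoids : Avoids i Δ) where
    t : ℕ
    t = n ∸ i

    t≡ : t ≡ suc (n ∸ suc i)
    t≡ = +-∸-assoc 1 i<n

    below : ∀ {x} → x ≤ n ∸ suc i → x < t
    below {x} x≤ = subst (x <_) (sym t≡) (s≤s x≤)

    -- The clauses of the next stage are derived by case analysis on the variables of at most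
    -- three pigeons on five levels.
    module Local {x y : ℕ} (x<S : x < S) (y<S : y < S) where
      level : ℕ → List ℕ
      level j = node (j + i * 4) x ∷ node (j + i * 4) y ∷ node (j + i * 4) t ∷ []

      nodes : List ℕ
      nodes = concatMap level (upTo 5)

      scope : List Var
      scope = concatMap bits nodes

      length-scope : length scope ≡ 15 * k
      length-scope = length-concatMap bits k (λ X → trans (length-map _ (upTo k)) (length-upTo k)) nodes

      data Near : ℕ → Set where
        is-x : Near x
        is-y : Near y
        is-t : Near t

      ∈-nodes : ∀ {u} j → j < 5 → Near u → node (j + i * 4) u ∈ nodes
      ∈-nodes j j<5 near = ∈-concatMap⁺ level (lose (∈-upTo⁺ j<5) (pick near))
        where
        pick : ∀ {u} → Near u → node (j + i * 4) u ∈ level j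
        pick is-x = here refl
        pick is-y = there (here refl)
        pick is-t = there (there (here refl))

      ∈-scope : ∀ {u l} j → j < 5 → Near u → l < k → v (j + i * 4) u l ∈ scope
      ∈-scope j j<5 near l<k = ∈-concatMap⁺ bits (lose (∈-nodes j j<5 near) (∈-map⁺ _ (∈-upTo⁺ l<k)))

      0<5 : 0 < 5
      0<5 = s≤s z≤n
      1<5 : 1 < 5
      1<5 = s≤s (s≤s z≤n)
      2<5 : 2 < 5
      2<5 = s≤s (s≤s (s≤s z≤n))
      3<5 : 3 < 5
      3<5 = s≤s (s≤s (s≤s (s≤s z≤n)))
      4<5 : 4 < 5
      4<5 = s≤s (s≤s (s≤s (s≤s (s≤s z≤n))))

      gates-covered : ∀ {u D} → Near u → D ∈ extFormula (moveGates i u) → D CoveredBy scope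
      gates-covered {u} {D} near D∈ {lit} lit∈ with find (∈-concatMap⁻ extClauses {xs = moveGates i u} D∈)
      ... | (X , p , q) , e∈ , D∈e with find (∈-concatMap⁻ (bitGates i u) {xs = upTo k} e∈)
      ... | l , l∈ , e∈l = covered (∈-upTo⁻ l∈) e∈l
        where
        assemble : X ∈ scope → var p ∈ scope → var q ∈ scope → var lit ∈ scope
        assemble X∈ p∈ q∈ with extClauses-vars {X} {p} {q} D∈e lit∈
        ... | inj₁ e        = subst (_∈ scope) (sym e) X∈
        ... | inj₂ (inj₁ e) = subst (_∈ scope) (sym e) p∈
        ... | inj₂ (inj₂ e) = subst (_∈ scope) (sym e) q∈
        agrees∈ : ∀ l → l < k → var (agrees i u l) ∈ scope
        agrees∈ l l<k = subst (_∈ scope) (sym (var-agrees i u l)) (∈-scope 0 0<5 near l<k)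
        covered : ∀ {l} → l < k → (X , p , q) ∈ bitGates i u l → var lit ∈ scope
        covered {zero} l<k (here refl) =
          assemble (∈-scope 1 1<5 near l<k) (agrees∈ 0 l<k) (agrees∈ 0 l<k)
        covered {suc l} l<k (here refl) =
          assemble (∈-scope 1 1<5 near l<k) (∈-scope 1 1<5 near (<-trans (n<1+n l) l<k)) (agrees∈ (suc l) l<k)
        covered l<k (there (here refl)) =
          assemble (∈-scope 2 2<5 near l<k) (∈-scope 1 1<5 near top<k) (∈-scope 0 0<5 is-t l<k)
        covered l<k (there (there (here refl))) =
          assemble (∈-scope 3 3<5 near l<k) (∈-scope 1 1<5 near top<k) (∈-scope 0 0<5 near l<k)
        covered l<k (there (there (there (here refl)))) =
          assemble (∈-scope 4 4<5 near l<k) (∈-scope 2 2<5 near l<k) (∈-scope 3 3<5 near l<k)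

      Witness : Assignment → Set
      Witness α = ∃ λ D → D ∈ Δ × Falsifies α D × D CoveredBy scope

      -- A gate clause violated by `α` is itself the witness, so the caller may assume that the
      -- gates of x and y compute correctly.
      derive : ∀ {C} → IsClause C →
        (∀ α → Falsifies α C →
           (∀ {D} → D ∈ extFormula (moveGates i x) → ¬ Falsifies α D) →
           (∀ {D} → D ∈ extFormula (moveGates i y) → ¬ Falsifies α D) → Witness α) →
        ∀ {Δ′} → Δ ⊆ Δ′ → Reach Δ′ (3 ^ (15 * k)) (C ∈_)
      derive {C} cl wit {Δ′} Δ⊆ = subst (λ s → Reach Δ′ (3 ^ s) (C ∈_)) length-scope
        (tree-resolution scope cl λ α fals → let (D , D∈ , falsD , cov) = witness α fals in
          D , Δ⊆ D∈ , falsD , inj₁ ∘ cov)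
        where
        witness : ∀ α → Falsifies α C → Witness α
        witness α fals with search α (extFormula (moveGates i x)) | search α (extFormula (moveGates i y))
        ... | inj₁ (D , D∈ , f) | _ =
          D , circuit⊆ (extFormula⁺ (moveGates⊆ i<n x<S) D∈) , (λ {l} → f {l}) , gates-covered is-x D∈
        ... | inj₂ _ | inj₁ (D , D∈ , f) =
          D , circuit⊆ (extFormula⁺ (moveGates⊆ i<n y<S) D∈) , (λ {l} → f {l}) , gates-covered is-y D∈
        ... | inj₂ satx | inj₂ saty = wit α fals satx saty

      collide : ∀ {α u w h} → Near u → Near w → u < S → w < S → u ≤ t → w ≤ t → u ≢ w →
                (∃ λ j → j < n × hole j ≡ h) →
                val k α (node (i * 4) u) ≡ h → val k α (node (i * 4) w) ≡ h → Witness α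
      collide {α} {u} {w} nu nw u<S w<S u≤t w≤t u≢w (j , j<n , refl) eu ew =
        _ , distinct u u<S w w<S (u≤t , w≤t , u≢w) j j<n , falsifies-collision α (node (i * 4) u) (node (i * 4) w) eu ew ,
        collision-covered (node (i * 4) u) (node (i * 4) w) nodes (∈-nodes 0 0<5 nu) (∈-nodes 0 0<5 nw)

      hit : ∀ {α u j} → Near u → u < S → u ≤ t → j < n → j < i → val k α (node (i * 4) u) ≡ hole j → Witness α
      hit {α} {u} nu u<S u≤t j<n j<i e =
        _ , avoids u u<S _ j<n (u≤t , j<i) , falsifies-holeLits k (node (i * 4) u) α e , holeLits-covered (node (i * 4) u) nodes (∈-nodes 0 0<5 nu)

    t<S : t < S
    t<S = n∸i<S i

    -- If both pigeons moved, both were in hole i. If one moved, it took the hole of t, so t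
    -- collided with the other. If none moved, the collision is old. Both x and y are below t, hence
    -- differ from it.
    next-distinct : ∀ {x y j} → x < S → y < S → x ≤ n ∸ suc i → y ≤ n ∸ suc i → x ≢ y → j < n →
      ∀ {Δ′} → Δ ⊆ Δ′ → Reach Δ′ (3 ^ (15 * k)) (collision (node (suc i * 4) x) (node (suc i * 4) y) (hole j) ∈_)
    next-distinct {x} {y} {j} x<S y<S x≤ y≤ x≢y j<n = derive {collision (node (suc i * 4) x) (node (suc i * 4) y) (hole j)}
      (collision-isClause (node (suc i * 4) x) (node (suc i * 4) y) (hole j) (hole-length j<n)) wit
      where
      open Local x<S y<S
      x<t = below x≤
      y<t = below y≤
      wit : ∀ α → Falsifies α (collision (node (suc i * 4) x) (node (suc i * 4) y) (hole j)) →
           (∀ {D} → D ∈ extFormula (moveGates i x) → ¬ Falsifies α D) →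
           (∀ {D} → D ∈ extFormula (moveGates i y) → ¬ Falsifies α D) → Witness α
      wit α fals satx saty = cases (Semantics.moved α {i} {x} i<n satx) (Semantics.moved α {i} {y} i<n saty)
        where
        ex : val k α (node (suc i * 4) x) ≡ hole j
        ex = holeLits-falsified k (node (suc i * 4) x) α (hole-length j<n) (fals ∘ ∈-++⁺ˡ)
        ey : val k α (node (suc i * 4) y) ≡ hole j
        ey = holeLits-falsified k (node (suc i * 4) y) α (hole-length j<n) (fals ∘ ∈-++⁺ʳ (holeLits k (node (suc i * 4) x) (hole j)))
        Moved : ℕ → Set
        Moved x = (val k α (node (4 + i * 4) x) ≡ val k α (node (i * 4) t) × val k α (node (i * 4) x) ≡ hole i) ⊎
                  (val k α (node (4 + i * 4) x) ≡ val k α (node (i * 4) x) × val k α (node (i * 4) x) ≢ hole i)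
        cases : Moved x → Moved y → Witness α
        cases (inj₁ (_ , hx)) (inj₁ (_ , hy)) =
          collide is-x is-y x<S y<S (<⇒≤ x<t) (<⇒≤ y<t) x≢y (i , i<n , refl) hx hy
        cases (inj₁ (ht , _)) (inj₂ (hy , _)) =
          collide is-t is-y t<S y<S ≤-refl (<⇒≤ y<t) (≢-sym (<⇒≢ y<t)) (j , j<n , refl) (trans (sym ht) ex) (trans (sym hy) ey)
        cases (inj₂ (hx , _)) (inj₁ (ht , _)) =
          collide is-x is-t x<S t<S (<⇒≤ x<t) ≤-refl (<⇒≢ x<t) (j , j<n , refl) (trans (sym hx) ex) (trans (sym ht) ey)
        cases (inj₂ (hx , _)) (inj₂ (hy , _)) =
          collide is-x is-y x<S y<S (<⇒≤ x<t) (<⇒≤ y<t) x≢y (j , j<n , refl) (trans (sym hx) ex) (trans (sym hy) ey)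

    -- A hole j < i is excluded by the old avoidance for x or t. For j = i, a pigeon that moved
    -- shared hole i with t, and one that stayed was not in hole i.
    next-avoids : ∀ {x j} → x < S → x ≤ n ∸ suc i → j < n → j < suc i →
      ∀ {Δ′} → Δ ⊆ Δ′ → Reach Δ′ (3 ^ (15 * k)) (holeLits k (node (suc i * 4) x) (hole j) ∈_)
    next-avoids {x} {j} x<S x≤ j<n j≤i = derive {holeLits k (node (suc i * 4) x) (hole j)}
      (holeLits-isClause (node (suc i * 4) x) (hole j) (hole-length j<n)) wit
      where
      open Local x<S x<S
      x<t = below x≤
      wit : ∀ α → Falsifies α (holeLits k (node (suc i * 4) x) (hole j)) →
           (∀ {D} → D ∈ extFormula (moveGates i x) → ¬ Falsifies α D) →
           (∀ {D} → D ∈ extFormula (moveGates i x) → ¬ Falsifies α D) → Witness α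
      wit α fals sat _ with holeLits-falsified k (node (suc i * 4) x) α (hole-length j<n) fals
                          | Semantics.moved α {i} {x} i<n sat | m≤n⇒m<n∨m≡n (s≤s⁻¹ j≤i)
      ... | e | inj₁ (ht , _)  | inj₁ j<i  = hit is-t t<S ≤-refl j<n j<i (trans (sym ht) e)
      ... | e | inj₁ (ht , hx) | inj₂ refl =
        collide is-x is-t x<S t<S (<⇒≤ x<t) ≤-refl (<⇒≢ x<t) (i , i<n , refl) hx (trans (sym ht) e)
      ... | e | inj₂ (hx , _)  | inj₁ j<i  = hit is-x x<S (<⇒≤ x<t) j<n j<i (trans (sym hx) e)
      ... | e | inj₂ (hx , ≢)  | inj₂ refl = ⊥-elim (≢ (trans (sym hx) e))

  M stage-cost : ℕ
  M = 3 ^ (15 * k)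
  stage-cost = S * (S * (n * M)) + S * (n * M)

  stage-step : ∀ {i Δ} → i < n → extFormula circuit ⊆ Δ → Distinct i Δ → Avoids i Δ →
               Reach Δ stage-cost (λ Δ → Distinct (suc i) Δ × Avoids (suc i) Δ)
  stage-step {i} {Δ} i<n circuit⊆ distinct avoids =
    all-distinct >>=[ distinct-monotone (suc i) ] λ Δ⊆ _ → all-avoid Δ⊆
    where
    open Stage i<n circuit⊆ distinct avoids
    all-distinct : Reach Δ (S * (S * (n * M))) (Distinct (suc i))
    all-distinct = for (λ x Δ⊆ p y y< c j j< → Δ⊆ (p y y< c j j<)) S λ x x<S Δ⊆₁ →
      for (λ y Δ⊆ p c j j< → Δ⊆ (p c j j<)) S λ y y<S Δ⊆₂ →
      when ((x ≤? n ∸ suc i) ×-dec (y ≤? n ∸ suc i) ×-dec ¬? (x ≟ y)) λ (x≤ , y≤ , x≢y) →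
      for (λ j Δ⊆ → Δ⊆) n λ j j<n Δ⊆₃ →
      next-distinct x<S y<S x≤ y≤ x≢y j<n (Δ⊆₃ ∘ Δ⊆₂ ∘ Δ⊆₁)
    all-avoid : ∀ {Δ′} → Δ ⊆ Δ′ → Reach Δ′ (S * (n * M)) (Avoids (suc i))
    all-avoid Δ⊆₀ = for (λ x Δ⊆ p j j< c → Δ⊆ (p j j< c)) S λ x x<S Δ⊆₁ →
      for (λ j Δ⊆ p c → Δ⊆ (p c)) n λ j j<n Δ⊆₂ →
      when ((x ≤? n ∸ suc i) ×-dec (j <? suc i)) λ (x≤ , j≤i) →
      next-avoids x<S x≤ j<n j≤i (Δ⊆₂ ∘ Δ⊆₁ ∘ Δ⊆₀)

  stages : ∀ i → i ≤ n → ∀ {Δ} → Γ ⊆ Δ → extFormula circuit ⊆ Δ →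
           Reach Δ (i * stage-cost) (λ Δ → Distinct i Δ × Avoids i Δ)
  stages zero _ Γ⊆ _ = done
    ((λ x x< y y< (_ , _ , x≢y) j j< → Γ⊆ (∈-BPHP k x< y< x≢y (hole-length j<))) , λ { _ _ _ _ (_ , ()) })
  stages (suc i) i<n Γ⊆ circuit⊆ = weaken (≤-reflexive (+-comm (i * stage-cost) stage-cost)) proj₂
    (stages i (<⇒≤ i<n) Γ⊆ circuit⊆
      >>=[ (λ Δ⊆ (d , a) → distinct-monotone i Δ⊆ d , avoids-monotone i Δ⊆ a) ]
      λ Δ⊆ (d , a) → stage-step i<n (Δ⊆ ∘ circuit⊆) d a)

  -- After n stages pigeon 0 avoids every hole, which branching over its k bits refutes.
  final : ∀ {Δ} → Avoids n Δ → Reach Δ (3 ^ k) ([] ∈_)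
  final {Δ} avoids = subst (λ s → Reach Δ (3 ^ s) ([] ∈_)) (trans (length-map _ (upTo k)) (length-upTo k))
    (tree-resolution (bits X) (λ { (_ , () , _) }) witness)
    where
    X : ℕ
    X = node (n * 4) 0
    witness : Refuted Δ (bits X) []
    witness α _ with ∈-at (∈-bitStrings k (length-val k α X))
    ... | j , j< , e = _ , avoids 0 (s≤s z≤n) j j<n (z≤n , j<n) , falsifies-holeLits k X α (sym e) ,
      λ l∈ → let (l , l<k , e′) = holeLits-vars k X l∈ in
        inj₁ (subst (_∈ bits X) (sym e′) (∈-map⁺ (bvar k X) (∈-upTo⁺ l<k)))
      where
      j<n : j < n
      j<n = <-≤-trans j< (≤-reflexive (length-bitStrings k))

  resolution-cost : ℕ
  resolution-cost = n * stage-cost + 3 ^ k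

  refutation : Reach (Γ ++ extFormula circuit) resolution-cost ([] ∈_)
  refutation = weaken ≤-refl proj₂
    (stages n ≤-refl ∈-++⁺ˡ (∈-++⁺ʳ Γ)
      >>=[ (λ Δ⊆ (d , a) → distinct-monotone n Δ⊆ d , avoids-monotone n Δ⊆ a) ] λ _ (_ , a) → final a)

  er-proof : ∃ λ s → ERProofOfSize Γ circuit s × s ≤ 3 * length circuit + (resolution-cost + 1)
  er-proof = from refutation
    where
    from : Reach (Γ ++ extFormula circuit) resolution-cost ([] ∈_) →
           ∃ λ s → ERProofOfSize Γ circuit s × s ≤ 3 * length circuit + (resolution-cost + 1)
    from (reach {Δ′} {steps} _ []∈ steps≤ continue) =
      3 * length circuit + (steps + 1) ,
      (circuit-extension , steps + 1 , (Δ′ , continue start , [] , []∈ , id , id) , refl) ,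
      +-monoʳ-≤ (3 * length circuit) (+-monoˡ-≤ 1 steps≤)

  -- Polynomial size of the ER proof.

  2≤n : 2 ≤ n
  2≤n = ^-monoʳ-≤ 2 (>-nonZero⁻¹ k)

  private instance
    n≢0 : NonZero n
    n≢0 = m^n≢0 2 k

  _*ᵖ_ : ∀ {x y a b} → x ≤ n ^ a → y ≤ n ^ b → x * y ≤ n ^ (a + b)
  _*ᵖ_ {a = a} {b} x≤ y≤ = ≤-trans (*-mono-≤ x≤ y≤) (≤-reflexive (sym (^-distribˡ-+-* n a b)))

  -- All bounds are kept as powers of n; a sum costs one more factor n because 2 ≤ n.
  _+ᵖ_ : ∀ {x y a} → x ≤ n ^ a → y ≤ n ^ a → x + y ≤ n ^ suc a
  _+ᵖ_ {a = a} x≤ y≤ = ≤-trans (+-mono-≤ x≤ y≤)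
    (≤-trans (≤-reflexive (cong (n ^ a +_) (sym (+-identityʳ (n ^ a))))) (*-monoˡ-≤ (n ^ a) 2≤n))

  raise : ∀ {x} a b → a ≤ b → x ≤ n ^ a → x ≤ n ^ b
  raise a b a≤b x≤ = ≤-trans x≤ (^-monoʳ-≤ n a≤b)

  n≤ᵖ : n ≤ n ^ 1
  n≤ᵖ = ≤-reflexive (sym (^-identityʳ n))

  S≤ᵖ : S ≤ n ^ 2
  S≤ᵖ = _+ᵖ_ {1} {n} {1} (m^n>0 n 1) n≤ᵖ

  k≤ᵖ : k ≤ n ^ 1
  k≤ᵖ = ≤-trans (<⇒≤ (m<2^m k)) n≤ᵖ
    where
    m<2^m : ∀ m → m < 2 ^ m
    m<2^m zero    = s≤s z≤n
    m<2^m (suc m) = <-≤-trans (+-monoˡ-≤ (suc m) (m^n>0 2 m)) (+-monoʳ-≤ (2 ^ m) (≤-trans (m<2^m m) (m≤m+n (2 ^ m) 0)))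

  -- As n = 2^k, a bound exponential in k is polynomial in n; estimating 3 by 2^2 doubles the
  -- exponent.
  3^≤ᵖ : ∀ a → 3 ^ (a * k) ≤ n ^ (a * 2)
  3^≤ᵖ a = begin
    3 ^ (a * k)        ≤⟨ ^-monoˡ-≤ (a * k) (n≤1+n 3) ⟩
    (2 ^ 2) ^ (a * k)  ≡⟨ ^-*-assoc 2 2 (a * k) ⟩
    2 ^ (2 * (a * k))  ≡⟨ cong (2 ^_) (rearrange a k) ⟩
    2 ^ (k * (a * 2))  ≡⟨ ^-*-assoc 2 k (a * 2) ⟨
    n ^ (a * 2)        ∎
    where
    open ≤-Reasoning
    rearrange : ∀ a k → 2 * (a * k) ≡ k * (a * 2)
    rearrange = solve-∀

  stage-cost≤ : stage-cost ≤ n ^ 36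
  stage-cost≤ = _+ᵖ_ {S * (S * (n * M))} {S * (n * M)} {35}
    (_*ᵖ_ {S} {S * (n * M)} {2} {33} S≤ᵖ (_*ᵖ_ {S} {n * M} {2} {31} S≤ᵖ nM≤))
    (raise 33 35 (m≤n+m 33 2) (_*ᵖ_ {S} {n * M} {2} {31} S≤ᵖ nM≤))
    where
    nM≤ : n * M ≤ n ^ 31
    nM≤ = _*ᵖ_ {n} {M} {1} {30} n≤ᵖ (3^≤ᵖ 15)

  -- A stage fits into n^36, the n stages into n^37, and each of the three further summands raises
  -- the exponent by one.
  er-size : 3 * length circuit + (resolution-cost + 1) ≤ n ^ 40
  er-size = _+ᵖ_ {3 * length circuit} {resolution-cost + 1} {39} circuit≤
    (_+ᵖ_ {resolution-cost} {1} {38}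
      (_+ᵖ_ {n * stage-cost} {3 ^ k} {37} (_*ᵖ_ {n} {stage-cost} {1} {36} n≤ᵖ stage-cost≤) 3^k≤)
      (m^n>0 n 38))
    where
    3^k≤ : 3 ^ k ≤ n ^ 37
    3^k≤ = raise 2 37 (m≤m+n 2 35) (subst (λ e → 3 ^ e ≤ n ^ 2) (*-identityˡ k) (3^≤ᵖ 1))
    4≤ : 4 ≤ n ^ 2
    4≤ = ^-monoˡ-≤ 2 2≤n
    circuit≤ : 3 * length circuit ≤ n ^ 39
    circuit≤ = raise 8 39 (m≤m+n 8 31) (_*ᵖ_ {3} {length circuit} {2} {6} (≤-trans (n≤1+n 3) 4≤)
      (subst (_≤ n ^ 6) (sym length-circuit)
        (_*ᵖ_ {n} {4 * (S * k)} {1} {5} n≤ᵖ (_*ᵖ_ {4} {S * k} {2} {3} 4≤ (_*ᵖ_ {S} {k} {2} {1} S≤ᵖ k≤ᵖ)))))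

  small-er-proof : ∃ λ s → ERProofOfSize Γ circuit s × s ≤ n ^ 40
  small-er-proof = let (s , p , s≤) = er-proof in s , p , ≤-trans s≤ er-size

-- The GER⁻ proof of `I`.

occursIn? : ∀ v F → Dec (OccursIn v F)
occursIn? v F = map′
  (λ p → let (C , C∈ , q) = find p ; (l , l∈ , e) = find q in C , C∈ , l , l∈ , e)
  (λ (C , C∈ , l , l∈ , e) → lose C∈ (lose l∈ e))
  (any? (any? (λ l → var l ≟ v)) F)

occursIn-⊆ : ∀ {w F G} → F ⊆ G → OccursIn w F → OccursIn w G
occursIn-⊆ F⊆G (C , C∈ , rest) = C , F⊆G C∈ , rest

extVar-occurs : ∀ {es e} → e ∈ es → OccursIn (extVar e) (extFormula es)
extVar-occurs {e = x , p , q} e∈ = _ , ∈-concatMap⁺ extClauses (lose e∈ (here refl)) , neg x , here refl , refl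

extension-fresh : ∀ {Δ es e} → ExtensionFor Δ es → e ∈ es →
  ¬ OccursIn (extVar e) Δ × var (proj₁ (proj₂ e)) ≢ extVar e × var (proj₂ (proj₂ e)) ≢ extVar e
extension-fresh (ext x∉ p≢ q≢ _ _) (here refl) = x∉ , p≢ , q≢
extension-fresh {Δ} (ext _ _ _ _ E) (there e∈) = let (x∉ , rest) = extension-fresh E e∈ in
  x∉ ∘ occursIn-⊆ ∈-++⁺ˡ , rest

-- `j₀` shows that m is positive: only then does `V` contain the extension variables, so that a GER⁻
-- proof may use them.
module GERUpperBound
  {Γ : Formula} {es : List ExtStep} {m : ℕ} {y z : Fin m → Var}
  (extension : ExtensionFor Γ es) (fresh : FreshYZ Γ es m y z) (j₀ : Fin m)
  {v₀ : Var} (v₀∈Γ : OccursIn v₀ Γ) where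

  open IClauses Γ es y z

  IΓ : Formula
  IΓ = I Γ es m y z

  YZ : Var → Set
  YZ v = ∃ λ j → v ≡ y j ⊎ v ≡ z j

  y-fresh : ∀ {j} → ¬ OccursIn (y j) (Γ ++ extFormula es)
  y-fresh = proj₁ (proj₂ (proj₂ (proj₂ fresh))) _

  z-fresh : ∀ {j} → ¬ OccursIn (z j) (Γ ++ extFormula es)
  z-fresh = proj₂ (proj₂ (proj₂ (proj₂ fresh))) _

  y≢z : ∀ i j → y i ≢ z j
  y≢z = proj₁ (proj₂ (proj₂ fresh))

  yz-fresh : ∀ {v} → YZ v → ¬ OccursIn v (Γ ++ extFormula es)
  yz-fresh (j , inj₁ refl) = y-fresh
  yz-fresh (j , inj₂ refl) = z-fresh

  extVar-not-YZ : ∀ {e} → e ∈ es → ¬ YZ (extVar e)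
  extVar-not-YZ e∈ yz = yz-fresh yz (occursIn-⊆ (∈-++⁺ʳ Γ) (extVar-occurs e∈))

  extVar-occursIn-I : ∀ {e} → e ∈ es → OccursIn (extVar e) IΓ
  extVar-occursIn-I {e} e∈ = _ , V⊆I (proj₁ (∈-V⁺ e∈ j₀)) , pos (extVar e) , here refl , refl

  -- The ER proof may use variables that do not occur in I (as p or q, or in weakenings); they
  -- are all identified with v₀.
  σᵛ : Var → Var
  σᵛ v = if does (occursIn? v IΓ) then v else v₀

  σᵛ-fixes : ∀ {v} → OccursIn v IΓ → σᵛ v ≡ v
  σᵛ-fixes {v} occ rewrite dec-true (occursIn? v IΓ) occ = refl

  σᵛ-cases : ∀ v → σᵛ v ≡ v ⊎ σᵛ v ≡ v₀
  σᵛ-cases v = if-case (λ w → w ≡ v ⊎ w ≡ v₀) (occursIn? v IΓ) (λ _ → inj₁ refl) (λ _ → inj₂ refl)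

  σᵛ-occurs : ∀ v → OccursIn (σᵛ v) IΓ
  σᵛ-occurs v = if-case (λ w → OccursIn w IΓ) (occursIn? v IΓ) id (λ _ → occursIn-⊆ ∈-++⁺ˡ v₀∈Γ)

  σ : Lit → Lit
  σ (pos v) = pos (σᵛ v)
  σ (neg v) = neg (σᵛ v)

  var-σ : ∀ l → var (σ l) ≡ σᵛ (var l)
  var-σ (pos v) = refl
  var-σ (neg v) = refl

  σ-ᶜ : ∀ l → σ (l ᶜ) ≡ (σ l) ᶜ
  σ-ᶜ (pos v) = refl
  σ-ᶜ (neg v) = refl

  σ-fixes : ∀ {l} → OccursIn (var l) IΓ → σ l ≡ l
  σ-fixes {pos v} occ = cong pos (σᵛ-fixes occ)
  σ-fixes {neg v} occ = cong neg (σᵛ-fixes occ)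

  σ-varsIn : ∀ C → VarsIn (map σ C) IΓ
  σ-varsIn C l∈ with ∈-map⁻ σ l∈
  ... | l , _ , refl = subst (λ v → OccursIn v IΓ) (sym (var-σ l)) (σᵛ-occurs (var l))

  σ-pos : ∀ l → var (σ l) ≡ var l ⊎ var (σ l) ≡ v₀
  σ-pos l = subst (λ v → v ≡ var l ⊎ v ≡ v₀) (sym (var-σ l)) (σᵛ-cases (var l))

  -- Identifying variables can make σ p and σ q complementary; the third clause is then tautological
  -- and left out.
  extClausesᵟ : ExtStep → Formula
  extClausesᵟ (x , p , q) = (neg x ∷ σ p ∷ []) ∷ (neg x ∷ σ q ∷ []) ∷
    (if does (σ p ≟ᴸ (σ q ᶜ)) then [] else (pos x ∷ (σ p ᶜ) ∷ (σ q ᶜ) ∷ []) ∷ [])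

  Λ : Formula
  Λ = concatMap extClausesᵟ es

  length-Λ : length Λ ≤ 3 * length es
  length-Λ = go es
    where
    third : ∀ {P : Set} (d : Dec P) (C : Clause) → length (if does d then [] else C ∷ []) ≤ 1
    third (yes _) C = z≤n
    third (no _)  C = ≤-refl
    go : ∀ es → length (concatMap extClausesᵟ es) ≤ 3 * length es
    go []                 = z≤n
    go ((x , p , q) ∷ es) = begin
      length (extClausesᵟ (x , p , q) ++ concatMap extClausesᵟ es)
        ≡⟨ length-++ (extClausesᵟ (x , p , q)) ⟩
      length (extClausesᵟ (x , p , q)) + length (concatMap extClausesᵟ es)
        ≤⟨ +-mono-≤ (s≤s (s≤s (third (σ p ≟ᴸ (σ q ᶜ)) _))) (go es) ⟩
      3 + 3 * length es
        ≡⟨ *-suc 3 (length es) ⟨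
      3 * suc (length es) ∎
      where open ≤-Reasoning

  -- σ changes a variable only to v₀, which occurs in Γ and therefore differs from x.
  σ≢extVar : ∀ {x l} → ¬ OccursIn x Γ → var l ≢ x → var (σ l) ≢ x
  σ≢extVar {l = l} x∉ l≢ e with σ-pos l
  ... | inj₁ e′ = l≢ (trans (sym e′) e)
  ... | inj₂ e′ = x∉ (subst (λ v → OccursIn v Γ) (trans (sym e′) e) v₀∈Γ)

  ∈-Λ⁻ : ∀ {C} → C ∈ Λ → ∃ λ x → ∃ λ p → ∃ λ q → (x , p , q) ∈ es × C ∈ extClausesᵟ (x , p , q)
  ∈-Λ⁻ C∈ = let ((x , p , q) , e∈ , C∈e) = find (∈-concatMap⁻ extClausesᵟ {xs = es} C∈) in x , p , q , e∈ , C∈e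

  third⁻ : ∀ {x p q C} → C ∈ (if does (σ p ≟ᴸ (σ q ᶜ)) then [] else (pos x ∷ (σ p ᶜ) ∷ (σ q ᶜ) ∷ []) ∷ []) →
           σ p ≢ σ q ᶜ × C ≡ pos x ∷ (σ p ᶜ) ∷ (σ q ᶜ) ∷ []
  third⁻ {p = p} {q} C∈ with if-no⁻ (σ p ≟ᴸ (σ q ᶜ)) C∈
  ... | ≢ , here e = ≢ , e

  Λ-isClause : ∀ {C} → C ∈ Λ → IsClause C
  Λ-isClause {C} C∈ with ∈-Λ⁻ C∈
  ... | x , p , q , e∈ , C∈e = isClause C∈e
    where
    p≢x : var (σ p) ≢ x
    p≢x = let (x∉ , p≢ , _) = extension-fresh extension e∈ in σ≢extVar {l = p} x∉ p≢
    q≢x : var (σ q) ≢ x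
    q≢x = let (x∉ , _ , q≢) = extension-fresh extension e∈ in σ≢extVar {l = q} x∉ q≢
    isClause : C ∈ extClausesᵟ (x , p , q) → IsClause C
    isClause (here refl)         = ext₁-isClause {x} {σ p} {σ q} p≢x q≢x
    isClause (there (here refl)) = ext₂-isClause {x} {σ p} {σ q} p≢x q≢x
    isClause (there (there C∈))  with third⁻ {x} {p} {q} C∈
    ... | ≢ , refl = ext₃-isClause {x} {σ p} {σ q} p≢x q≢x ≢

  extClausesᵟ-vars : ∀ {x p q C l} → C ∈ extClausesᵟ (x , p , q) → l ∈ C →
                     var l ≡ x ⊎ var l ≡ var (σ p) ⊎ var l ≡ var (σ q)
  extClausesᵟ-vars {x} {p} {q} (here refl)         l∈ = extClauses-vars {x} {σ p} {σ q} (here refl) l∈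
  extClausesᵟ-vars {x} {p} {q} (there (here refl)) l∈ = extClauses-vars {x} {σ p} {σ q} (there (here refl)) l∈
  extClausesᵟ-vars {x} {p} {q} (there (there C∈))  l∈ with third⁻ {x} {p} {q} C∈
  ... | _ , refl = extClauses-vars {x} {σ p} {σ q} (there (there (here refl))) l∈

  Λ-varsIn : ∀ {C} → C ∈ Λ → VarsIn C IΓ
  Λ-varsIn C∈ {l} l∈ with ∈-Λ⁻ C∈
  ... | x , p , q , e∈ , C∈e with extClausesᵟ-vars {x} {p} {q} C∈e l∈
  ... | inj₁ e        = subst (λ v → OccursIn v IΓ) (sym e) (extVar-occursIn-I e∈)
  ... | inj₂ (inj₁ e) = subst (λ v → OccursIn v IΓ) (sym (trans e (var-σ p))) (σᵛ-occurs (var p))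
  ... | inj₂ (inj₂ e) = subst (λ v → OccursIn v IΓ) (sym (trans e (var-σ q))) (σᵛ-occurs (var q))

  -- V is blocked on the variables y: the only clause with ¬ y j is ¬ y j ∨ z j.
  YImpliesZ : Formula → Set
  YImpliesZ Δ = ∀ {D j} → D ∈ Δ → neg (y j) ∈ D → pos (z j) ∈ D

  blocked-V : ∀ Vs {Δ} → Vs ⊆ V es m y z → YImpliesZ Δ → BlockedSeq Δ Vs
  blocked-V []       Vs⊆ y⇒z = []
  blocked-V (C ∷ Vs) {Δ} Vs⊆ y⇒z with ∈-V⁻ (Vs⊆ (here refl))
  ... | e , j , e∈ , l , var-l , refl = (pos (y j) , there (here refl) , resolves) ∷ blocked-V Vs (Vs⊆ ∘ there) y⇒z′
    where
    resolves : ∀ D → D ∈ Δ → neg (y j) ∈ D →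
      TautPred (λ l′ → (l′ ∈ (l ∷ pos (y j) ∷ neg (z j) ∷ []) × l′ ≢ pos (y j)) ⊎ (l′ ∈ D × l′ ≢ neg (y j)))
    resolves D D∈ y∈ = neg (z j) , inj₁ (there (there (here refl)) , λ ()) , inj₂ (y⇒z D∈ y∈ , λ ())
    y⇒z′ : YImpliesZ ((l ∷ pos (y j) ∷ neg (z j) ∷ []) ∷ Δ)
    y⇒z′ (there D∈) y∈ = y⇒z D∈ y∈
    y⇒z′ {j = i} (here refl) (here e) = ⊥-elim (extVar-not-YZ e∈ (i , inj₁ (trans (sym var-l) (sym (cong var e)))))
    y⇒z′ {j = i} (here refl) (there (there (here e))) = ⊥-elim (y≢z i j (cong var e))

  -- Freshness carries over from the ER proof: `Γᶜ` is the formula which that proof extends, and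
  -- beyond its variables `Δ` has only y and z. So x is new to `Δ`; the first two clauses are
  -- blocked on ¬x, and the third on x, where it meets only those two.
  blocked-Λ : ∀ {Γᶜ} fs {Δ} → ExtensionFor Γᶜ fs → fs ⊆ es → Γ ⊆ Γᶜ →
    (∀ {w} → OccursIn w Δ → OccursIn w Γᶜ ⊎ YZ w) → YImpliesZ Δ →
    BlockedSeq Δ (concatMap extClausesᵟ fs ++ V es m y z)
  blocked-Λ [] _ _ _ _ y⇒z = blocked-V (V es m y z) id y⇒z
  blocked-Λ {Γᶜ} ((x , p , q) ∷ fs) {Δ} (ext x∉ p≢ q≢ _ E) fs⊆ Γ⊆ occ y⇒z =
    (neg x , here refl , λ D D∈ x∈ → ⊥-elim (x∉Δ (D , D∈ , pos x , x∈ , refl))) ∷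
    (neg x , here refl , second) ∷
    subst (BlockedSeq Δ₂) (sym (++-assoc (if does (σ p ≟ᴸ (σ q ᶜ)) then [] else C₃ ∷ []) _ _)) last-clause
    where
    C₁ C₂ C₃ : Clause
    C₁ = neg x ∷ σ p ∷ []
    C₂ = neg x ∷ σ q ∷ []
    C₃ = pos x ∷ (σ p ᶜ) ∷ (σ q ᶜ) ∷ []
    Δ₂ : Formula
    Δ₂ = C₂ ∷ C₁ ∷ Δ
    e∈ : (x , p , q) ∈ es
    e∈ = fs⊆ (here refl)
    x∉Δ : ¬ OccursIn x Δ
    x∉Δ x∈ = [ x∉ , extVar-not-YZ e∈ ]′ (occ x∈)
    p≢x : var (σ p) ≢ x
    p≢x = σ≢extVar {l = p} (x∉ ∘ occursIn-⊆ Γ⊆) p≢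
    q≢x : var (σ q) ≢ x
    q≢x = σ≢extVar {l = q} (x∉ ∘ occursIn-⊆ Γ⊆) q≢
    second : ∀ D → D ∈ C₁ ∷ Δ → pos x ∈ D → TautPred (λ l → (l ∈ C₂ × l ≢ neg x) ⊎ (l ∈ D × l ≢ pos x))
    second D (here refl) (there (here e)) = ⊥-elim (p≢x (sym (cong var e)))
    second D (there D∈) x∈ = ⊥-elim (x∉Δ (D , D∈ , pos x , x∈ , refl))
    third : ∀ D → D ∈ Δ₂ → neg x ∈ D → TautPred (λ l → (l ∈ C₃ × l ≢ pos x) ⊎ (l ∈ D × l ≢ neg x))
    third D (here refl) _ = (σ q ᶜ) ,
      inj₁ (there (there (here refl)) , λ e → q≢x (trans (sym (var-ᶜ (σ q))) (cong var e))) ,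
      inj₂ (there (here (ᶜ-involutive (σ q))) , λ e → q≢x (trans (cong var (sym (ᶜ-involutive (σ q)))) (cong var e)))
    third D (there (here refl)) _ = (σ p ᶜ) ,
      inj₁ (there (here refl) , λ e → p≢x (trans (sym (var-ᶜ (σ p))) (cong var e))) ,
      inj₂ (there (here (ᶜ-involutive (σ p))) , λ e → p≢x (trans (cong var (sym (ᶜ-involutive (σ p)))) (cong var e)))
    third D (there (there D∈)) x∈ = ⊥-elim (x∉Δ (D , D∈ , neg x , x∈ , refl))

    Γ⁺ : Formula
    Γ⁺ = Γᶜ ++ extClauses (x , p , q)
    old : ∀ {w} → OccursIn w Γᶜ → OccursIn w Γ⁺
    old = occursIn-⊆ ∈-++⁺ˡ
    new-x : OccursIn x Γ⁺
    new-x = _ , ∈-++⁺ʳ Γᶜ (here refl) , neg x , here refl , refl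
    new-p : OccursIn (var (σ p)) Γ⁺
    new-p with σ-pos p
    ... | inj₁ e = _ , ∈-++⁺ʳ Γᶜ (here refl) , p , there (here refl) , sym e
    ... | inj₂ e = subst (λ v → OccursIn v Γ⁺) (sym e) (old (occursIn-⊆ Γ⊆ v₀∈Γ))
    new-q : OccursIn (var (σ q)) Γ⁺
    new-q with σ-pos q
    ... | inj₁ e = _ , ∈-++⁺ʳ Γᶜ (there (here refl)) , q , there (here refl) , sym e
    ... | inj₂ e = subst (λ v → OccursIn v Γ⁺) (sym e) (old (occursIn-⊆ Γ⊆ v₀∈Γ))

    new-vars : ∀ {C l} → C ∈ extClauses (x , σ p , σ q) → l ∈ C → OccursIn (var l) Γ⁺
    new-vars C∈ l∈ with extClauses-vars {x} {σ p} {σ q} C∈ l∈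
    ... | inj₁ e        = subst (λ v → OccursIn v Γ⁺) (sym e) new-x
    ... | inj₂ (inj₁ e) = subst (λ v → OccursIn v Γ⁺) (sym e) new-p
    ... | inj₂ (inj₂ e) = subst (λ v → OccursIn v Γ⁺) (sym e) new-q

    y-not-new : ∀ {C j} → C ∈ extClauses (x , σ p , σ q) → neg (y j) ∉ C
    y-not-new {j = j} C∈ y∈ with extClauses-vars {x} {σ p} {σ q} C∈ y∈
    ... | inj₁ e = extVar-not-YZ e∈ (j , inj₁ (sym e))
    ... | inj₂ (inj₁ e) with σ-pos p
    ... | inj₁ e′ = y-fresh {j} (_ , ∈-++⁺ʳ Γ (∈-concatMap⁺ extClauses (lose e∈ (here refl))) , p , there (here refl) , sym (trans e e′))
    ... | inj₂ e′ = y-fresh {j} (occursIn-⊆ ∈-++⁺ˡ (subst (λ v → OccursIn v Γ) (sym (trans e e′)) v₀∈Γ))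
    y-not-new {j = j} C∈ y∈ | inj₂ (inj₂ e) with σ-pos q
    ... | inj₁ e′ = y-fresh {j} (_ , ∈-++⁺ʳ Γ (∈-concatMap⁺ extClauses (lose e∈ (there (here refl)))) , q , there (here refl) , sym (trans e e′))
    ... | inj₂ e′ = y-fresh {j} (occursIn-⊆ ∈-++⁺ˡ (subst (λ v → OccursIn v Γ) (sym (trans e e′)) v₀∈Γ))

    continue : ∀ {Δ′} → (∀ {D} → D ∈ Δ′ → D ∈ extClauses (x , σ p , σ q) ⊎ D ∈ Δ) →
               BlockedSeq Δ′ (concatMap extClausesᵟ fs ++ V es m y z)
    continue {Δ′} split = blocked-Λ fs E (fs⊆ ∘ there) (∈-++⁺ˡ ∘ Γ⊆) occ′ y⇒z′
      where
      occ′ : ∀ {w} → OccursIn w Δ′ → OccursIn w Γ⁺ ⊎ YZ w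
      occ′ (D , D∈ , l , l∈ , refl) with split D∈
      ... | inj₁ C∈ = inj₁ (new-vars C∈ l∈)
      ... | inj₂ D∈ with occ (D , D∈ , l , l∈ , refl)
      ... | inj₁ o  = inj₁ (old o)
      ... | inj₂ yz = inj₂ yz
      y⇒z′ : YImpliesZ Δ′
      y⇒z′ {j = j} D∈ y∈ with split D∈
      ... | inj₁ C∈ = ⊥-elim (y-not-new {j = j} C∈ y∈)
      ... | inj₂ D∈ = y⇒z D∈ y∈

    split₂ : ∀ {D} → D ∈ Δ₂ → D ∈ extClauses (x , σ p , σ q) ⊎ D ∈ Δ
    split₂ (here refl)         = inj₁ (there (here refl))
    split₂ (there (here refl)) = inj₁ (here refl)
    split₂ (there (there D∈))  = inj₂ D∈

    split₃ : ∀ {D} → D ∈ C₃ ∷ Δ₂ → D ∈ extClauses (x , σ p , σ q) ⊎ D ∈ Δ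
    split₃ (here refl) = inj₁ (there (there (here refl)))
    split₃ (there D∈)  = split₂ D∈

    last-clause : BlockedSeq Δ₂ ((if does (σ p ≟ᴸ (σ q ᶜ)) then [] else C₃ ∷ []) ++ (concatMap extClausesᵟ fs ++ V es m y z))
    last-clause = if-case (λ Cs → BlockedSeq Δ₂ (Cs ++ (concatMap extClausesᵟ fs ++ V es m y z))) (σ p ≟ᴸ (σ q ᶜ))
      (λ _ → continue split₂) (λ _ → (pos x , here refl , third) ∷ continue split₃)

  blocked-extension : BlockedExtension IΓ Λ
  blocked-extension = Λ-isClause , Γ ++ W Γ m y z , base⊆ , Λ ++ V es m y z , same , blocked
    where
    base : Formula
    base = Γ ++ W Γ m y z

    base⊆ : base ⊆F IΓ
    base⊆ (D , D∈ , eq) = D , [ ∈-++⁺ˡ , W⊆I ]′ (∈-++⁻ Γ D∈) , eq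

    occurs-base : ∀ {w} → OccursIn w base → OccursIn w Γ ⊎ YZ w
    occurs-base (D , D∈ , rest) with ∈-++⁻ Γ D∈
    ... | inj₁ p = inj₁ (D , p , rest)
    ... | inj₂ p = occursIn-W⁻ (D , p , rest)

    same : ∀ C → (C ∈F (Λ ++ V es m y z) → C ∈F Λ ⊎ (C ∈F IΓ × ¬ C ∈F base)) ×
                 (C ∈F Λ ⊎ (C ∈F IΓ × ¬ C ∈F base) → C ∈F (Λ ++ V es m y z))
    same C = to , from
      where
      to : C ∈F (Λ ++ V es m y z) → C ∈F Λ ⊎ (C ∈F IΓ × ¬ C ∈F base)
      to (D , D∈ , eq) with ∈-++⁻ Λ D∈
      ... | inj₁ p = inj₁ (D , p , eq)
      ... | inj₂ p with ∈-V⁻ p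
      -- A clause of `V` is not in the base, where no extension variable occurs.
      ... | e , j , e∈ , l , var-l , refl = inj₂ ((_ , V⊆I p , eq) , λ (D′ , D′∈ , eq′) →
        [ proj₁ (extension-fresh extension e∈) , extVar-not-YZ e∈ ]′
          (occurs-base (D′ , D′∈ , l , proj₂ eq′ (proj₁ eq (here refl)) , var-l)))
      from : C ∈F Λ ⊎ (C ∈F IΓ × ¬ C ∈F base) → C ∈F (Λ ++ V es m y z)
      from (inj₁ (D , D∈ , eq)) = D , ∈-++⁺ˡ D∈ , eq
      from (inj₂ ((D , D∈ , eq) , ∉base)) with ∈-I⁻ D∈
      ... | inj₁ p        = ⊥-elim (∉base (D , ∈-++⁺ˡ p , eq))
      ... | inj₂ (inj₁ p) = D , ∈-++⁺ʳ Λ p , eq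
      ... | inj₂ (inj₂ p) = ⊥-elim (∉base (D , ∈-++⁺ʳ Γ p , eq))

    blocked : BlockedSeq base (Λ ++ V es m y z)
    blocked = blocked-Λ es extension id id occurs-base y⇒z
      where
      y⇒z : YImpliesZ base
      y⇒z {D} {j} D∈ y∈ with ∈-++⁻ Γ D∈
      ... | inj₁ p = ⊥-elim (y-fresh {j} (D , ∈-++⁺ˡ p , neg (y j) , y∈ , refl))
      ... | inj₂ p with ∈-W⁻ p | y∈
      ... | i , inj₁ refl | here e = there (here (cong pos (cong z (proj₁ fresh j i (cong var e)))))
      ... | i , inj₁ refl | there (here ())
      ... | i , inj₂ (inj₁ (D′ , D′∈ , refl)) | there y∈′ = ⊥-elim (y-fresh {j} (D′ , ∈-++⁺ˡ D′∈ , neg (y j) , y∈′ , refl))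
      ... | i , inj₂ (inj₂ (D′ , D′∈ , refl)) | here e = ⊥-elim (y≢z j i (cong var e))
      ... | i , inj₂ (inj₂ (D′ , D′∈ , refl)) | there y∈′ = ⊥-elim (y-fresh {j} (D′ , ∈-++⁺ˡ D′∈ , neg (y j) , y∈′ , refl))

  -- σ may turn a clause into a tautology; such clauses are dropped from the derivation.
  Image : Formula → Clause → Set
  Image Ω C = Tautological (map σ C) ⊎ map σ C ∈ Ω

  ∈-map-σᶜ : ∀ {l C} → (l ᶜ) ∈ C → (σ l ᶜ) ∈ map σ C
  ∈-map-σᶜ {l} {C} p = subst (_∈ map σ C) (σ-ᶜ l) (∈-map⁺ σ p)

  -- If the resolved literal survives in the image of the resolvent, the image is a weakening of
  -- the image of a premise.
  σ-rule : ∀ {Δ Δ′ C} → (∀ {D} → D ∈ Δ → Image Δ′ D) → ¬ Tautological (map σ C) → ResRule Δ C → ResRule Δ′ (map σ C)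
  σ-rule {Δ} {Δ′} {C} image nt (inj₂ (A , A∈ , A⊆C , _)) = weakening (image A∈)
    where
    mapped : map σ A ⊆ map σ C
    mapped l∈ with ∈-map⁻ σ l∈
    ... | l , p , refl = ∈-map⁺ σ (A⊆C p)
    weakening : Image Δ′ A → ResRule Δ′ (map σ C)
    weakening (inj₁ (l , p , q)) = ⊥-elim (nt (l , mapped p , mapped q))
    weakening (inj₂ A′∈) = inj₂ (map σ A , A′∈ , mapped , nt)
  σ-rule {Δ} {Δ′} {C} image nt (inj₁ (A , B , l , A∈ , B∈ , l∈A , lᶜ∈B , iff , _)) =
    cases (σ l ∈ᴸ? map σ C) ((σ l ᶜ) ∈ᴸ? map σ C) (image A∈) (image B∈)
    where
    fromA : ∀ {l′} → l′ ∈ map σ A → l′ ≢ σ l → l′ ∈ map σ C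
    fromA p ≢ with ∈-map⁻ σ p
    ... | a , a∈ , refl = ∈-map⁺ σ (proj₂ (iff a) (inj₁ (a∈ , ≢ ∘ cong σ)))
    fromB : ∀ {l′} → l′ ∈ map σ B → l′ ≢ σ l ᶜ → l′ ∈ map σ C
    fromB p ≢ with ∈-map⁻ σ p
    ... | b , b∈ , refl = ∈-map⁺ σ (proj₂ (iff b) (inj₂ (b∈ , λ e → ≢ (trans (cong σ e) (σ-ᶜ l)))))
    A⊆C : σ l ∈ map σ C → map σ A ⊆ map σ C
    A⊆C l∈ {l′} p with l′ ≟ᴸ σ l
    ... | yes refl = l∈
    ... | no ≢     = fromA p ≢
    B⊆C : (σ l ᶜ) ∈ map σ C → map σ B ⊆ map σ C
    B⊆C l∈ {l′} p with l′ ≟ᴸ (σ l ᶜ)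
    ... | yes refl = l∈
    ... | no ≢     = fromB p ≢
    -- At most one member of a complementary pair in the image of A is σ l. What survives in the
    -- image of C is either the complement of σ l, which is excluded, or the whole pair, which would
    -- make that image tautological.
    A-not-taut : (σ l) ∉ map σ C → (σ l ᶜ) ∉ map σ C → ¬ Tautological (map σ A)
    A-not-taut l∉ lᶜ∉ (a , p , q) with a ≟ᴸ σ l | (a ᶜ) ≟ᴸ σ l
    ... | yes refl | _      = lᶜ∉ (fromA q (l≢lᶜ a ∘ sym))
    ... | no _  | yes e     = lᶜ∉ (fromA (subst (_∈ map σ A) (trans (sym (ᶜ-involutive a)) (cong _ᶜ e)) p) (l≢lᶜ (σ l) ∘ sym))
    ... | no ≢  | no ≢ᶜ     = nt (a , fromA p ≢ , fromA q ≢ᶜ)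
    B-not-taut : (σ l) ∉ map σ C → (σ l ᶜ) ∉ map σ C → ¬ Tautological (map σ B)
    B-not-taut l∉ lᶜ∉ (b , p , q) with b ≟ᴸ (σ l ᶜ) | (b ᶜ) ≟ᴸ (σ l ᶜ)
    ... | yes refl | _   = l∉ (fromB (subst (_∈ map σ B) (ᶜ-involutive (σ l)) q) (l≢lᶜ (σ l)))
    ... | no _  | yes e  = l∉ (fromB (subst (_∈ map σ B) (trans (sym (ᶜ-involutive b)) (trans (cong _ᶜ e) (ᶜ-involutive (σ l)))) p) (l≢lᶜ (σ l)))
    ... | no ≢  | no ≢ᶜ  = nt (b , fromB p ≢ , fromB q ≢ᶜ)
    resolve : (σ l) ∉ map σ C → (σ l ᶜ) ∉ map σ C → map σ A ∈ Δ′ → map σ B ∈ Δ′ → ResRule Δ′ (map σ C)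
    resolve l∉ lᶜ∉ A′∈ B′∈ = inj₁ (map σ A , map σ B , σ l , A′∈ , B′∈ , ∈-map⁺ σ l∈A , ∈-map-σᶜ lᶜ∈B ,
      (λ l′ → to , λ { (inj₁ (p , ≢)) → fromA p ≢ ; (inj₂ (p , ≢)) → fromB p ≢ }) , nt)
      where
      to : ∀ {l′} → l′ ∈ map σ C → (l′ ∈ map σ A × l′ ≢ σ l) ⊎ (l′ ∈ map σ B × l′ ≢ σ l ᶜ)
      to l′∈ with ∈-map⁻ σ l′∈
      ... | c , c∈ , refl with proj₁ (iff c) c∈
      ... | inj₁ (p , _) = inj₁ (∈-map⁺ σ p , λ e → l∉ (subst (_∈ map σ C) e l′∈))
      ... | inj₂ (p , _) = inj₂ (∈-map⁺ σ p , λ e → lᶜ∉ (subst (_∈ map σ C) e l′∈))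
    cases : Dec (σ l ∈ map σ C) → Dec ((σ l ᶜ) ∈ map σ C) → Image Δ′ A → Image Δ′ B → ResRule Δ′ (map σ C)
    cases (yes l∈) _ (inj₁ (a , p , q)) _ = ⊥-elim (nt (a , A⊆C l∈ p , A⊆C l∈ q))
    cases (yes l∈) _ (inj₂ A′∈) _         = inj₂ (map σ A , A′∈ , A⊆C l∈ , nt)
    cases (no _) (yes l∈) _ (inj₁ (b , p , q)) = ⊥-elim (nt (b , B⊆C l∈ p , B⊆C l∈ q))
    cases (no _) (yes l∈) _ (inj₂ B′∈)         = inj₂ (map σ B , B′∈ , B⊆C l∈ , nt)
    cases (no l∉) (no lᶜ∉) (inj₁ t) _          = ⊥-elim (A-not-taut l∉ lᶜ∉ t)
    cases (no l∉) (no lᶜ∉) (inj₂ _) (inj₁ t)   = ⊥-elim (B-not-taut l∉ lᶜ∉ t)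
    cases (no l∉) (no lᶜ∉) (inj₂ A′∈) (inj₂ B′∈) = resolve l∉ lᶜ∉ A′∈ B′∈

  σ-derivation : ∀ {Γ₁ Ω} → (∀ {C} → C ∈ Γ₁ → Image Ω C) → ∀ {Δ N} → Derivation ResRule Γ₁ Δ N →
    ∃ λ Δ′ → ∃ λ N′ → N′ ≤ N × Derivation (Restrict IΓ ResRule) Ω Δ′ N′ × (∀ {C} → C ∈ Δ → Image Δ′ C)
  σ-derivation {Ω = Ω} image start = Ω , 1 , ≤-refl , start , image
  σ-derivation image (step {C = C} d r) with σ-derivation image d | tautological? (map σ C)
  ... | Δ′ , N′ , N′≤ , d′ , im | yes t = Δ′ , N′ , m≤n⇒m≤1+n N′≤ , d′ , λ { (here refl) → inj₁ t ; (there D∈) → im D∈ }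
  ... | Δ′ , N′ , N′≤ , d′ , im | no nt = map σ C ∷ Δ′ , suc N′ , s≤s N′≤ , step d′ (σ-rule im nt r , σ-varsIn C) ,
    λ { (here refl) → inj₂ (here refl) ; (there D∈) → [ inj₁ , inj₂ ∘ there ]′ (im D∈) }

  image-start : ∀ {C} → C ∈ Γ ++ extFormula es → Image (IΓ ++ Λ) C
  image-start {C} C∈ with ∈-++⁻ Γ C∈
  ... | inj₁ p = inj₂ (∈-++⁺ˡ (subst (_∈ IΓ) (sym fixed) (∈-++⁺ˡ p)))
    where
    fixed : map σ C ≡ C
    fixed = map-id-local (All.tabulate λ {l} l∈ → σ-fixes (C , ∈-++⁺ˡ p , l , l∈ , refl))
  ... | inj₂ q with find (∈-concatMap⁻ extClauses {xs = es} q)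
  ... | (x , p , q) , e∈ , C∈e = image C∈e
    where
    σx : σᵛ x ≡ x
    σx = σᵛ-fixes (extVar-occursIn-I e∈)
    inΛ : ∀ {C} → C ∈ extClausesᵟ (x , p , q) → C ∈ IΓ ++ Λ
    inΛ C∈ = ∈-++⁺ʳ IΓ (∈-concatMap⁺ extClausesᵟ (lose e∈ C∈))
    image : ∀ {C} → C ∈ extClauses (x , p , q) → Image (IΓ ++ Λ) C
    image (here refl)         = inj₂ (inΛ (here (cong (λ x → neg x ∷ σ p ∷ []) σx)))
    image (there (here refl)) = inj₂ (inΛ (there (here (cong (λ x → neg x ∷ σ q ∷ []) σx))))
    image (there (there (here refl))) with σ p ≟ᴸ (σ q ᶜ)
    ... | yes e = inj₁ (σ (p ᶜ) , there (here refl) , there (there (here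
      (trans (cong _ᶜ (trans (σ-ᶜ p) (trans (cong _ᶜ e) (ᶜ-involutive (σ q))))) (sym (σ-ᶜ q))))))
    ... | no p≢ = inj₂ (inΛ (there (there (if-no⁺ (σ p ≟ᴸ (σ q ᶜ)) p≢
      (here (cong₂ _∷_ (cong pos σx) (cong₂ (λ a b → a ∷ b ∷ []) (σ-ᶜ p) (σ-ᶜ q))))))))

  ger-proof : ∀ {N b} → ResProof (Γ ++ extFormula es) N → 3 * length es + N ≤ b → HasGER⁻ProofOfSize≤ IΓ b
  ger-proof {N} {b} (Δ , d , (D , D∈ , D≋[])) bound with σ-derivation image-start d
  ... | Δ′ , N′ , N′≤ , d′ , im = Λ , blocked-extension , Λ-varsIn , N′ , (Δ′ , d′ , [] , empty , id , id) ,
    ≤-trans (+-mono-≤ length-Λ N′≤) bound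
    where
    empty : [] ∈ Δ′
    empty with im (subst (_∈ Δ) (≋[]⇒≡ D≋[]) D∈)
    ... | inj₁ (_ , () , _)
    ... | inj₂ p = p

-- Logarithms and the theorem.

2^⌊log₂n⌋≤n : ∀ n → 1 ≤ n → 2 ^ ⌊log₂ n ⌋ ≤ n
2^⌊log₂n⌋≤n = <-rec _ halve
  where
  open ≤-Reasoning
  1≤log : ∀ n → 1 ≤ ⌊log₂ suc (suc n) ⌋
  1≤log n = subst (_≤ ⌊log₂ suc (suc n) ⌋) (⌊log₂[2^n]⌋≡n 1) (⌊log₂⌋-mono-≤ {2} {suc (suc n)} (s≤s (s≤s z≤n)))
  halve : ∀ n → (∀ {m} → m < n → 1 ≤ m → 2 ^ ⌊log₂ m ⌋ ≤ m) → 1 ≤ n → 2 ^ ⌊log₂ n ⌋ ≤ n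
  halve 1                 rec _ = ≤-refl
  halve n@(suc (suc n′)) rec _ = begin
    2 ^ ⌊log₂ n ⌋             ≡⟨ cong (2 ^_) (m+[n∸m]≡n (1≤log n′)) ⟨
    2 * 2 ^ (⌊log₂ n ⌋ ∸ 1)   ≡⟨ cong (λ e → 2 * 2 ^ e) (⌊log₂⌊n/2⌋⌋≡⌊log₂n⌋∸1 n) ⟨
    2 * 2 ^ ⌊log₂ ⌊ n /2⌋ ⌋   ≤⟨ *-monoʳ-≤ 2 (rec (⌊n/2⌋<n (suc n′)) (s≤s z≤n)) ⟩
    2 * ⌊ n /2⌋               ≡⟨ cong (⌊ n /2⌋ +_) (+-identityʳ _) ⟩
    ⌊ n /2⌋ + ⌊ n /2⌋         ≤⟨ +-monoʳ-≤ ⌊ n /2⌋ (⌊n/2⌋≤⌈n/2⌉ n) ⟩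
    ⌊ n /2⌋ + ⌈ n /2⌉         ≡⟨ ⌊n/2⌋+⌈n/2⌉≡n n ⟩
    n ∎

2^m≤n⇒m≤⌊log₂n⌋ : ∀ m {n} → 2 ^ m ≤ n → m ≤ ⌊log₂ n ⌋
2^m≤n⇒m≤⌊log₂n⌋ m p = subst (_≤ _) (⌊log₂[2^n]⌋≡n m) (⌊log₂⌋-mono-≤ p)

2^m≤n⇒m≤⌈log₂n⌉ : ∀ m {n} → 2 ^ m ≤ n → m ≤ ⌈log₂ n ⌉
2^m≤n⇒m≤⌈log₂n⌉ m p = subst (_≤ _) (⌈log₂2^n⌉≡n m) (⌈log₂⌉-mono-≤ p)

n<2^[1+⌊log₂n⌋] : ∀ n → n < 2 ^ suc ⌊log₂ n ⌋
n<2^[1+⌊log₂n⌋] n = ≰⇒> λ p → <-irrefl refl (2^m≤n⇒m≤⌊log₂n⌋ (suc ⌊log₂ n ⌋) p)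

derivation-nonempty : ∀ {R Γ Δ N} → Derivation R Γ Δ N → 1 ≤ N
derivation-nonempty start      = s≤s z≤n
derivation-nonempty (step _ _) = s≤s z≤n

-- No axiom is empty, so a proof has at least one step. Hence m is positive, as the GER⁻
-- construction requires.
bphp-size≥2 : ∀ k .{{_ : NonZero k}} {s} → SBC⁻Proof (BPHP2^ k) s → 2 ≤ s
bphp-size≥2 k (_ , step d _ , _) = s≤s (derivation-nonempty d)
bphp-size≥2 k (_ , start , (D , D∈ , D≋[])) = ⊥-elim (nonempty (∈-BPHP⁻ k D∈) (≋[]⇒≡ D≋[]))
  where
  nonempty : ∀ {D} → Axiom k D → D ≢ []
  nonempty (axiom {x} {y} {h} _ _ _ len) e with vars-holeLits k x len (>-nonZero⁻¹ k)
  ... | l , l∈ , _ with () ← subst (l ∈_) e (∈-++⁺ˡ {ys = holeLits k y h} l∈)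

theorem27 : (Σ ℕ λ c → Σ ℕ λ n₀ → ∀ n → 2 ≤ n → n₀ ≤ n →
    ∀ s → IsSizeSBC⁻ (BPHP n) s →
    ∀ (es : List ExtStep) → IsMinERExtension (BPHP n) es →
    ∀ (y z : Fin ⌈log₂ s ⌉ → Var) → FreshYZ (BPHP n) es ⌈log₂ s ⌉ y z →
    HasGER⁻ProofOfSize≤ (I (BPHP n) es ⌈log₂ s ⌉ y z) (n ^ c))
    ×
    (Σ ℕ λ d → Σ ℕ λ n₀ → ∀ n → 2 ≤ n → n₀ ≤ n →
    ∀ s → IsSizeSBC⁻ (BPHP n) s →
    ∀ (es : List ExtStep) → IsMinERExtension (BPHP n) es →
    ∀ (y z : Fin ⌈log₂ s ⌉ → Var) → FreshYZ (BPHP n) es ⌈log₂ s ⌉ y z →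
    ∀ N → SBC⁻Proof (I (BPHP n) es ⌈log₂ s ⌉ y z) N →
    2 ^ (n / suc d) ≤ N)
-- The divisor 48 = `suc 47` is twice 24, because n is less than twice the power of two 2^k to which
-- it is rounded down. From n = 8 on, this power is at least 8.
theorem27 = (40 , 2 , upper) , (47 , 8 , lower)
  where
  upper : ∀ n → 2 ≤ n → 2 ≤ n → ∀ s → IsSizeSBC⁻ (BPHP n) s → ∀ es → IsMinERExtension (BPHP n) es →
    ∀ y z → FreshYZ (BPHP n) es ⌈log₂ s ⌉ y z → HasGER⁻ProofOfSize≤ (I (BPHP n) es ⌈log₂ s ⌉ y z) (n ^ 40)
  upper n 2≤n _ s (proof , _) es (s′ , (extension , N , res , size) , least) y z fresh =
    GERUpperBound.ger-proof extension fresh (fromℕ< 1≤m) (pigeonVar⇒occursIn {0} 0<Sk) res (begin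
      3 * length es + N          ≡⟨ size ⟩
      s′                         ≤⟨ least circuit _ (proj₁ (proj₂ small-er-proof)) ⟩
      proj₁ small-er-proof       ≤⟨ proj₂ (proj₂ small-er-proof) ⟩
      (2 ^ k) ^ 40               ≤⟨ ^-monoˡ-≤ 40 (2^⌊log₂n⌋≤n n (≤-trans (n≤1+n 1) 2≤n)) ⟩
      n ^ 40                     ∎)
    where
    open ≤-Reasoning
    k : ℕ
    k = ⌊log₂ n ⌋
    instance
      k≢0 : NonZero k
      k≢0 = >-nonZero (2^m≤n⇒m≤⌊log₂n⌋ 1 2≤n)
    open Cook k using (circuit)
    open CookProof k using (small-er-proof)
    open SetBlockedClauses k using (pigeonVar⇒occursIn)
    1≤m : 1 ≤ ⌈log₂ s ⌉
    1≤m = 2^m≤n⇒m≤⌈log₂n⌉ 1 (bphp-size≥2 k proof)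
    0<Sk : 0 < suc (2 ^ k) * k
    0<Sk = ≤-trans (>-nonZero⁻¹ k) (m≤m+n k (2 ^ k * k))

  lower : ∀ n → 2 ≤ n → 8 ≤ n → ∀ s → IsSizeSBC⁻ (BPHP n) s → ∀ es → IsMinERExtension (BPHP n) es →
    ∀ y z → FreshYZ (BPHP n) es ⌈log₂ s ⌉ y z → ∀ N → SBC⁻Proof (I (BPHP n) es ⌈log₂ s ⌉ y z) N → 2 ^ (n / 48) ≤ N
  -- Up to 2^m steps some setting of the pairs works for the whole proof. Beyond that, N exceeds
  -- 2^m, whose exponent is already at least 2^k / 24 by the bound for BPHP.
  lower n _ 8≤n s (proof , _) es _ y z fresh N proofI = [ small , large ]′ (≤-<-connex N (2 ^ ⌈log₂ s ⌉))
    where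
    open ≤-Reasoning
    k : ℕ
    k = ⌊log₂ n ⌋
    3≤k : 3 ≤ k
    3≤k = 2^m≤n⇒m≤⌊log₂n⌋ 3 8≤n
    instance
      k≢0 : NonZero k
      k≢0 = >-nonZero (≤-trans (s≤s z≤n) 3≤k)
    open SBC⁻LowerBound k (^-monoʳ-≤ 2 3≤k) using (bphp-lower-bound; I-lower-bound)
    exponent : n / 48 ≤ 2 ^ k / 24
    exponent = begin
      n / 48              ≤⟨ /-monoˡ-≤ 48 (<⇒≤ (n<2^[1+⌊log₂n⌋] n)) ⟩
      2 * 2 ^ k / 48      ≡⟨ m*n/m*o≡n/o 2 (2 ^ k) 24 ⟩
      2 ^ k / 24          ∎
    small : N ≤ 2 ^ ⌈log₂ s ⌉ → 2 ^ (n / 48) ≤ N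
    small N≤ = ≤-trans (^-monoʳ-≤ 2 exponent) (I-lower-bound {es} fresh N≤ proofI)
    large : 2 ^ ⌈log₂ s ⌉ < N → 2 ^ (n / 48) ≤ N
    large <N = ≤-trans (^-monoʳ-≤ 2 (≤-trans exponent
      (2^m≤n⇒m≤⌈log₂n⌉ (2 ^ k / 24) (bphp-lower-bound proof)))) (<⇒≤ <N)
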